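{- For all bipartitions $(\lambda,\mu)\vdash n$ and $(\alpha,\beta)\vdash n$, and for every signed composition $\gamma$ of $n$ obtained by arranging in some order the parts of $\alpha$ (unbarred) and the parts of $\beta$ (barred), $$\chi^{\lambda,\mu}(\alpha,\beta)=\sum_{Q\in\mathrm{SYT}(\lambda,\mu)}\mathrm{wt}_\gamma(\mathrm{sDes}(Q)).$$ In other words, $\mathrm{SYT}(\lambda,\mu)$ with the map $\mathrm{sDes}$ is a fine set for the irreducible character $\chi^{\lambda,\mu}$.
   Context: $B_n$ is the hyperoctahedral group. Its conjugacy classes are indexed by signed cycle types $(\alpha,\beta)\vdash n$ (viewing $w$ as a permutation of $\{1,\dots,n,\bar1,\dots,\bar n\}$, $\alpha$ lists lengths of positive cycles — pairs of disjoint cycles $c,\bar c$, length $|c|$ — and $\beta$ lengths of negative cycles $c=\bar c$, length $|c|/2$); $\chi(\alpha,\beta)$ is the value of a class function there. $\chi^{\lambda,\mu}$ is the irreducible character of $B_n$ indexed by the bipartition $(\lambda,\mu)$, normalized so that its Frobenius characteristic $\frac{1}{2^nn!}\sum_w\chi^{\lambda,\mu}(w)p^+_{\alpha(w)}p^-_{\beta(w)}$ equals $s_\lambda(x)s_\mu(y)$, where $p^\pm_k=\sum_i(x_i^k\pm y_i^k)$. A standard Young bitableau of shape $(\lambda,\mu)$ is a pair $Q=(Q^+,Q^-)$ of row- and column-strictly increasing fillings of shapes $\lambda,\mu$ using each element of $[n]$ once; $\mathrm{SYT}(\lambda,\mu)$ is their set. $\mathrm{sDes}(Q)=(S,\varepsilon)$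 where $S$ consists of $n$ and all $s\in[n-1]$ such that either $s,s+1$ are in the same tableau and $s+1$ is in a lower row than $s$, or $s,s+1$ are in different tableaux; $\varepsilon(s)=+$ if $s\in Q^+$ and $-$ otherwise. Its sign vector is $\tilde\varepsilon(j)=+$ iff $j\in Q^+$. For a signed composition $\gamma$ (composition of $n$ with some parts barred) with partial sums $0=r_0<r_1<\dots<r_k=n$, $S(\gamma)=\{r_1,\dots,r_k\}$, blocks $I_i=\{r_{i-1}+1,\dots,r_i\}$, and a pair $\sigma=(S,\varepsilon)$ ($n\in S\subseteq[n]$, $\varepsilon:S\to\{\pm\}$, sign vector $\tilde\varepsilon(j)=\varepsilon(\min\{s\in S:s\ge j\})$): $\mathrm{wt}_\gamma(\sigma)=0$ if for some $i$ the set $S\cap\{r_{i-1}+1,\dots,r_i-1\}$ is not an initial segment of $\{r_{i-1}+1,\dots,r_i-1\}$ or $\tilde\varepsilon$ is not constant on $I_i$; otherwise $\mathrm{wt}_\gamma(\sigma)=(-1)^{|S\setminus S(\gamma)|+n_\gamma(\sigma)}$, where $n_\gamma(\sigma)$ counts the $i$ with $\tilde\varepsilon=-$ on $I_i$ and the $i$-th part of $\gamma$ barred. -}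

module Defs where

open import Data.Bool using (Bool; true; false; _∧_; _∨_; not; if_then_else_; _xor_)
open import Data.Nat as ℕ using (ℕ; zero; suc; _+_; _*_; _∸_; _≡ᵇ_; _<ᵇ_; _≤ᵇ_; _<_; _≥_)
open import Data.Nat using (_!)
open import Data.Integer as ℤ using (ℤ; 0ℤ; 1ℤ; -_) renaming (+_ to ⁺_)
open import Data.Fin as Fin using (Fin; toℕ)
open import Data.List as List using (List; []; _∷_; _++_; map; concatMap; foldr; upTo; length; filterᵇ; zip)
open import Data.Bool.ListAction using (all; any)
open import Data.Nat.ListAction using (sum)
open import Data.List.Relation.Unary.All using (All)
open import Data.List.Relation.Unary.Linked using (Linked)
open import Data.Vec as Vec using (Vec; []; _∷_; tabulate)
open import Data.Product using (_×_; _,_; proj₁; proj₂)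
open import Relation.Binary.PropositionalEquality using (_≡_)

interval : ℕ → ℕ → List ℕ
interval a b = map (λ t → a + t) (upTo (suc b ∸ a))

allLists : ℕ → {A : Set} → List A → List (List A)
allLists zero    xs = [] ∷ []
allLists (suc k) xs = concatMap (λ x → map (x ∷_) (allLists k xs)) xs

allVecs : (k : ℕ) → {A : Set} → List A → List (Vec A k)
allVecs zero    xs = [] ∷ []
allVecs (suc k) xs = concatMap (λ x → map (x ∷_) (allVecs k xs)) xs

allFinL : (n : ℕ) → List (Fin n)
allFinL n = Vec.toList (Vec.allFin n)

sumℤ : List ℤ → ℤ
sumℤ = foldr ℤ._+_ 0ℤ

count : {A : Set} → (A → Bool) → List A → ℕ
count p xs = length (filterᵇ p xs)

indexed : {A : Set} → List A → List (ℕ × A)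
indexed xs = zip (upTo (length xs)) xs

at : {A : Set} → A → List A → ℕ → A
at d []       _       = d
at d (x ∷ xs) zero    = x
at d (x ∷ xs) (suc i) = at d xs i

eqℕ : ℕ → ℕ → Bool
eqℕ = _≡ᵇ_

eqBool : Bool → Bool → Bool
eqBool a b = not (a xor b)

eqVecℕ : {k : ℕ} → Vec ℕ k → Vec ℕ k → Bool
eqVecℕ []       []       = true
eqVecℕ (x ∷ xs) (y ∷ ys) = eqℕ x y ∧ eqVecℕ xs ys

insertDesc : ℕ → List ℕ → List ℕ
insertDesc x []       = x ∷ []
insertDesc x (y ∷ ys) = if y ≤ᵇ x then x ∷ y ∷ ys else y ∷ insertDesc x ys

sortDesc : List ℕ → List ℕ
sortDesc = foldr insertDesc []

IsPartition : List ℕ → Set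
IsPartition p = All (λ k → 0 < k) p × Linked _≥_ p

size : List ℕ → ℕ
size = sum

-- cells (row , column), 0-indexed, English convention (row 0 on top)
cellsOfShape : List ℕ → List (ℕ × ℕ)
cellsOfShape p = concatMap (λ (i , r) → map (λ j → (i , j)) (upTo r)) (indexed p)

adjacentRC : ℕ × ℕ → ℕ × ℕ → Bool
adjacentRC (i , j) (i' , j') =
  (eqℕ i' i ∧ eqℕ j' (suc j)) ∨ (eqℕ j' j ∧ eqℕ i' (suc i))

rightOf : ℕ × ℕ → ℕ × ℕ → Bool
rightOf (i , j) (i' , j') = eqℕ i' i ∧ eqℕ j' (suc j)

belowOf : ℕ × ℕ → ℕ × ℕ → Bool
belowOf (i , j) (i' , j') = eqℕ j' j ∧ eqℕ i' (suc i)

-- Polynomials in variables x_1..x_N, y_1..y_N with integer coefficients,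
-- represented as formal lists of terms (coefficient , (x-exponents , y-exponents)).

Mono : ℕ → Set
Mono N = Vec ℕ N × Vec ℕ N

Poly : ℕ → Set
Poly N = List (ℤ × Mono N)

eqMono : {N : ℕ} → Mono N → Mono N → Bool
eqMono (a , b) (a' , b') = eqVecℕ a a' ∧ eqVecℕ b b'

coeff : {N : ℕ} → Poly N → Mono N → ℤ
coeff p m = sumℤ (map (λ (c , m') → if eqMono m m' then c else 0ℤ) p)

_⊗_ : {N : ℕ} → Poly N → Poly N → Poly N
p ⊗ q = concatMap (λ (c , (a , b)) →
          map (λ (d , (a' , b')) → (c ℤ.* d , (Vec.zipWith _+_ a a' , Vec.zipWith _+_ b b'))) q) p

onePoly : {N : ℕ} → Poly N
onePoly {N} = (1ℤ , (Vec.replicate N 0 , Vec.replicate N 0)) ∷ []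

prodPoly : {N : ℕ} → List (Poly N) → Poly N
prodPoly = foldr _⊗_ onePoly

kE : {N : ℕ} → ℕ → Fin N → Vec ℕ N
kE k i = tabulate (λ j → if eqℕ (toℕ i) (toℕ j) then k else 0)

pPlus pMinus : (N : ℕ) → ℕ → Poly N
pPlus  N k = map (λ i → (1ℤ , (kE k i , Vec.replicate N 0))) (allFinL N)
          ++ map (λ i → (1ℤ , (Vec.replicate N 0 , kE k i))) (allFinL N)
pMinus N k = map (λ i → (1ℤ , (kE k i , Vec.replicate N 0))) (allFinL N)
          ++ map (λ i → (- 1ℤ , (Vec.replicate N 0 , kE k i))) (allFinL N)

pPM : (N : ℕ) → List ℕ → List ℕ → Poly N
pPM N α β = prodPoly (map (pPlus N) α) ⊗ prodPoly (map (pMinus N) β)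

-- semistandard Young tableaux of shape p with entries in Fin N:
-- a filling lists the entries of the cells in the order of cellsOfShape p
isSSYT : {N : ℕ} → List ℕ → List (Fin N) → Bool
isSSYT p f =
  all (λ (c , u) → all (λ (d , v) →
        (not (rightOf c d) ∨ (toℕ u ≤ᵇ toℕ v)) ∧ (not (belowOf c d) ∨ (toℕ u <ᵇ toℕ v)))
      cf) cf
  where cf = zip (cellsOfShape p) f

SSYT : (N : ℕ) → List ℕ → List (List (Fin N))
SSYT N p = filterᵇ (isSSYT p) (allLists (length (cellsOfShape p)) (allFinL N))

content : {N : ℕ} → List (Fin N) → Vec ℕ N
content f = tabulate (λ i → count (λ u → eqℕ (toℕ u) (toℕ i)) f)

schurXY : (N : ℕ) → List ℕ → List ℕ → Poly N
schurXY N la mu =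
  concatMap (λ T → map (λ U → (1ℤ , (content T , content U))) (SSYT N mu)) (SSYT N la)

-- The hyperoctahedral group B_n as signed permutations of {1..n, 1̄..n̄}.
-- An element is (π , ε) with π a permutation of Fin n and ε : signs;
-- it sends i ↦ π(i) if ε_i = false, i ↦ \bar{π(i)} if ε_i = true, and
-- commutes with the bar involution.  A signed point is (i , barred?).

injectiveV : {n : ℕ} → Vec (Fin n) n → Bool
injectiveV {n} π = all (λ i → all (λ j → eqℕ (toℕ i) (toℕ j) ∨
                     not (eqℕ (toℕ (Vec.lookup π i)) (toℕ (Vec.lookup π j)))) (allFinL n)) (allFinL n)

SignedPerm : ℕ → Set
SignedPerm n = Vec (Fin n) n × Vec Bool n

Bn : (n : ℕ) → List (SignedPerm n)
Bn n = concatMap (λ π → map (λ ε → (π , ε)) (allVecs n (true ∷ false ∷ [])))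
                 (filterᵇ injectiveV (allVecs n (allFinL n)))

act : {n : ℕ} → SignedPerm n → Fin n × Bool → Fin n × Bool
act (π , ε) (i , s) = (Vec.lookup π i , s xor Vec.lookup ε i)

iter : {n : ℕ} → SignedPerm n → ℕ → Fin n × Bool → Fin n × Bool
iter w zero    x = x
iter w (suc k) x = act w (iter w k x)

returnTime : {n : ℕ} → SignedPerm n → Fin n → ℕ
returnTime {n} w i = firstHit (interval 1 n)
  where
  firstHit : List ℕ → ℕ
  firstHit []       = n
  firstHit (k ∷ ks) = if eqℕ (toℕ (proj₁ (iter w k (i , false)))) (toℕ i) then k else firstHit ks

-- the cycle through i is negative (contains both i and ī)
negCycle : {n : ℕ} → SignedPerm n → Fin n → Bool
negCycle w i = proj₂ (iter w (returnTime w i) (i , false))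

isRep : {n : ℕ} → SignedPerm n → Fin n → Bool
isRep w i = all (λ k → toℕ i <ᵇ toℕ (proj₁ (iter w k (i , false))))
                (interval 1 (returnTime w i ∸ 1))

alphaOf betaOf : {n : ℕ} → SignedPerm n → List ℕ
alphaOf {n} w = sortDesc (map (returnTime w)
  (filterᵇ (λ i → isRep w i ∧ not (negCycle w i)) (allFinL n)))
betaOf {n} w = sortDesc (map (returnTime w)
  (filterᵇ (λ i → isRep w i ∧ negCycle w i) (allFinL n)))

-- χ is the irreducible character χ^{λ,μ} of B_n: its Frobenius characteristic
--   (1/(2^n n!)) Σ_{w ∈ B_n} χ(α(w),β(w)) p^+_{α(w)} p^-_{β(w)}
-- equals s_λ(x) s_μ(y), as an identity in any finite number N of x- and
-- y-variables (coefficientwise, after multiplying by 2^n n!).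

IsIrrChar : (n : ℕ) → List ℕ → List ℕ → (List ℕ → List ℕ → ℤ) → Set
IsIrrChar n la mu χ = (N : ℕ) → (m : Mono N) →
  sumℤ (map (λ w → χ (alphaOf w) (betaOf w) ℤ.* coeff (pPM N (alphaOf w) (betaOf w)) m) (Bn n))
  ≡ (⁺ (2 ℕ.^ n * n !)) ℤ.* coeff (schurXY N la mu) m

-- Standard Young bitableaux.
-- A cell of the bipartition (λ,μ) is (tab , (row , col)) with tab = true for λ (Q⁺)
-- and tab = false for μ (Q⁻).  A bitableau Q is encoded by the list whose (j-1)-th
-- entry is the cell containing j (j = 1..n).

Cell : Set
Cell = Bool × (ℕ × ℕ)

cellsBi : List ℕ → List ℕ → List Cell
cellsBi la mu = map (true ,_) (cellsOfShape la) ++ map (false ,_) (cellsOfShape mu)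

eqCell : Cell → Cell → Bool
eqCell (t , (i , j)) (t' , (i' , j')) = eqBool t t' ∧ eqℕ i i' ∧ eqℕ j j'

isSYT : List Cell → Bool
isSYT Q = all (λ (j , c) → all (λ (k , d) →
              (eqℕ j k ∨ not (eqCell c d)) ∧
              (not (eqBool (proj₁ c) (proj₁ d) ∧ adjacentRC (proj₂ c) (proj₂ d)) ∨ (j <ᵇ k)))
            (indexed Q)) (indexed Q)

-- SYT(λ,μ) for (λ,μ) ⊢ n: bijective fillings of the n cells by 1..n
SYT : ℕ → List ℕ → List ℕ → List (List Cell)
SYT n la mu = filterᵇ isSYT (allLists n (cellsBi la mu))

-- pairs σ = (S , ε): S ⊆ [n] as a predicate on ℕ, ε : signs (true = +), read on S
SignedSet : Set
SignedSet = (ℕ → Bool) × (ℕ → Bool)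

cellOf : List Cell → ℕ → Cell
cellOf Q j = at (true , (0 , 0)) Q (j ∸ 1)

sDes : ℕ → List Cell → SignedSet
sDes n Q = S , ε
  where
  S : ℕ → Bool
  S s = eqℕ s n ∨
        ((s <ᵇ n) ∧ (not (eqBool (proj₁ (cellOf Q s)) (proj₁ (cellOf Q (suc s))))
                     ∨ (proj₁ (proj₂ (cellOf Q s)) <ᵇ proj₁ (proj₂ (cellOf Q (suc s))))))
  ε : ℕ → Bool
  ε s = proj₁ (cellOf Q s)

-- sign vector ε̃(j) = ε(min {s ∈ S : s ≥ j})   (for 1 ≤ j ≤ n, assuming n ∈ S)
epsTilde : ℕ → SignedSet → ℕ → Bool
epsTilde n (S , ε) j = go (n ∸ j) j
  where
  go : ℕ → ℕ → Bool
  go zero    s = ε s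
  go (suc k) s = if S s then ε s else go k (suc s)

-- Signed compositions: lists of (part , barred?)

arrangement : List ℕ → List ℕ → List (ℕ × Bool)
arrangement α β = map (_, false) α ++ map (_, true) β

blocks : List (ℕ × Bool) → List (ℕ × ℕ × Bool)
blocks γ = go 0 γ
  where
  go : ℕ → List (ℕ × Bool) → List (ℕ × ℕ × Bool)
  go a []             = []
  go a ((c , b) ∷ cs) = (a , a + c , b) ∷ go (a + c) cs

inSγ : List (ℕ × Bool) → ℕ → Bool
inSγ γ s = any (λ (a , r , b) → eqℕ s r) (blocks γ)

wt : ℕ → List (ℕ × Bool) → SignedSet → ℤ
wt n γ σ =
  if all blockOK (blocks γ)
  then (- 1ℤ) ℤ.^ (count (λ s → S s ∧ not (inSγ γ s)) (interval 1 n) + nγ)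
  else 0ℤ
  where
  S : ℕ → Bool
  S = proj₁ σ
  et : ℕ → Bool
  et = epsTilde n σ
  -- S ∩ {a+1..r-1} is an initial segment of {a+1..r-1}, and ε̃ is constant on {a+1..r}
  blockOK : ℕ × ℕ × Bool → Bool
  blockOK (a , r , b) =
    all (λ s → not (not (S s) ∧ S (suc s))) (interval (suc a) (r ∸ 2)) ∧
    all (λ j → eqBool (et j) (et (suc j))) (interval (suc a) (r ∸ 1))
  nγ : ℕ
  nγ = count (λ (a , r , b) → b ∧ not (et r)) (blocks γ)

{-# OPTIONS --safe #-}
-- Write p_k = Σ_c (-1)^(ℓ(c)-1) c_last h_c, the sum being over the compositions c of k.  Pairing with the product
-- of the p^±_k over the parts k of γ is therefore an explicit integer combination of coefficient extractions, and
-- this functional L is applied to both sides of the Frobenius characteristic identity.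
--
-- On a product of power sums of type δ, an induction on the set of parts sent to the first variable shows that L
-- vanishes unless δ is a rearrangement of γ, in which case its value is the order of the centralizer.  Hence L maps
-- the left-hand side to 2^n n! χ(α,β).
--
-- On s_λ(x) s_μ(y), standardization identifies the coefficient at a signed composition with the number of standard
-- bitableaux having these signs and no descent inside a part.  For a fixed bitableau with descent set D in a block,
-- the alternating sum over the compositions whose part boundaries contain D is (-1)^|D| if D is an initial segment
-- and 0 otherwise, so L maps the right-hand side to 2^n n! Σ_Q wt_γ(sDes Q).
module Submission where

open import Defs
open import Data.Bool using (Bool; true; false; T; T?; _∧_; _∨_; not; _xor_; if_then_else_)
open import Data.Bool.ListAction using (all; any)
open import Data.Bool.Properties as Boolₚ using (T-∧; T-∨)
open import Data.Empty using (⊥; ⊥-elim)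
open import Data.Fin as Fin using (Fin; toℕ)
import Data.Fin.Properties as Finₚ
open import Data.Integer using (ℤ; 0ℤ; 1ℤ; -_) renaming (_+_ to _+ᶻ_; _*_ to _*ᶻ_; _^_ to _^ᶻ_; +_ to ⁺_)
import Data.Integer.Properties as ℤₚ
import Data.Integer.Tactic.RingSolver as ℤ-Solver
open import Data.List using (List; []; _∷_; _++_; map; concatMap; filterᵇ; length; zip; upTo; applyUpTo; take; drop)
open import Data.List using (allFin; tabulate; cartesianProduct; cartesianProductWith)
import Data.List.Properties as Listₚ
open import Data.List.Membership.Propositional using (_∈_; _∉_; lose; find)
open import Data.List.Membership.Propositional.Properties
open import Data.List.Relation.Binary.Permutation.Propositional using (_↭_; ↭-sym; ↭-trans; ↭-refl; ↭-reflexive)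
import Data.List.Relation.Binary.Permutation.Propositional as Perm
import Data.List.Relation.Binary.Permutation.Propositional.Properties as Permₚ
open import Data.List.Relation.Unary.All as All using (All; []; _∷_)
import Data.List.Relation.Unary.All.Properties as Allₚ
open import Data.List.Relation.Unary.AllPairs as AllPairs using (AllPairs; []; _∷_)
import Data.List.Relation.Unary.AllPairs.Properties as AllPairsₚ
open import Data.List.Relation.Unary.Any as Any using (here; there)
open import Data.List.Relation.Unary.Linked as Linked using (Linked; []; [-]; _∷_)
import Data.List.Relation.Unary.Linked.Properties as Linkedₚ
open import Data.List.Relation.Unary.Unique.Propositional using (Unique)
import Data.List.Relation.Unary.Unique.Propositional.Properties as Uniqueₚ
open import Data.Nat using (ℕ; zero; suc; _+_; _*_; _∸_; _^_; _!; _≡ᵇ_; _<ᵇ_; _≤ᵇ_; _≤_; _<_; _≥_; z≤n; s≤s; z<s)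
import Data.Nat.Properties as ℕₚ
import Data.Nat.Tactic.RingSolver as ℕ-Solver
open import Data.Product using (_×_; _,_; proj₁; proj₂; ∃)
open import Data.Sum using (_⊎_; inj₁; inj₂; [_,_]′)
open import Data.Unit using (⊤; tt)
open import Data.Vec as Vec using (Vec; []; _∷_)
import Data.Vec.Properties as Vecₚ
open import Function using (_∘_; id; Equivalence)
open import Relation.Binary using (tri<; tri≈; tri>)
open import Relation.Binary.PropositionalEquality using (_≡_; _≢_; refl; sym; trans; cong; cong₂; subst; module ≡-Reasoning)
open import Relation.Nullary using (¬_; yes; no)

-- Finite sums and lists

-- The characteristic identity is used in exactly n variables x and n variables y. A composition is
-- read off at the monomial that carries the size of each part at the position where the part starts
-- and exponent 0 elsewhere. By symmetry of the polynomials another placement would give the same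
-- coefficient; this one keeps all compositions of n in the same variables and turns concatenation
-- of blocks into concatenation of exponent vectors, so L is a product over the parts of γ, each
-- factor with variables of its own. Power sums are additive over disjoint sets of variables, and a
-- factor of L kills every product of power sums except a single one of the right degree. What is
-- left is a count of matchings between two lists of parts; neither a scalar product nor a basis of
-- symmetric functions has to be set up. That these counts add up to 2^n n! over the group is a
-- double count of pairs (w , u), where u lists points in such an order that it spells the cycles of
-- w in the pattern γ. A given w has as many such u as there are matchings, and each of the 2^n n!
-- signed arrangements u belongs to exactly one w.

∑ : {A : Set} → List A → (A → ℤ) → ℤ
∑ xs f = sumℤ (map f xs)

⟦_⟧ : Bool → ℤ
⟦ b ⟧ = if b then 1ℤ else 0ℤ

⟦∧⟧ : ∀ a b → ⟦ a ∧ b ⟧ ≡ ⟦ a ⟧ *ᶻ ⟦ b ⟧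
⟦∧⟧ true b  = sym (ℤₚ.*-identityˡ ⟦ b ⟧)
⟦∧⟧ false b = refl

T⇒≡ : ∀ {b} → T b → b ≡ true
T⇒≡ {true} _ = refl

≡⇒T : ∀ {b} → b ≡ true → T b
≡⇒T refl = tt

¬T⇒≡ : ∀ {b} → ¬ T b → b ≡ false
¬T⇒≡ {true} f = ⊥-elim (f tt)
¬T⇒≡ {false} f = refl

T-ext : ∀ {a b} → (T a → T b) → (T b → T a) → a ≡ b
T-ext {true}  {true}  f g = refl
T-ext {true}  {false} f g = ⊥-elim (f tt)
T-ext {false} {true}  f g = ⊥-elim (g tt)
T-ext {false} {false} f g = refl

∧⁻ : ∀ {a b} → T (a ∧ b) → T a × T b
∧⁻ = Equivalence.to T-∧

∧⁺ : ∀ {a b} → T a → T b → T (a ∧ b)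
∧⁺ p q = Equivalence.from T-∧ (p , q)

T-not⁻ : ∀ {a} → T (not a) → ¬ T a
T-not⁻ {true} ()

T-not⁺ : ∀ {a} → ¬ T a → T (not a)
T-not⁺ {true} f = ⊥-elim (f tt)
T-not⁺ {false} f = tt

⇒⁻ : ∀ {a b} → T (not a ∨ b) → T a → T b
⇒⁻ {true} p _ = p

⇒⁺ : ∀ {a b} → (T a → T b) → T (not a ∨ b)
⇒⁺ {true} f = f tt
⇒⁺ {false} f = tt

all-T⁻ : {A : Set} {p : A → Bool} {xs : List A} → T (all p xs) → ∀ {x} → x ∈ xs → T (p x)
all-T⁻ {xs = xs} h = All.lookup (Allₚ.all⁺ _ xs h)

all-T⁺ : {A : Set} {p : A → Bool} {xs : List A} → (∀ {x} → x ∈ xs → T (p x)) → T (all p xs)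
all-T⁺ h = Allₚ.all⁻ _ (All.tabulate h)

eqBool⇒≡ : ∀ {a b} → T (eqBool a b) → a ≡ b
eqBool⇒≡ {true} {true} _ = refl
eqBool⇒≡ {false} {false} _ = refl

eqBool-refl : ∀ a → T (eqBool a a)
eqBool-refl true = tt
eqBool-refl false = tt

≡⇒eqBool : ∀ {a b} → a ≡ b → T (eqBool a b)
≡⇒eqBool {a} refl = eqBool-refl a

*-exchange : ∀ a b c → a *ᶻ (b *ᶻ c) ≡ b *ᶻ (a *ᶻ c)
*-exchange = ℤ-Solver.solve-∀

*-interchange : ∀ a b c d → (a *ᶻ b) *ᶻ (c *ᶻ d) ≡ (a *ᶻ c) *ᶻ (b *ᶻ d)
*-interchange = ℤ-Solver.solve-∀

module _ {A : Set} where

  ∑-cong∈ : ∀ (xs : List A) {f g} → (∀ {x} → x ∈ xs → f x ≡ g x) → ∑ xs f ≡ ∑ xs g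
  ∑-cong∈ []       h = refl
  ∑-cong∈ (x ∷ xs) h = cong₂ _+ᶻ_ (h (here refl)) (∑-cong∈ xs (h ∘ there))

  ∑-cong : ∀ (xs : List A) {f g} → (∀ x → f x ≡ g x) → ∑ xs f ≡ ∑ xs g
  ∑-cong xs h = ∑-cong∈ xs (λ {x} _ → h x)

  ∑-++ : ∀ (xs ys : List A) {f} → ∑ (xs ++ ys) f ≡ ∑ xs f +ᶻ ∑ ys f
  ∑-++ []       ys = sym (ℤₚ.+-identityˡ _)
  ∑-++ (x ∷ xs) ys {f} = trans (cong (f x +ᶻ_) (∑-++ xs ys)) (sym (ℤₚ.+-assoc (f x) _ _))

  ∑-0 : ∀ (xs : List A) {f} → (∀ {x} → x ∈ xs → f x ≡ 0ℤ) → ∑ xs f ≡ 0ℤ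
  ∑-0 []       h = refl
  ∑-0 (x ∷ xs) h = trans (cong₂ _+ᶻ_ (h (here refl)) (∑-0 xs (h ∘ there))) refl

  ∑-+ : ∀ (xs : List A) {f g} → ∑ xs (λ x → f x +ᶻ g x) ≡ ∑ xs f +ᶻ ∑ xs g
  ∑-+ []       = refl
  ∑-+ (x ∷ xs) {f} {g} = trans (cong ((f x +ᶻ g x) +ᶻ_) (∑-+ xs {f} {g})) (interchange (f x) (g x) _ _)
    where
    interchange : ∀ a b c d → (a +ᶻ b) +ᶻ (c +ᶻ d) ≡ (a +ᶻ c) +ᶻ (b +ᶻ d)
    interchange = ℤ-Solver.solve-∀

  ∑-*ˡ : ∀ (xs : List A) c {f} → ∑ xs (λ x → c *ᶻ f x) ≡ c *ᶻ ∑ xs f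
  ∑-*ˡ []       c = sym (ℤₚ.*-zeroʳ c)
  ∑-*ˡ (x ∷ xs) c {f} = trans (cong (c *ᶻ f x +ᶻ_) (∑-*ˡ xs c {f})) (sym (ℤₚ.*-distribˡ-+ c (f x) _))

  ∑-*ʳ : ∀ (xs : List A) c {f} → ∑ xs (λ x → f x *ᶻ c) ≡ ∑ xs f *ᶻ c
  ∑-*ʳ xs c {f} = trans (∑-cong xs (λ x → ℤₚ.*-comm (f x) c)) (trans (∑-*ˡ xs c) (ℤₚ.*-comm c _))

  ∑-neg : ∀ (xs : List A) {f} → ∑ xs (λ x → - f x) ≡ - ∑ xs f
  ∑-neg []       = refl
  ∑-neg (x ∷ xs) {f} = trans (cong (- f x +ᶻ_) (∑-neg xs {f})) (sym (ℤₚ.neg-distrib-+ (f x) _))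

  ∑-↭ : ∀ {xs ys : List A} {f} → xs ↭ ys → ∑ xs f ≡ ∑ ys f
  ∑-↭ Perm.refl = refl
  ∑-↭ {f = f} (Perm.prep x p) = cong (f x +ᶻ_) (∑-↭ p)
  ∑-↭ {f = f} (Perm.swap x y p) = trans (cong (λ s → f x +ᶻ (f y +ᶻ s)) (∑-↭ p)) (lemma (f x) (f y) _)
    where
    lemma : ∀ a b c → a +ᶻ (b +ᶻ c) ≡ b +ᶻ (a +ᶻ c)
    lemma = ℤ-Solver.solve-∀
  ∑-↭ (Perm.trans p q) = trans (∑-↭ p) (∑-↭ q)

  ∑-filter : ∀ (p : A → Bool) xs {f} → ∑ (filterᵇ p xs) f ≡ ∑ xs (λ x → ⟦ p x ⟧ *ᶻ f x)
  ∑-filter p []       = refl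
  ∑-filter p (x ∷ xs) {f} with p x
  ... | true  = cong₂ _+ᶻ_ (sym (ℤₚ.*-identityˡ (f x))) (∑-filter p xs)
  ... | false = trans (∑-filter p xs) (sym (ℤₚ.+-identityˡ _))

  length-∑ : ∀ (xs : List A) → ⁺ (length xs) ≡ ∑ xs (λ _ → 1ℤ)
  length-∑ []       = refl
  length-∑ (x ∷ xs) = cong (1ℤ +ᶻ_) (length-∑ xs)

  count-∑ : ∀ (p : A → Bool) xs → ⁺ (count p xs) ≡ ∑ xs (λ x → ⟦ p x ⟧)
  count-∑ p xs = trans (length-∑ (filterᵇ p xs)) (trans (∑-filter p xs) (∑-cong xs (λ x → ℤₚ.*-identityʳ _)))

  ∑-single : ∀ {xs : List A} {y f} → Unique xs → y ∈ xs → (∀ {x} → x ∈ xs → x ≢ y → f x ≡ 0ℤ) → ∑ xs f ≡ f y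
  ∑-single {x ∷ xs} {f = f} (x∉ ∷ u) (here refl) h =
    trans (cong (f x +ᶻ_) (∑-0 xs (λ z∈ → h (there z∈) (λ e → All.lookup x∉ z∈ (sym e))))) (ℤₚ.+-identityʳ _)
  ∑-single (x∉ ∷ u) (there y∈) h =
    trans (cong₂ _+ᶻ_ (h (here refl) (All.lookup x∉ y∈)) (∑-single u y∈ (h ∘ there))) (ℤₚ.+-identityˡ _)

  ∈-filterᵇ⁺ : ∀ {p : A → Bool} {x xs} → x ∈ xs → T (p x) → x ∈ filterᵇ p xs
  ∈-filterᵇ⁺ {p} = ∈-filter⁺ (T? ∘ p)

  ∈-filterᵇ⁻ : ∀ {p : A → Bool} {x} xs → x ∈ filterᵇ p xs → x ∈ xs × T (p x)
  ∈-filterᵇ⁻ {p} xs = ∈-filter⁻ (T? ∘ p) {xs = xs}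

  count-↭ : ∀ (p : A → Bool) {xs ys} → xs ↭ ys → count p xs ≡ count p ys
  count-↭ p r = Permₚ.↭-length (Permₚ.filter-↭ (T? ∘ p) r)

  ∈⇒↭∷ : ∀ {x : A} {xs} → x ∈ xs → ∃ λ ys → xs ↭ x ∷ ys
  ∈⇒↭∷ {x} x∈ with ∈-∃++ x∈
  ... | ys , zs , refl = ys ++ zs , Permₚ.shift x ys zs

  -- Pigeonhole: each member of `xs` uses up one entry of `ys`, and `ys` is too short to have
  -- entries left over.
  Unique-⊆-↭ : ∀ {xs ys : List A} → Unique xs → (∀ {x} → x ∈ xs → x ∈ ys) → length ys ≤ length xs → xs ↭ ys
  Unique-⊆-↭ {[]}     {[]}    u s l = ↭-refl
  Unique-⊆-↭ {x ∷ xs} (x∉ ∷ u) s l with ∈⇒↭∷ (s (here refl))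
  ... | zs , p = ↭-trans (Perm.prep x (Unique-⊆-↭ u sub (ℕₚ.≤-pred (ℕₚ.≤-trans (ℕₚ.≤-reflexive (sym (Permₚ.↭-length p))) l)))) (↭-sym p)
    where
    sub : ∀ {y} → y ∈ xs → y ∈ zs
    sub y∈ with Permₚ.∈-resp-↭ p (s (there y∈))
    ... | here refl = ⊥-elim (All.lookup x∉ y∈ refl)
    ... | there y∈zs = y∈zs

  Unique-↭ : ∀ {xs ys : List A} → xs ↭ ys → Unique xs → Unique ys
  Unique-↭ Perm.refl u = u
  Unique-↭ (Perm.prep x p) (x∉ ∷ u) = Permₚ.All-resp-↭ p x∉ ∷ Unique-↭ p u
  Unique-↭ (Perm.swap x y p) ((x≢y ∷ x∉) ∷ y∉ ∷ u) =
    ((x≢y ∘ sym) ∷ Permₚ.All-resp-↭ p y∉) ∷ Permₚ.All-resp-↭ p x∉ ∷ Unique-↭ p u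
  Unique-↭ (Perm.trans p q) u = Unique-↭ q (Unique-↭ p u)

  -- A sorted list is determined by its multiset: each of the two heads occurs in the other list, so
  -- each precedes the other.
  AllPairs-↭⇒≡ : ∀ {R : A → A → Set} → (∀ {x y} → R x y → R y x → x ≡ y) →
    ∀ {xs ys} → AllPairs R xs → AllPairs R ys → xs ↭ ys → xs ≡ ys
  AllPairs-↭⇒≡ antisym {[]} [] q p with refl ← Permₚ.↭-empty-inv (↭-sym p) = refl
  AllPairs-↭⇒≡ antisym {x ∷ xs} {[]} a [] p with () ← Permₚ.↭-empty-inv p
  AllPairs-↭⇒≡ {R} antisym {x ∷ xs} {y ∷ ys} (x< ∷ a) (y< ∷ b) p with same
    where
    same : x ≡ y
    same with Permₚ.∈-resp-↭ p (here refl) | Permₚ.∈-resp-↭ (↭-sym p) (here refl)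
    ... | here e   | _        = e
    ... | there _  | here e   = sym e
    ... | there x∈ | there y∈ = antisym (All.lookup x< y∈) (All.lookup y< x∈)
  ... | refl = cong (x ∷_) (AllPairs-↭⇒≡ antisym a b (Permₚ.drop-∷ p))

module _ {A B : Set} where

  ∑-map : ∀ (h : A → B) xs {f} → ∑ (map h xs) f ≡ ∑ xs (f ∘ h)
  ∑-map h []       = refl
  ∑-map h (x ∷ xs) {f} = cong (f (h x) +ᶻ_) (∑-map h xs)

  ∑-concatMap : ∀ (h : A → List B) xs {f} → ∑ (concatMap h xs) f ≡ ∑ xs (λ x → ∑ (h x) f)
  ∑-concatMap h []       = refl
  ∑-concatMap h (x ∷ xs) {f} = trans (∑-++ (h x) (concatMap h xs)) (cong (∑ (h x) f +ᶻ_) (∑-concatMap h xs))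

  ∑-swap : ∀ (xs : List A) (ys : List B) {f : A → B → ℤ} →
    ∑ xs (λ x → ∑ ys (f x)) ≡ ∑ ys (λ y → ∑ xs (λ x → f x y))
  ∑-swap []       ys = sym (∑-0 ys (λ _ → refl))
  ∑-swap (x ∷ xs) ys {f} = trans (cong (∑ ys (f x) +ᶻ_) (∑-swap xs ys)) (sym (∑-+ ys))

  -- The injection is a relation rather than a function, so that one relation read in both
  -- directions can prove that two sets are equinumerous.
  injective⇒length≤ : ∀ (ρ : A → B → Set) {xs ys} → Unique xs → (∀ {x} → x ∈ xs → ∃ λ y → y ∈ ys × ρ x y) →
    (∀ {x x' y} → x ∈ xs → x' ∈ xs → ρ x y → ρ x' y → x ≡ x') → length xs ≤ length ys
  injective⇒length≤ ρ {[]} u e i = z≤n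
  injective⇒length≤ ρ {x ∷ xs} {ys} (x∉ ∷ u) e i with e (here refl)
  ... | y , y∈ , r with ∈⇒↭∷ y∈
  ... | zs , p = ℕₚ.≤-trans (s≤s (injective⇒length≤ ρ u e' (λ a b → i (there a) (there b)))) (ℕₚ.≤-reflexive (sym (Permₚ.↭-length p)))
    where
    e' : ∀ {x'} → x' ∈ xs → ∃ λ y' → y' ∈ zs × ρ x' y'
    e' x'∈ with e (there x'∈)
    ... | y' , y'∈ , r' with Permₚ.∈-resp-↭ p y'∈
    ... | there q = y' , q , r'
    ... | here refl = ⊥-elim (All.lookup x∉ x'∈ (i (here refl) (there x'∈) r r'))

filterᵇ-cong : {A : Set} {p q : A → Bool} → (∀ x → p x ≡ q x) → ∀ xs → filterᵇ p xs ≡ filterᵇ q xs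
filterᵇ-cong h [] = refl
filterᵇ-cong {p = p} {q} h (x ∷ xs) with p x | q x | h x
... | true | .true | refl = cong (x ∷_) (filterᵇ-cong h xs)
... | false | .false | refl = filterᵇ-cong h xs

filterᵇ-∧ : {A : Set} (p q : A → Bool) → ∀ xs → filterᵇ p (filterᵇ q xs) ≡ filterᵇ (λ x → q x ∧ p x) xs
filterᵇ-∧ p q [] = refl
filterᵇ-∧ p q (x ∷ xs) with q x
... | false = filterᵇ-∧ p q xs
... | true with p x
... | true = cong (x ∷_) (filterᵇ-∧ p q xs)
... | false = filterᵇ-∧ p q xs

module _ {A : Set} where

  ∑-allLists-suc : ∀ k (xs : List A) {f} → ∑ (allLists (suc k) xs) f ≡ ∑ xs (λ x → ∑ (allLists k xs) (λ l → f (x ∷ l)))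
  ∑-allLists-suc k xs = trans (∑-concatMap _ xs) (∑-cong xs (λ x → ∑-map (x ∷_) (allLists k xs)))

  ∑-allLists-+ : ∀ k m (xs : List A) {f} →
    ∑ (allLists (k + m) xs) f ≡ ∑ (allLists k xs) (λ l → ∑ (allLists m xs) (λ l' → f (l ++ l')))
  ∑-allLists-+ zero    m xs = sym (ℤₚ.+-identityʳ _)
  ∑-allLists-+ (suc k) m xs = trans (∑-allLists-suc (k + m) xs)
    (trans (∑-cong xs (λ x → ∑-allLists-+ k m xs)) (sym (∑-allLists-suc k xs)))

  ∈-allLists⁺ : ∀ {xs l : List A} → All (_∈ xs) l → l ∈ allLists (length l) xs
  ∈-allLists⁺ [] = here refl
  ∈-allLists⁺ {xs} {x ∷ l} (x∈ ∷ a) = ∈-concatMap⁺ _ (Any.map (λ { refl → ∈-map⁺ (x ∷_) (∈-allLists⁺ a) }) x∈)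

  ∈-allLists⁻ : ∀ k {xs l : List A} → l ∈ allLists k xs → length l ≡ k × All (_∈ xs) l
  ∈-allLists⁻ zero (here refl) = refl , []
  ∈-allLists⁻ (suc k) {xs} m with find (∈-concatMap⁻ (λ x → map (x ∷_) (allLists k xs)) {xs = xs} m)
  ... | x , x∈ , m' with ∈-map⁻ (x ∷_) m'
  ... | l , l∈ , refl with ∈-allLists⁻ k l∈
  ... | refl , a = refl , x∈ ∷ a

  allLists-∷ : ∀ k (xs : List A) → allLists (suc k) xs ≡ cartesianProductWith _∷_ xs (allLists k xs)
  allLists-∷ k xs = lemma xs
    where
    lemma : ∀ zs → concatMap (λ x → map (x ∷_) (allLists k xs)) zs ≡ cartesianProductWith _∷_ zs (allLists k xs)
    lemma [] = refl
    lemma (z ∷ zs) = cong (map (z ∷_) (allLists k xs) ++_) (lemma zs)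

  allLists-Unique : ∀ k {xs : List A} → Unique xs → Unique (allLists k xs)
  allLists-Unique zero u = [] ∷ []
  allLists-Unique (suc k) {xs} u = subst Unique (sym (allLists-∷ k xs))
    (Uniqueₚ.cartesianProductWith⁺ _∷_ (λ { refl → refl , refl }) u (allLists-Unique k u))

  allVecs-Unique : ∀ k {xs : List A} → Unique xs → Unique (allVecs k xs)
  allVecs-Unique zero u = [] ∷ []
  allVecs-Unique (suc k) {xs} u = subst Unique (sym (lemma xs))
    (Uniqueₚ.cartesianProductWith⁺ _∷_ (λ { refl → refl , refl }) u (allVecs-Unique k u))
    where
    lemma : ∀ zs → concatMap (λ x → map (x ∷_) (allVecs k xs)) zs ≡ cartesianProductWith _∷_ zs (allVecs k xs)
    lemma [] = refl
    lemma (z ∷ zs) = cong (map (z ∷_) (allVecs k xs) ++_) (lemma zs)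

  ∈-allVecs⁺ : ∀ {k} {xs : List A} (v : Vec A k) → (∀ i → Vec.lookup v i ∈ xs) → v ∈ allVecs k xs
  ∈-allVecs⁺ [] a = here refl
  ∈-allVecs⁺ {suc k} {xs} (x ∷ v) a =
    ∈-concatMap⁺ _ (Any.map (λ { refl → ∈-map⁺ (x ∷_) (∈-allVecs⁺ v (a ∘ Fin.suc)) }) (a Fin.zero))

allFinL≡ : ∀ n → allFinL n ≡ allFin n
allFinL≡ n = lemma id
  where
  lemma : ∀ {n} {A : Set} (f : Fin n → A) → Vec.toList (Vec.tabulate f) ≡ tabulate f
  lemma {zero} f = refl
  lemma {suc n} f = cong (f Fin.zero ∷_) (lemma (f ∘ Fin.suc))

∈-allFinL : ∀ {n} (i : Fin n) → i ∈ allFinL n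
∈-allFinL {n} i rewrite allFinL≡ n = ∈-allFin i

allFinL-Unique : ∀ n → Unique (allFinL n)
allFinL-Unique n rewrite allFinL≡ n = Uniqueₚ.allFin⁺ n

length-allFinL : ∀ n → length (allFinL n) ≡ n
length-allFinL n = trans (cong length (allFinL≡ n)) (Listₚ.length-tabulate id)

Unique-full : ∀ {n} {xs : List (Fin n)} → Unique xs → length xs ≡ n → ∀ i → i ∈ xs
Unique-full {n} u l i = Permₚ.∈-resp-↭ (↭-sym (Unique-⊆-↭ u (λ {x} _ → ∈-allFinL x) (ℕₚ.≤-reflexive (trans (length-allFinL n) (sym l)))))
  (∈-allFinL i)

module _ {A : Set} where

  length-take-+ : ∀ k {m} {xs : List A} → length xs ≡ k + m → length (take k xs) ≡ k
  length-take-+ k {m} {xs} l = trans (Listₚ.length-take k xs) (ℕₚ.m≤n⇒m⊓n≡m (ℕₚ.≤-trans (ℕₚ.m≤m+n k m) (ℕₚ.≤-reflexive (sym l))))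

  length-drop-+ : ∀ k {m} {xs : List A} → length xs ≡ k + m → length (drop k xs) ≡ m
  length-drop-+ k {m} {xs} l = trans (Listₚ.length-drop k xs) (trans (cong (_∸ k) l) (ℕₚ.m+n∸m≡n k m))

  ++-cancel : ∀ (xs xs' : List A) {ys ys'} → length xs ≡ length xs' → xs ++ ys ≡ xs' ++ ys' → xs ≡ xs' × ys ≡ ys'
  ++-cancel [] [] l e = refl , e
  ++-cancel (x ∷ xs) (y ∷ ys) l e with ++-cancel xs ys (ℕₚ.suc-injective l) (Listₚ.∷-injectiveʳ e)
  ... | p , q = cong₂ _∷_ (Listₚ.∷-injectiveˡ e) p , q

bools : List Bool
bools = true ∷ false ∷ []

bits : ∀ k → List (Vec Bool k)
bits k = allVecs k bools

-- Functionals on products of power sums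

Part : Set
Part = ℕ × Bool

total : List Part → ℕ
total []            = 0
total ((k , _) ∷ γ) = k + total γ

Positive : Part → Set
Positive (k , _) = 0 < k

total-↭ : ∀ {γ δ} → γ ↭ δ → total γ ≡ total δ
total-↭ Perm.refl = refl
total-↭ (Perm.prep x p) = cong (proj₁ x +_) (total-↭ p)
total-↭ (Perm.swap x y p) = trans (cong (λ t → proj₁ x + (proj₁ y + t)) (total-↭ p)) (lemma (proj₁ x) (proj₁ y) _)
  where
  lemma : ∀ a b c → a + (b + c) ≡ b + (a + c)
  lemma = ℕ-Solver.solve-∀
total-↭ (Perm.trans p q) = trans (total-↭ p) (total-↭ q)

total-++ : ∀ γ δ → total (γ ++ δ) ≡ total γ + total δ
total-++ [] δ = refl
total-++ ((k , _) ∷ γ) δ = trans (cong (k +_) (total-++ γ δ)) (sym (ℕₚ.+-assoc k _ _))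

total>0 : ∀ {x δ} → Positive x → 0 < total (x ∷ δ)
total>0 {x} p = ℕₚ.<-≤-trans p (ℕₚ.m≤m+n (proj₁ x) _)

-- Equal elements count as distinguishable, as they do when a product of binomials is expanded.
splits : {A : Set} → List A → List (List A × List A)
splits []       = ([] , []) ∷ []
splits (x ∷ xs) = map (λ (as , bs) → (x ∷ as , bs)) (splits xs) ++ map (λ (as , bs) → (as , x ∷ bs)) (splits xs)

picks : {A : Set} → List A → List (A × List A)
picks []       = []
picks (x ∷ xs) = (x , xs) ∷ map (λ (y , ys) → (y , x ∷ ys)) (picks xs)

module _ {A : Set} where

  ∑-splits-∷ : ∀ x (xs : List A) {G : List A × List A → ℤ} → ∑ (splits (x ∷ xs)) G ≡
    ∑ (splits xs) (λ (as , bs) → G (x ∷ as , bs)) +ᶻ ∑ (splits xs) (λ (as , bs) → G (as , x ∷ bs))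
  ∑-splits-∷ x xs {G} = trans (∑-++ (map (λ (as , bs) → (x ∷ as , bs)) (splits xs)) _)
    (cong₂ _+ᶻ_ (∑-map _ (splits xs)) (∑-map _ (splits xs)))

  splits-↭ : ∀ (xs : List A) {s} → s ∈ splits xs → proj₁ s ++ proj₂ s ↭ xs
  splits-↭ [] (here refl) = ↭-refl
  splits-↭ (x ∷ xs) s∈ with ∈-++⁻ (map (λ (as , bs) → (x ∷ as , bs)) (splits xs)) s∈
  ... | inj₁ m with ∈-map⁻ _ m
  ... | s , s∈' , refl = Perm.prep x (splits-↭ xs s∈')
  splits-↭ (x ∷ xs) s∈ | inj₂ m with ∈-map⁻ _ m
  ... | s , s∈' , refl = ↭-trans (Permₚ.shift x (proj₁ s) (proj₂ s)) (Perm.prep x (splits-↭ xs s∈'))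

  ∑-splits-[]ˡ : ∀ (xs : List A) {G} → (∀ x as bs → G (x ∷ as , bs) ≡ 0ℤ) → ∑ (splits xs) G ≡ G ([] , xs)
  ∑-splits-[]ˡ []       h = ℤₚ.+-identityʳ _
  ∑-splits-[]ˡ (x ∷ xs) {G} h = trans (∑-splits-∷ x xs {G}) (trans (cong₂ _+ᶻ_
    (∑-0 (splits xs) (λ {(as , bs)} _ → h x as bs)) (∑-splits-[]ˡ xs (λ y as bs → h y as (x ∷ bs)))) (ℤₚ.+-identityˡ _))

  ∑-splits-[]ʳ : ∀ (xs : List A) {G} → (∀ x as bs → G (as , x ∷ bs) ≡ 0ℤ) → ∑ (splits xs) G ≡ G (xs , [])
  ∑-splits-[]ʳ []       h = ℤₚ.+-identityʳ _
  ∑-splits-[]ʳ (x ∷ xs) {G} h = trans (∑-splits-∷ x xs {G}) (trans (cong₂ _+ᶻ_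
    (∑-splits-[]ʳ xs (λ y as bs → h y (x ∷ as) bs)) (∑-0 (splits xs) (λ {(as , bs)} _ → h x as bs))) (ℤₚ.+-identityʳ _))

  ∑-splits-[-] : ∀ (xs : List A) {G} → (∀ bs → G ([] , bs) ≡ 0ℤ) → (∀ x y as bs → G (x ∷ y ∷ as , bs) ≡ 0ℤ) →
    ∑ (splits xs) G ≡ ∑ (picks xs) (λ (x , bs) → G (x ∷ [] , bs))
  ∑-splits-[-] []       {G} h h' = trans (ℤₚ.+-identityʳ _) (h [])
  ∑-splits-[-] (x ∷ xs) {G} h h' = trans (∑-splits-∷ x xs {G}) (cong₂ _+ᶻ_
    (∑-splits-[]ˡ xs (h' x))
    (trans (∑-splits-[-] xs (λ bs → h (x ∷ bs)) (λ y z as bs → h' y z as (x ∷ bs))) (sym (∑-map _ (picks xs)))))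

-- A set of monomials with their multiplication, together with the terms of the power sum belonging
-- to each part. Commutativity and associativity are arguments of the lemmas that reorder or join
-- products.
record Space : Set₁ where
  field
    Car       : Set
    𝟎         : Car
    _⊕_       : Car → Car → Car
    identityˡ : ∀ v → 𝟎 ⊕ v ≡ v
    gens      : Part → List (ℤ × Car)

open Space

-- Evaluates a linear functional, given by its values F on monomials, at a product of power sums,
-- gens listing the terms of each power sum.
powerSums : (V : Space) → List Part → (Car V → ℤ) → ℤ
powerSums V []      F = F (𝟎 V)
powerSums V (d ∷ δ) F = ∑ (gens V d) (λ (s , v) → s *ᶻ powerSums V δ (λ u → F (_⊕_ V v u)))

module _ (V : Space) where

  powerSums-cong : ∀ δ {F G} → (∀ v → F v ≡ G v) → powerSums V δ F ≡ powerSums V δ G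
  powerSums-cong []      h = h _
  powerSums-cong (d ∷ δ) h = ∑-cong (gens V d) (λ (s , v) → cong (s *ᶻ_) (powerSums-cong δ (λ u → h _)))

  powerSums-∑ : {X : Set} (xs : List X) (c : X → ℤ) → ∀ δ {G : X → Car V → ℤ} →
    powerSums V δ (λ v → ∑ xs (λ x → c x *ᶻ G x v)) ≡ ∑ xs (λ x → c x *ᶻ powerSums V δ (G x))
  powerSums-∑ xs c [] = refl
  powerSums-∑ xs c (d ∷ δ) {G} = begin
    ∑ (gens V d) (λ (s , v) → s *ᶻ powerSums V δ (λ u → ∑ xs (λ x → c x *ᶻ G x (_⊕_ V v u))))
      ≡⟨ ∑-cong (gens V d) (λ (s , v) → trans (cong (s *ᶻ_) (powerSums-∑ xs c δ))
           (trans (sym (∑-*ˡ xs s)) (∑-cong xs (λ x → *-exchange s (c x) _)))) ⟩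
    ∑ (gens V d) (λ (s , v) → ∑ xs (λ x → c x *ᶻ (s *ᶻ powerSums V δ (λ u → G x (_⊕_ V v u)))))
      ≡⟨ ∑-swap (gens V d) xs ⟩
    ∑ xs (λ x → ∑ (gens V d) (λ (s , v) → c x *ᶻ (s *ᶻ powerSums V δ (λ u → G x (_⊕_ V v u)))))
      ≡⟨ ∑-cong xs (λ x → ∑-*ˡ (gens V d) (c x)) ⟩
    ∑ xs (λ x → c x *ᶻ powerSums V (d ∷ δ) (G x)) ∎
    where
    open ≡-Reasoning

  powerSums-*ˡ : ∀ c δ {F} → powerSums V δ (λ v → c *ᶻ F v) ≡ c *ᶻ powerSums V δ F
  powerSums-*ˡ c δ {F} = trans (powerSums-cong δ (λ v → sym (ℤₚ.+-identityʳ _)))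
    (trans (powerSums-∑ (tt ∷ []) (λ _ → c) δ {λ _ → F}) (ℤₚ.+-identityʳ _))

  powerSums-*ʳ : ∀ c δ {F} → powerSums V δ (λ v → F v *ᶻ c) ≡ powerSums V δ F *ᶻ c
  powerSums-*ʳ c δ {F} = trans (powerSums-cong δ (λ v → ℤₚ.*-comm (F v) c)) (trans (powerSums-*ˡ c δ) (ℤₚ.*-comm c _))

  powerSums-linear : ∀ a b δ {F G} →
    powerSums V δ (λ v → a *ᶻ F v +ᶻ b *ᶻ G v) ≡ a *ᶻ powerSums V δ F +ᶻ b *ᶻ powerSums V δ G
  powerSums-linear a b δ {F} {G} = trans (powerSums-cong δ (λ v → cong (a *ᶻ F v +ᶻ_) (sym (ℤₚ.+-identityʳ _))))
    (trans (powerSums-∑ (true ∷ false ∷ []) (λ x → if x then a else b) δ {λ x → if x then F else G})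
      (cong (a *ᶻ powerSums V δ F +ᶻ_) (ℤₚ.+-identityʳ _)))

  powerSums-0 : ∀ δ {F} → (∀ v → F v ≡ 0ℤ) → powerSums V δ F ≡ 0ℤ
  powerSums-0 δ h = trans (powerSums-cong δ h) (powerSums-*ˡ 0ℤ δ {λ _ → 0ℤ})

  powerSums-↭ : (∀ u v w → _⊕_ V u (_⊕_ V v w) ≡ _⊕_ V v (_⊕_ V u w)) →
    ∀ {δ δ'} → δ ↭ δ' → ∀ F → powerSums V δ F ≡ powerSums V δ' F
  powerSums-↭ comm Perm.refl F = refl
  powerSums-↭ comm (Perm.prep d p) F = ∑-cong (gens V d) (λ (s , v) → cong (s *ᶻ_) (powerSums-↭ comm p _))
  powerSums-↭ comm (Perm.trans p q) F = trans (powerSums-↭ comm p F) (powerSums-↭ comm q F)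
  powerSums-↭ comm {d ∷ e ∷ δ} {_ ∷ _ ∷ δ'} (Perm.swap d e p) F = begin
    ∑ (gens V d) (λ (s , v) → s *ᶻ ∑ (gens V e) (λ (t , w) → t *ᶻ powerSums V δ (λ u → F (_⊕_ V v (_⊕_ V w u)))))
      ≡⟨ ∑-cong (gens V d) (λ (s , v) → sym (∑-*ˡ (gens V e) s)) ⟩
    ∑ (gens V d) (λ (s , v) → ∑ (gens V e) (λ (t , w) → s *ᶻ (t *ᶻ powerSums V δ (λ u → F (_⊕_ V v (_⊕_ V w u))))))
      ≡⟨ ∑-swap (gens V d) (gens V e) ⟩
    ∑ (gens V e) (λ (t , w) → ∑ (gens V d) (λ (s , v) → s *ᶻ (t *ᶻ powerSums V δ (λ u → F (_⊕_ V v (_⊕_ V w u))))))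
      ≡⟨ ∑-cong (gens V e) (λ (t , w) → trans (∑-cong (gens V d) (λ (s , v) → trans (*-exchange s t _)
           (cong (λ z → t *ᶻ (s *ᶻ z)) (trans (powerSums-↭ comm p _) (powerSums-cong δ' (λ u → cong F (comm v w u)))))))
           (∑-*ˡ (gens V d) t)) ⟩
    ∑ (gens V e) (λ (t , w) → t *ᶻ ∑ (gens V d) (λ (s , v) → s *ᶻ powerSums V δ' (λ u → F (_⊕_ V w (_⊕_ V v u))))) ∎
    where
    open ≡-Reasoning

  powerSums-++ : (∀ u v w → _⊕_ V u (_⊕_ V v w) ≡ _⊕_ V (_⊕_ V u v) w) → ∀ δ δ' {F} →
    powerSums V (δ ++ δ') F ≡ powerSums V δ (λ u → powerSums V δ' (λ v → F (_⊕_ V u v)))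
  powerSums-++ assoc [] δ' {F} = powerSums-cong δ' (λ v → cong F (sym (identityˡ V v)))
  powerSums-++ assoc (d ∷ δ) δ' {F} = ∑-cong (gens V d) (λ (s , v) → cong (s *ᶻ_)
    (trans (powerSums-++ assoc δ δ') (powerSums-cong δ (λ u → powerSums-cong δ' (λ w → cong F (assoc v u w))))))

_⊠_ : Space → Space → Space
V ⊠ W = record
  { Car = Car V × Car W
  ; 𝟎 = 𝟎 V , 𝟎 W
  ; _⊕_ = λ (v , w) (v' , w') → _⊕_ V v v' , _⊕_ W w w'
  ; identityˡ = λ (v , w) → cong₂ _,_ (identityˡ V v) (identityˡ W w)
  ; gens = λ d → map (λ (s , v) → (s , (v , 𝟎 W))) (gens V d) ++ map (λ (s , w) → (s , (𝟎 V , w))) (gens W d)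
  }

-- A power sum in the union of two alphabets is the sum of its values in each, so expanding the
-- product over δ distributes the parts of δ over the two alphabets.
powerSums-⊠ : ∀ V W δ {F} → powerSums (V ⊠ W) δ F ≡
  ∑ (splits δ) (λ (as , bs) → powerSums V as (λ v → powerSums W bs (λ w → F (v , w))))
powerSums-⊠ V W [] = sym (ℤₚ.+-identityʳ _)
powerSums-⊠ V W (d ∷ δ) {F} = begin
  ∑ (gens (V ⊠ W) d) step
    ≡⟨ ∑-++ (map (λ (s , v) → (s , (v , 𝟎 W))) (gens V d)) _ ⟩
  ∑ (map (λ (s , v) → (s , (v , 𝟎 W))) (gens V d)) step +ᶻ ∑ (map (λ (s , w) → (s , (𝟎 V , w))) (gens W d)) step
    ≡⟨ cong₂ _+ᶻ_ (∑-map _ (gens V d)) (∑-map _ (gens W d)) ⟩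
  ∑ (gens V d) (λ (s , v) → step (s , (v , 𝟎 W))) +ᶻ ∑ (gens W d) (λ (s , w) → step (s , (𝟎 V , w)))
    ≡⟨ cong₂ _+ᶻ_ left right ⟩
  ∑ (splits δ) (λ (as , bs) → H (d ∷ as , bs)) +ᶻ ∑ (splits δ) (λ (as , bs) → H (as , d ∷ bs))
    ≡⟨ sym (∑-splits-∷ d δ {H}) ⟩
  ∑ (splits (d ∷ δ)) H ∎
  where
  open ≡-Reasoning
  step : ℤ × Car (V ⊠ W) → ℤ
  step (s , v) = s *ᶻ powerSums (V ⊠ W) δ (λ u → F (_⊕_ (V ⊠ W) v u))
  H : List Part × List Part → ℤ
  H (as , bs) = powerSums V as (λ v → powerSums W bs (λ w → F (v , w)))
  left : ∑ (gens V d) (λ (s , v) → step (s , (v , 𝟎 W))) ≡ ∑ (splits δ) (λ (as , bs) → H (d ∷ as , bs))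
  left = trans (∑-cong (gens V d) (λ (s , v) → trans (cong (s *ᶻ_) (trans
      (powerSums-cong (V ⊠ W) δ (λ (v' , w') → cong (λ z → F (_⊕_ V v v' , z)) (identityˡ W w')))
      (powerSums-⊠ V W δ))) (sym (∑-*ˡ (splits δ) s))))
    (∑-swap (gens V d) (splits δ))
  right : ∑ (gens W d) (λ (s , w) → step (s , (𝟎 V , w))) ≡ ∑ (splits δ) (λ (as , bs) → H (as , d ∷ bs))
  right = trans (∑-cong (gens W d) (λ (s , w) → trans (cong (s *ᶻ_) (trans
      (powerSums-cong (V ⊠ W) δ (λ (v' , w') → cong (λ z → F (z , _⊕_ W w w')) (identityˡ V v')))
      (powerSums-⊠ V W δ))) (sym (∑-*ˡ (splits δ) s))))
    (trans (∑-swap (gens W d) (splits δ))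
      (∑-cong (splits δ) (λ (as , bs) → sym (powerSums-∑ V (gens W d) proj₁ as))))

powerSums-hom : ∀ V W (h : Car V → Car W) → h (𝟎 V) ≡ 𝟎 W → (∀ u v → h (_⊕_ V u v) ≡ _⊕_ W (h u) (h v)) →
  (∀ d → map (λ (s , v) → (s , h v)) (gens V d) ↭ gens W d) → ∀ δ {F} →
  powerSums V δ (F ∘ h) ≡ powerSums W δ F
powerSums-hom V W h h0 h⊕ hg [] {F} = cong F h0
powerSums-hom V W h h0 h⊕ hg (d ∷ δ) {F} =
  trans (∑-cong (gens V d) (λ (s , v) → cong (s *ᶻ_) (trans (powerSums-cong V δ (λ u → cong F (h⊕ v u)))
    (powerSums-hom V W h h0 h⊕ hg δ))))
  (trans (sym (∑-map (λ (s , v) → (s , h v)) (gens V d))) (∑-↭ (hg d)))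

sg : Bool → ℤ
sg b = if b then - 1ℤ else 1ℤ

signs : (Bool → ℤ) → List Part → ℤ
signs σ []            = 1ℤ
signs σ ((_ , b) ∷ δ) = σ b *ᶻ signs σ δ

signs-++ : ∀ σ γ δ → signs σ (γ ++ δ) ≡ signs σ γ *ᶻ signs σ δ
signs-++ σ [] δ = sym (ℤₚ.*-identityˡ _)
signs-++ σ ((_ , b) ∷ γ) δ = trans (cong (σ b *ᶻ_) (signs-++ σ γ δ)) (sym (ℤₚ.*-assoc (σ b) _ _))

signs-↭ : ∀ σ {γ δ} → γ ↭ δ → signs σ γ ≡ signs σ δ
signs-↭ σ Perm.refl = refl
signs-↭ σ (Perm.prep (_ , b) p) = cong (σ b *ᶻ_) (signs-↭ σ p)
signs-↭ σ (Perm.swap (_ , a) (_ , b) p) = trans (cong (λ t → σ a *ᶻ (σ b *ᶻ t)) (signs-↭ σ p)) (*-exchange (σ a) (σ b) _)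
signs-↭ σ (Perm.trans p q) = trans (signs-↭ σ p) (signs-↭ σ q)

signs-1 : ∀ δ → signs (λ _ → 1ℤ) δ ≡ 1ℤ
signs-1 []      = refl
signs-1 (d ∷ δ) = trans (ℤₚ.*-identityˡ _) (signs-1 δ)

-- A single variable, in which a power sum has one term. `σ` is constantly 1 for a variable x; for a
-- variable y it is `sg`, which gives barred power sums their sign.
line : (Bool → ℤ) → Space
line σ = record { Car = ℕ ; 𝟎 = 0 ; _⊕_ = _+_ ; identityˡ = λ _ → refl ; gens = λ (d , b) → (σ b , d) ∷ [] }

powerSums-line : ∀ σ δ {F} → powerSums (line σ) δ F ≡ signs σ δ *ᶻ F (total δ)
powerSums-line σ [] = sym (ℤₚ.*-identityˡ _)
powerSums-line σ ((d , b) ∷ δ) {F} = trans (ℤₚ.+-identityʳ _)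
  (trans (cong (σ b *ᶻ_) (powerSums-line σ δ)) (sym (ℤₚ.*-assoc (σ b) _ _)))

zeros : ∀ N → Vec ℕ N
zeros N = Vec.replicate N 0

_⊞_ : ∀ {N} → Vec ℕ N → Vec ℕ N → Vec ℕ N
_⊞_ = Vec.zipWith _+_

units : ℕ → ∀ N → List (Vec ℕ N)
units d zero    = []
units d (suc N) = (d ∷ zeros N) ∷ map (0 ∷_) (units d N)

vectors : (Bool → ℤ) → ℕ → Space
vectors σ N = record
  { Car = Vec ℕ N ; 𝟎 = zeros N ; _⊕_ = _⊞_
  ; identityˡ = Vecₚ.zipWith-identityˡ (λ _ → refl)
  ; gens = λ (d , b) → map (σ b ,_) (units d N) }

-- The first variable is split off as an alphabet of its own; the total of the parts sent to it
-- becomes its exponent.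
powerSums-suc : ∀ σ N δ {F} → powerSums (vectors σ (suc N)) δ F ≡
  ∑ (splits δ) (λ (as , bs) → signs σ as *ᶻ powerSums (vectors σ N) bs (λ v → F (total as ∷ v)))
powerSums-suc σ N δ {F} = trans
  (sym (powerSums-hom (line σ ⊠ vectors σ N) (vectors σ (suc N)) (λ (c , v) → c ∷ v) refl (λ _ _ → refl)
    (λ (d , b) → ↭-reflexive (cong ((σ b , d ∷ zeros N) ∷_) (trans (sym (Listₚ.map-∘ _))
      (trans (sym (Listₚ.map-∘ _)) (Listₚ.map-∘ _))))) δ {F}))
  (trans (powerSums-⊠ (line σ) (vectors σ N) δ)
    (∑-cong (splits δ) (λ (as , bs) → powerSums-line σ as)))

isZero : ∀ {N} → Vec ℕ N → ℤ
isZero {N} v = ⟦ eqVecℕ (zeros N) v ⟧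

isZero-zeros : ∀ N → isZero (zeros N) ≡ 1ℤ
isZero-zeros zero = refl
isZero-zeros (suc N) = isZero-zeros N

-- A positive part leaves a positive exponent in some variable.
powerSums-isZero : ∀ σ N {x} → Positive x → ∀ δ → powerSums (vectors σ N) (x ∷ δ) isZero ≡ 0ℤ
powerSums-isZero σ N {suc d , b} _ δ = ∑-0 (map (σ b ,_) (units (suc d) N)) λ m → lemma (∈-map⁻ _ m)
  where
  nonzero : ∀ {N} {u} → u ∈ units (suc d) N → ∀ v → isZero (u ⊞ v) ≡ 0ℤ
  nonzero {suc N} (here refl) (c ∷ v) = refl
  nonzero {suc N} (there m) (c ∷ v) with ∈-map⁻ (0 ∷_) m
  ... | u , u∈ , refl with c
  ... | zero = nonzero u∈ v
  ... | suc _ = refl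
  lemma : ∀ {y} → (∃ λ u → u ∈ units (suc d) N × y ≡ (σ b , u)) →
    proj₁ y *ᶻ powerSums (vectors σ N) δ (λ u → isZero (proj₂ y ⊞ u)) ≡ 0ℤ
  lemma (u , u∈ , refl) = trans (cong (σ b *ᶻ_) (powerSums-0 (vectors σ N) δ (nonzero u∈))) (ℤₚ.*-zeroʳ (σ b))

-- A composition of k is encoded by a vector of length k with each part at the position where it starts.
-- runWeight 0 0 is, up to sign, the coefficient of h_c in p_k = Σ_c (-1)^(ℓ(c)-1) c_last h_c;
-- in general r more zeros are expected before the next part and w is the size of the part being read.
runWeight : ℕ → ℕ → ∀ {k} → Vec ℕ k → ℤ
runWeight zero    w []            = ⁺ w
runWeight (suc r) w []            = 0ℤ
runWeight zero    w (zero ∷ v)    = 0ℤ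
runWeight zero    w (suc c ∷ v)   = - runWeight c (suc c) v
runWeight (suc r) w (zero ∷ v)    = runWeight r w v
runWeight (suc r) w (suc _ ∷ v)   = 0ℤ

-- Up to `signs` and the condition on the degree, the value of `runWeight r w` at the product of the
-- power sums of δ. The zero for two or more factors expresses that p_k pairs to 0 with decomposable
-- elements.
tailValue : ℕ → List Part → ℤ
tailValue w []            = ⁺ w
tailValue w (d ∷ [])      = - (⁺ proj₁ d)
tailValue w (_ ∷ _ ∷ _)   = 0ℤ

-- Only splits with at most one part on the right contribute: x + `total` δ when there is none, and
-- the negative of each part of δ when it stands there alone.
∑-tailValue : ∀ x δ → ∑ (splits δ) (λ (as , bs) → tailValue (x + total as) bs) ≡ ⁺ x
∑-tailValue x [] = trans (ℤₚ.+-identityʳ _) (cong ⁺_ (ℕₚ.+-identityʳ x))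
∑-tailValue x ((d , b) ∷ δ) = begin
  ∑ (splits ((d , b) ∷ δ)) G
    ≡⟨ ∑-splits-∷ (d , b) δ {G} ⟩
  ∑ (splits δ) (λ (as , bs) → tailValue (x + (d + total as)) bs) +ᶻ ∑ (splits δ) (λ (as , bs) → G (as , (d , b) ∷ bs))
    ≡⟨ cong₂ _+ᶻ_ (trans (∑-cong (splits δ) (λ (as , bs) → cong (λ z → tailValue z bs) (sym (ℕₚ.+-assoc x d _)))) (∑-tailValue (x + d) δ))
         (∑-splits-[]ʳ δ (λ _ _ _ → refl)) ⟩
  ⁺ (x + d) +ᶻ - (⁺ d)
    ≡⟨ lemma (⁺ x) (⁺ d) ⟩
  ⁺ x ∎
  where
  open ≡-Reasoning
  G : List Part × List Part → ℤ
  G (as , bs) = tailValue (x + total as) bs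
  lemma : ∀ a b → (a +ᶻ b) +ᶻ - b ≡ a
  lemma = ℤ-Solver.solve-∀

nonzero? : ℕ → ℤ
nonzero? zero    = 0ℤ
nonzero? (suc _) = 1ℤ

-- `nonzero?` leaves out the split with nothing on the left, since a new part of the composition has
-- positive size. For two or more parts that term is 0 anyway and `∑-tailValue` applies at x = 0;
-- for one part the sum is this part; the empty list fails the condition on the degree.
∑-tailValue-nonzero : ∀ w δ → All Positive δ → ∀ k →
  ⟦ total δ ≡ᵇ suc k ⟧ *ᶻ - ∑ (splits δ) (λ (as , bs) → nonzero? (total as) *ᶻ tailValue (total as) bs) ≡
  ⟦ total δ ≡ᵇ suc k ⟧ *ᶻ tailValue w δ
∑-tailValue-nonzero w [] _ k = refl
∑-tailValue-nonzero w ((suc d , b) ∷ []) (z<s ∷ _) k =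
  cong (λ z → ⟦ d + 0 ≡ᵇ k ⟧ *ᶻ - z) (trans (lemma (⁺ suc (d + 0))) (cong (⁺_ ∘ suc) (ℕₚ.+-identityʳ d)))
  where
  lemma : ∀ a → 1ℤ *ᶻ a +ᶻ (0ℤ +ᶻ 0ℤ) ≡ a
  lemma = ℤ-Solver.solve-∀
∑-tailValue-nonzero w (x ∷ y ∷ δ) pos@(px ∷ _) k = cong (λ z → ⟦ total (x ∷ y ∷ δ) ≡ᵇ suc k ⟧ *ᶻ - z)
  (trans (∑-cong∈ (splits (x ∷ y ∷ δ)) (λ {s} s∈ → term s (splits-↭ (x ∷ y ∷ δ) s∈))) (∑-tailValue 0 (x ∷ y ∷ δ)))
  where
  term : ∀ s → proj₁ s ++ proj₂ s ↭ x ∷ y ∷ δ →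
    nonzero? (total (proj₁ s)) *ᶻ tailValue (total (proj₁ s)) (proj₂ s) ≡ tailValue (total (proj₁ s)) (proj₂ s)
  term ([] , []) p with () ← Permₚ.↭-empty-inv (↭-sym p)
  term ([] , b ∷ []) p with () ← Permₚ.↭-singleton-inv (↭-sym p)
  term ([] , _ ∷ _ ∷ _) p = refl
  term (a ∷ as , bs) p with total (a ∷ as) | total>0 {a} {as} (All.head (Permₚ.All-resp-↭ (↭-sym p) pos))
  ... | suc t | _ = ℤₚ.*-identityˡ _

-- Induction on the number of variables by way of the set of parts sent to the first one. While
-- zeros are still expected this set is empty; where a new part of the composition starts it is
-- nonempty, and its total is the size of that part.
powerSums-runWeight : ∀ σ k r w δ → All Positive δ → powerSums (vectors σ k) δ (runWeight r w) ≡
  signs σ δ *ᶻ (⟦ total δ + r ≡ᵇ k ⟧ *ᶻ tailValue w δ)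
powerSums-runWeight σ zero zero w [] _ = sym (trans (ℤₚ.*-identityˡ _) (ℤₚ.*-identityˡ _))
powerSums-runWeight σ zero (suc r) w [] _ = refl
powerSums-runWeight σ zero r w ((suc d , b) ∷ δ) (z<s ∷ _) = sym (ℤₚ.*-zeroʳ (signs σ ((suc d , b) ∷ δ)))
powerSums-runWeight σ (suc k) (suc r) w δ pos = begin
  powerSums (vectors σ (suc k)) δ (runWeight (suc r) w)
    ≡⟨ powerSums-suc σ k δ ⟩
  ∑ (splits δ) (λ (as , bs) → signs σ as *ᶻ powerSums (vectors σ k) bs (λ v → runWeight (suc r) w (total as ∷ v)))
    ≡⟨ ∑-cong∈ (splits δ) (λ {s} s∈ → drop-nonempty s (splits-↭ δ s∈)) ⟩
  ∑ (splits δ) G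
    ≡⟨ ∑-splits-[]ˡ δ (λ _ _ _ → refl) ⟩
  powerSums (vectors σ k) δ (runWeight r w)
    ≡⟨ powerSums-runWeight σ k r w δ pos ⟩
  signs σ δ *ᶻ (⟦ total δ + r ≡ᵇ k ⟧ *ᶻ tailValue w δ)
    ≡⟨ cong (λ z → signs σ δ *ᶻ (⟦ z ≡ᵇ suc k ⟧ *ᶻ tailValue w δ)) (sym (ℕₚ.+-suc (total δ) r)) ⟩
  signs σ δ *ᶻ (⟦ total δ + suc r ≡ᵇ suc k ⟧ *ᶻ tailValue w δ) ∎
  where
  open ≡-Reasoning
  G : List Part × List Part → ℤ
  G ([] , bs) = powerSums (vectors σ k) bs (runWeight r w)
  G (_ ∷ _ , _) = 0ℤ
  drop-nonempty : ∀ s → proj₁ s ++ proj₂ s ↭ δ →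
    signs σ (proj₁ s) *ᶻ powerSums (vectors σ k) (proj₂ s) (λ v → runWeight (suc r) w (total (proj₁ s) ∷ v)) ≡ G s
  drop-nonempty ([] , bs) p = ℤₚ.*-identityˡ _
  drop-nonempty (a ∷ as , bs) p with total (a ∷ as) | total>0 {a} {as} (All.head (Permₚ.All-resp-↭ (↭-sym p) pos))
  ... | suc t | _ = trans (cong (signs σ (a ∷ as) *ᶻ_) (powerSums-0 (vectors σ k) bs (λ _ → refl))) (ℤₚ.*-zeroʳ (signs σ (a ∷ as)))
powerSums-runWeight σ (suc k) zero w δ pos = begin
  powerSums (vectors σ (suc k)) δ (runWeight zero w)
    ≡⟨ powerSums-suc σ k δ ⟩
  ∑ (splits δ) (λ (as , bs) → signs σ as *ᶻ powerSums (vectors σ k) bs (λ v → runWeight zero w (total as ∷ v)))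
    ≡⟨ ∑-cong∈ (splits δ) (λ {s} s∈ → term s (splits-↭ δ s∈)) ⟩
  ∑ (splits δ) (λ (as , bs) → - (signs σ δ *ᶻ ⟦ total δ ≡ᵇ suc k ⟧) *ᶻ (nonzero? (total as) *ᶻ tailValue (total as) bs))
    ≡⟨ ∑-*ˡ (splits δ) (- (signs σ δ *ᶻ ⟦ total δ ≡ᵇ suc k ⟧)) ⟩
  - (signs σ δ *ᶻ ⟦ total δ ≡ᵇ suc k ⟧) *ᶻ ∑ (splits δ) (λ (as , bs) → nonzero? (total as) *ᶻ tailValue (total as) bs)
    ≡⟨ assoc (signs σ δ) ⟦ total δ ≡ᵇ suc k ⟧ _ ⟩
  signs σ δ *ᶻ (⟦ total δ ≡ᵇ suc k ⟧ *ᶻ - ∑ (splits δ) (λ (as , bs) → nonzero? (total as) *ᶻ tailValue (total as) bs))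
    ≡⟨ cong (signs σ δ *ᶻ_) (∑-tailValue-nonzero w δ pos k) ⟩
  signs σ δ *ᶻ (⟦ total δ ≡ᵇ suc k ⟧ *ᶻ tailValue w δ)
    ≡⟨ cong (λ z → signs σ δ *ᶻ (⟦ z ≡ᵇ suc k ⟧ *ᶻ tailValue w δ)) (sym (ℕₚ.+-identityʳ (total δ))) ⟩
  signs σ δ *ᶻ (⟦ total δ + zero ≡ᵇ suc k ⟧ *ᶻ tailValue w δ) ∎
  where
  open ≡-Reasoning
  assoc : ∀ a b c → - (a *ᶻ b) *ᶻ c ≡ a *ᶻ (b *ᶻ - c)
  assoc = ℤ-Solver.solve-∀
  rearrange : ∀ a b c d → a *ᶻ (- 1ℤ *ᶻ (b *ᶻ (c *ᶻ d))) ≡ - ((a *ᶻ b) *ᶻ c) *ᶻ (1ℤ *ᶻ d)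
  rearrange = ℤ-Solver.solve-∀
  term : ∀ s → proj₁ s ++ proj₂ s ↭ δ →
    signs σ (proj₁ s) *ᶻ powerSums (vectors σ k) (proj₂ s) (λ v → runWeight zero w (total (proj₁ s) ∷ v)) ≡
    - (signs σ δ *ᶻ ⟦ total δ ≡ᵇ suc k ⟧) *ᶻ (nonzero? (total (proj₁ s)) *ᶻ tailValue (total (proj₁ s)) (proj₂ s))
  term (as , bs) p with total as in eq
  ... | zero = trans (cong (signs σ as *ᶻ_) (powerSums-0 (vectors σ k) bs (λ _ → refl)))
                 (trans (ℤₚ.*-zeroʳ (signs σ as)) (sym (ℤₚ.*-zeroʳ (- (signs σ δ *ᶻ ⟦ total δ ≡ᵇ suc k ⟧)))))
  -- A part of size `suc c` is followed by c more zeros before the next one may start.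
  ... | suc c = begin
    signs σ as *ᶻ powerSums (vectors σ k) bs (λ v → - runWeight c (suc c) v)
      ≡⟨ cong (signs σ as *ᶻ_) (trans (powerSums-cong (vectors σ k) bs (λ v → sym (ℤₚ.-1*i≡-i _))) (powerSums-*ˡ (vectors σ k) (- 1ℤ) bs)) ⟩
    signs σ as *ᶻ (- 1ℤ *ᶻ powerSums (vectors σ k) bs (runWeight c (suc c)))
      ≡⟨ cong (λ z → signs σ as *ᶻ (- 1ℤ *ᶻ z)) (powerSums-runWeight σ k c (suc c) bs (Allₚ.++⁻ʳ as (Permₚ.All-resp-↭ (↭-sym p) pos))) ⟩
    signs σ as *ᶻ (- 1ℤ *ᶻ (signs σ bs *ᶻ (⟦ total bs + c ≡ᵇ k ⟧ *ᶻ tailValue (suc c) bs)))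
      ≡⟨ rearrange (signs σ as) (signs σ bs) ⟦ total bs + c ≡ᵇ k ⟧ _ ⟩
    - ((signs σ as *ᶻ signs σ bs) *ᶻ ⟦ total bs + c ≡ᵇ k ⟧) *ᶻ (1ℤ *ᶻ tailValue (suc c) bs)
      ≡⟨ cong₂ (λ y z → - (y *ᶻ ⟦ z ≡ᵇ suc k ⟧) *ᶻ (1ℤ *ᶻ tailValue (suc c) bs))
           (trans (sym (signs-++ σ as bs)) (signs-↭ σ p)) size≡ ⟩
    - (signs σ δ *ᶻ ⟦ total δ ≡ᵇ suc k ⟧) *ᶻ (1ℤ *ᶻ tailValue (suc c) bs) ∎
    where
    size≡ : suc (total bs + c) ≡ total δ
    size≡ = trans (cong suc (ℕₚ.+-comm (total bs) c)) (trans (cong (_+ total bs) (sym eq)) (trans (sym (total-++ as bs)) (total-↭ p)))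

monos : ℕ → Space
monos N = vectors (λ _ → 1ℤ) N ⊠ vectors sg N

-- The functional that represents pairing with p_k(x) + `sg b` · p_k(y). `runWeight` has one sign
-- for every part of the composition, the expansion of p_k one less, hence the minus signs.
blockWeight : ∀ {k} → Bool → Mono k → ℤ
blockWeight b (x , y) = - 1ℤ *ᶻ (runWeight 0 0 x *ᶻ isZero y) +ᶻ - sg b *ᶻ (isZero x *ᶻ runWeight 0 0 y)

-- The pairing of p_k(x) ± p_k(y) with p_d(x) ± p_d(y): for d = k each alphabet contributes k up to
-- sign, and the two contributions cancel when exactly one of the parts is barred.
typeWeight : Part → Part → ℤ
typeWeight (k , b) (d , b') = if (d ≡ᵇ k) ∧ eqBool b' b then ⁺ (2 * k) else 0ℤ

typeWeight-formula : ∀ k b d b' → - 1ℤ *ᶻ (1ℤ *ᶻ (⟦ d ≡ᵇ k ⟧ *ᶻ - (⁺ d))) +ᶻ - sg b *ᶻ (sg b' *ᶻ (⟦ d ≡ᵇ k ⟧ *ᶻ - (⁺ d)))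
  ≡ typeWeight (k , b) (d , b')
typeWeight-formula k b d b' with d ≡ᵇ k in eq
... | false = trans (cong (λ z → 0ℤ +ᶻ - sg b *ᶻ z) (ℤₚ.*-zeroʳ (sg b'))) (cong (0ℤ +ᶻ_) (ℤₚ.*-zeroʳ (- sg b)))
... | true with refl ← ℕₚ.≡ᵇ⇒≡ d k (≡⇒T eq) = cases b b'
  where
  same : ∀ s x → s *ᶻ s ≡ 1ℤ → - 1ℤ *ᶻ (1ℤ *ᶻ (1ℤ *ᶻ - x)) +ᶻ - s *ᶻ (s *ᶻ (1ℤ *ᶻ - x)) ≡ x +ᶻ x
  same s x h = trans (lemma s x) (trans (cong (λ z → x +ᶻ z *ᶻ x) h) (cong (x +ᶻ_) (ℤₚ.*-identityˡ x)))
    where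
    lemma : ∀ s x → - 1ℤ *ᶻ (1ℤ *ᶻ (1ℤ *ᶻ - x)) +ᶻ - s *ᶻ (s *ᶻ (1ℤ *ᶻ - x)) ≡ x +ᶻ (s *ᶻ s) *ᶻ x
    lemma = ℤ-Solver.solve-∀
  diff : ∀ s t x → s *ᶻ t ≡ - 1ℤ → - 1ℤ *ᶻ (1ℤ *ᶻ (1ℤ *ᶻ - x)) +ᶻ - s *ᶻ (t *ᶻ (1ℤ *ᶻ - x)) ≡ 0ℤ
  diff s t x h = trans (lemma s t x) (trans (cong (λ z → x +ᶻ z *ᶻ x) h) (lemma' x))
    where
    lemma : ∀ s t x → - 1ℤ *ᶻ (1ℤ *ᶻ (1ℤ *ᶻ - x)) +ᶻ - s *ᶻ (t *ᶻ (1ℤ *ᶻ - x)) ≡ x +ᶻ (s *ᶻ t) *ᶻ x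
    lemma = ℤ-Solver.solve-∀
    lemma' : ∀ x → x +ᶻ - 1ℤ *ᶻ x ≡ 0ℤ
    lemma' = ℤ-Solver.solve-∀
  2* : ⁺ d +ᶻ ⁺ d ≡ ⁺ (2 * d)
  2* = cong (λ z → ⁺ (d + z)) (sym (ℕₚ.+-identityʳ d))
  cases : ∀ b b' → - 1ℤ *ᶻ (1ℤ *ᶻ (1ℤ *ᶻ - (⁺ d))) +ᶻ - sg b *ᶻ (sg b' *ᶻ (1ℤ *ᶻ - (⁺ d)))
    ≡ (if eqBool b' b then ⁺ (2 * d) else 0ℤ)
  cases true true = trans (same (- 1ℤ) (⁺ d) refl) 2*
  cases false false = trans (same 1ℤ (⁺ d) refl) 2*
  cases true false = diff (- 1ℤ) 1ℤ (⁺ d) refl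
  cases false true = diff 1ℤ (- 1ℤ) (⁺ d) refl

-- The factor `isZero` forces all parts of δ into the other alphabet, so a single split survives in
-- each summand.
powerSums-blockWeight : ∀ k b δ → All Positive δ → powerSums (monos k) δ (blockWeight b) ≡
  - 1ℤ *ᶻ (1ℤ *ᶻ (⟦ total δ + 0 ≡ᵇ k ⟧ *ᶻ tailValue 0 δ)) +ᶻ - sg b *ᶻ (signs sg δ *ᶻ (⟦ total δ + 0 ≡ᵇ k ⟧ *ᶻ tailValue 0 δ))
powerSums-blockWeight k b δ pos = trans (powerSums-linear (monos k) (- 1ℤ) (- sg b) δ)
  (cong₂ (λ y z → - 1ℤ *ᶻ y +ᶻ - sg b *ᶻ z) xs ys)
  where
  X Y : Space
  X = vectors (λ _ → 1ℤ) k
  Y = vectors sg k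
  G H : List Part × List Part → ℤ
  G (as , []) = powerSums X as (runWeight 0 0)
  G (as , _ ∷ _) = 0ℤ
  H ([] , bs) = powerSums Y bs (runWeight 0 0)
  H (_ ∷ _ , bs) = 0ℤ
  G≡ : ∀ s → proj₁ s ++ proj₂ s ↭ δ →
    powerSums X (proj₁ s) (λ x → powerSums Y (proj₂ s) (λ y → runWeight 0 0 x *ᶻ isZero y)) ≡ G s
  G≡ (as , []) p = powerSums-cong X as (λ x → trans (cong (runWeight 0 0 x *ᶻ_) (isZero-zeros k)) (ℤₚ.*-identityʳ _))
  G≡ (as , c ∷ bs) p = powerSums-0 X as (λ x → trans (powerSums-*ˡ Y (runWeight 0 0 x) (c ∷ bs) {isZero})
    (trans (cong (runWeight 0 0 x *ᶻ_) (powerSums-isZero sg k (All.head (Allₚ.++⁻ʳ as (Permₚ.All-resp-↭ (↭-sym p) pos))) bs))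
      (ℤₚ.*-zeroʳ (runWeight 0 0 x))))
  H≡ : ∀ s → proj₁ s ++ proj₂ s ↭ δ →
    powerSums X (proj₁ s) (λ x → powerSums Y (proj₂ s) (λ y → isZero x *ᶻ runWeight 0 0 y)) ≡ H s
  H≡ ([] , bs) p = powerSums-cong Y bs (λ y → trans (cong (_*ᶻ runWeight 0 0 y) (isZero-zeros k)) (ℤₚ.*-identityˡ _))
  H≡ (c ∷ as , bs) p = trans (powerSums-cong X (c ∷ as) (λ x → powerSums-*ˡ Y (isZero x) bs {runWeight 0 0}))
    (trans (powerSums-*ʳ X (powerSums Y bs (runWeight 0 0)) (c ∷ as) {isZero})
      (cong (_*ᶻ powerSums Y bs (runWeight 0 0)) (powerSums-isZero (λ _ → 1ℤ) k {c} (All.head (Permₚ.All-resp-↭ (↭-sym p) pos)) as)))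
  xs : powerSums (monos k) δ (λ (x , y) → runWeight 0 0 x *ᶻ isZero y) ≡ 1ℤ *ᶻ (⟦ total δ + 0 ≡ᵇ k ⟧ *ᶻ tailValue 0 δ)
  xs = trans (powerSums-⊠ X Y δ) (trans (∑-cong∈ (splits δ) (λ {s} s∈ → G≡ s (splits-↭ δ s∈)))
    (trans (∑-splits-[]ʳ δ (λ _ _ _ → refl)) (trans (powerSums-runWeight (λ _ → 1ℤ) k 0 0 δ pos)
      (cong (_*ᶻ (⟦ total δ + 0 ≡ᵇ k ⟧ *ᶻ tailValue 0 δ)) (signs-1 δ)))))
  ys : powerSums (monos k) δ (λ (x , y) → isZero x *ᶻ runWeight 0 0 y) ≡ signs sg δ *ᶻ (⟦ total δ + 0 ≡ᵇ k ⟧ *ᶻ tailValue 0 δ)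
  ys = trans (powerSums-⊠ X Y δ) (trans (∑-cong∈ (splits δ) (λ {s} s∈ → H≡ s (splits-↭ δ s∈)))
    (trans (∑-splits-[]ˡ δ (λ _ _ _ → refl)) (powerSums-runWeight sg k 0 0 δ pos)))

-- The number of matchings of the parts of γ with equal parts of δ, times ∏ 2k over the parts k of γ:
-- this is the order of the centralizer if γ and δ are rearrangements of each other, and 0 otherwise.
matchings : List Part → List Part → ℤ
matchings []      []      = 1ℤ
matchings []      (_ ∷ _) = 0ℤ
matchings (c ∷ γ) δ       = ∑ (picks δ) (λ (a , δ') → typeWeight c a *ᶻ matchings γ δ')

-- The property of L on which the induction over γ rests: each block reads its own segment of the
-- variables and contributes a factor.
Multiplicative : (∀ γ → Mono (total γ) → ℤ) → Set
Multiplicative F = F [] ([] , []) ≡ 1ℤ × (∀ k b γ (x y : Vec ℕ (suc k)) (x' y' : Vec ℕ (total γ)) →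
  F ((suc k , b) ∷ γ) (x Vec.++ x' , y Vec.++ y') ≡ blockWeight b (x , y) *ᶻ F γ (x' , y'))

zeros-++ : ∀ k m → zeros k Vec.++ zeros m ≡ zeros (k + m)
zeros-++ zero m = refl
zeros-++ (suc k) m = cong (0 ∷_) (zeros-++ k m)

⊞-++ : ∀ {k m} (x x' : Vec ℕ k) (y y' : Vec ℕ m) → (x ⊞ x') Vec.++ (y ⊞ y') ≡ (x Vec.++ y) ⊞ (x' Vec.++ y')
⊞-++ [] [] y y' = refl
⊞-++ (a ∷ x) (a' ∷ x') y y' = cong (_ ∷_) (⊞-++ x x' y y')

units-+ : ∀ d k m → units d (k + m) ≡ map (Vec._++ zeros m) (units d k) ++ map (zeros k Vec.++_) (units d m)
units-+ d zero m = sym (Listₚ.map-id (units d m))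
units-+ d (suc k) m = cong₂ _∷_ (cong (d ∷_) (sym (zeros-++ k m)))
  (trans (cong (map (0 ∷_)) (units-+ d k m)) (trans (Listₚ.map-++ (0 ∷_) (map (Vec._++ zeros m) (units d k)) _)
    (cong₂ _++_ (trans (sym (Listₚ.map-∘ (units d k))) (Listₚ.map-∘ (units d k))) (sym (Listₚ.map-∘ (units d m))))))

concatMono : ∀ {k m} → Mono k × Mono m → Mono (k + m)
concatMono ((x , y) , (x' , y')) = (x Vec.++ x' , y Vec.++ y')

-- Only the order of the terms differs: the product of spaces lists x and y of the first segment
-- before x and y of the second, whereas after concatenation all x come before all y.
concatMono-gens : ∀ k m d → map (λ (s , v) → (s , concatMono v)) (gens (monos k ⊠ monos m) d) ↭ gens (monos (k + m)) d
concatMono-gens k m (d , b) = ↭-trans (↭-reflexive flatten) (↭-trans shuffle (↭-reflexive (sym unflatten)))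
  where
  Term : Set
  Term = ℤ × Mono (k + m)
  x₁ x₂ y₁ y₂ : List Term
  x₁ = map (λ u → (1ℤ , (u Vec.++ zeros m , zeros k Vec.++ zeros m))) (units d k)
  x₂ = map (λ u → (1ℤ , (zeros k Vec.++ u , zeros k Vec.++ zeros m))) (units d m)
  y₁ = map (λ u → (sg b , (zeros k Vec.++ zeros m , u Vec.++ zeros m))) (units d k)
  y₂ = map (λ u → (sg b , (zeros k Vec.++ zeros m , zeros k Vec.++ u))) (units d m)
  map₃ : {A B C D : Set} (f : A → B) (g : B → C) (h : C → D) (xs : List A) → map h (map g (map f xs)) ≡ map (h ∘ g ∘ f) xs
  map₃ f g h xs = trans (sym (Listₚ.map-∘ (map f xs))) (sym (Listₚ.map-∘ xs))
  map₄ : {A B C D E : Set} (f : A → B) (g : B → C) (h : C → D) (i : D → E) (xs : List A) → map i (map h (map g (map f xs))) ≡ map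
    (i ∘ h ∘ g ∘ f) xs
  map₄ f g h i xs = trans (cong (map i) (map₃ f g h xs)) (sym (Listₚ.map-∘ xs))
  flatten : map (λ (s , v) → (s , concatMono v)) (gens (monos k ⊠ monos m) (d , b)) ≡ (x₁ ++ y₁) ++ (x₂ ++ y₂)
  flatten = trans (Listₚ.map-++ _ (map _ (gens (monos k) (d , b))) _) (cong₂ _++_
    (trans (cong (map _) (Listₚ.map-++ _ (map _ (map _ (units d k))) _)) (trans (Listₚ.map-++ _ (map _ (map _ (map _ (units d k)))) _)
      (cong₂ _++_ (map₄ _ _ _ _ (units d k)) (map₄ _ _ _ _ (units d k)))))
    (trans (cong (map _) (Listₚ.map-++ _ (map _ (map _ (units d m))) _)) (trans (Listₚ.map-++ _ (map _ (map _ (map _ (units d m)))) _)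
      (cong₂ _++_ (map₄ _ _ _ _ (units d m)) (map₄ _ _ _ _ (units d m))))))
  split-units : {B : Set} (f : Vec ℕ (k + m) → B) → map f (units d (k + m)) ≡
    map (λ u → f (u Vec.++ zeros m)) (units d k) ++ map (λ u → f (zeros k Vec.++ u)) (units d m)
  split-units f = trans (cong (map f) (units-+ d k m)) (trans (Listₚ.map-++ f (map (Vec._++ zeros m) (units d k)) _)
    (cong₂ _++_ (sym (Listₚ.map-∘ (units d k))) (sym (Listₚ.map-∘ (units d m)))))
  unflatten : gens (monos (k + m)) (d , b) ≡ (x₁ ++ x₂) ++ (y₁ ++ y₂)
  unflatten rewrite zeros-++ k m = cong₂ _++_
    (trans (sym (Listₚ.map-∘ (units d (k + m)))) (split-units _))
    (trans (sym (Listₚ.map-∘ (units d (k + m)))) (split-units _))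
  shuffle : (x₁ ++ y₁) ++ (x₂ ++ y₂) ↭ (x₁ ++ x₂) ++ (y₁ ++ y₂)
  shuffle = ↭-trans (↭-reflexive (Listₚ.++-assoc x₁ y₁ (x₂ ++ y₂)))
    (↭-trans (Permₚ.++⁺ˡ x₁ (Permₚ.shifts y₁ x₂)) (↭-reflexive (sym (Listₚ.++-assoc x₁ x₂ (y₁ ++ y₂)))))

-- Cutting the variables at the end of the first block distributes the parts of δ over the two
-- sides. The first block gives 0 unless it receives exactly one part, so the sum runs over the
-- choices of a partner for the first part of γ.
powerSums-matchings : ∀ F → Multiplicative F → ∀ γ δ → All Positive γ → All Positive δ →
  powerSums (monos (total γ)) δ (F γ) ≡ matchings γ δ
powerSums-matchings F (F[] , F∷) [] [] _ _ = F[]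
powerSums-matchings F (F[] , F∷) [] (d ∷ δ) _ _ = refl
powerSums-matchings F mult@(F[] , F∷) ((suc k , b) ∷ γ) δ (z<s ∷ γ>0) δ>0 = begin
  powerSums (monos (suc k + total γ)) δ (F ((suc k , b) ∷ γ))
    ≡⟨ sym (powerSums-hom (monos (suc k) ⊠ monos (total γ)) (monos (suc k + total γ)) concatMono
         (cong₂ _,_ (zeros-++ (suc k) (total γ)) (zeros-++ (suc k) (total γ)))
         (λ ((x , y) , (x' , y')) ((u , v) , (u' , v')) → cong₂ _,_ (⊞-++ x u x' u') (⊞-++ y v y' v'))
         (concatMono-gens (suc k) (total γ)) δ) ⟩
  powerSums (monos (suc k) ⊠ monos (total γ)) δ (F ((suc k , b) ∷ γ) ∘ concatMono)
    ≡⟨ powerSums-cong (monos (suc k) ⊠ monos (total γ)) δ (λ ((x , y) , (x' , y')) → F∷ k b γ x y x' y') ⟩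
  powerSums (monos (suc k) ⊠ monos (total γ)) δ (λ (v , w) → blockWeight b v *ᶻ F γ w)
    ≡⟨ powerSums-⊠ (monos (suc k)) (monos (total γ)) δ ⟩
  ∑ (splits δ) (λ (as , bs) → powerSums (monos (suc k)) as (λ v → powerSums (monos (total γ)) bs (λ w → blockWeight b v *ᶻ F γ w)))
    ≡⟨ ∑-cong∈ (splits δ) (λ {s} s∈ → term s (splits-↭ δ s∈)) ⟩
  ∑ (splits δ) G
    ≡⟨ ∑-splits-[-] δ (λ _ → refl) (λ _ _ _ _ → refl) ⟩
  matchings ((suc k , b) ∷ γ) δ ∎
  where
  open ≡-Reasoning
  G : List Part × List Part → ℤ
  G ([] , bs) = 0ℤ
  G (a ∷ [] , bs) = typeWeight (suc k , b) a *ᶻ matchings γ bs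
  G (_ ∷ _ ∷ _ , bs) = 0ℤ
  block≡ : ∀ as bs → powerSums (monos (suc k)) as (blockWeight b) *ᶻ matchings γ bs ≡ G (as , bs) → All Positive bs →
    powerSums (monos (suc k)) as (λ v → powerSums (monos (total γ)) bs (λ w → blockWeight b v *ᶻ F γ w)) ≡ G (as , bs)
  block≡ as bs h pos = trans (powerSums-cong (monos (suc k)) as (λ v → powerSums-*ˡ (monos (total γ)) (blockWeight b v) bs))
    (trans (powerSums-*ʳ (monos (suc k)) (powerSums (monos (total γ)) bs (F γ)) as)
      (trans (cong (powerSums (monos (suc k)) as (blockWeight b) *ᶻ_) (powerSums-matchings F mult γ bs γ>0 pos)) h))
  vanish : ∀ as → ⟦ total as + 0 ≡ᵇ suc k ⟧ *ᶻ tailValue 0 as ≡ 0ℤ → All Positive as → powerSums (monos (suc k)) as (blockWeight b) ≡ 0ℤ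
  vanish as h pos = trans (powerSums-blockWeight (suc k) b as pos) (trans (cong (λ z → - 1ℤ *ᶻ (1ℤ *ᶻ z) +ᶻ - sg b *ᶻ (signs sg as *ᶻ z)) h)
    (lemma (sg b) (signs sg as)))
    where
    lemma : ∀ s t → - 1ℤ *ᶻ (1ℤ *ᶻ 0ℤ) +ᶻ - s *ᶻ (t *ᶻ 0ℤ) ≡ 0ℤ
    lemma = ℤ-Solver.solve-∀
  total-[-] : ∀ x → total (x ∷ []) + 0 ≡ proj₁ x
  total-[-] x = trans (ℕₚ.+-identityʳ (total (x ∷ []))) (ℕₚ.+-identityʳ (proj₁ x))
  term : ∀ s → proj₁ s ++ proj₂ s ↭ δ →
    powerSums (monos (suc k)) (proj₁ s) (λ v → powerSums (monos (total γ)) (proj₂ s) (λ w → blockWeight b v *ᶻ F γ w)) ≡ G s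
  term (as , bs) p with Permₚ.All-resp-↭ (↭-sym p) δ>0
  term ([] , bs) p | pos = block≡ [] bs (cong (_*ᶻ matchings γ bs) (vanish [] refl [])) pos
  term (x ∷ [] , bs) p | px ∷ pos = block≡ (x ∷ []) bs
    (cong (_*ᶻ matchings γ bs) (trans (powerSums-blockWeight (suc k) b (x ∷ []) (px ∷ []))
    (trans (cong₂ (λ y z → - 1ℤ *ᶻ (1ℤ *ᶻ (⟦ y ≡ᵇ suc k ⟧ *ᶻ - (⁺ proj₁ x))) +ᶻ - sg b *ᶻ (z *ᶻ (⟦ y ≡ᵇ suc k ⟧ *ᶻ - (⁺ proj₁ x))))
      (total-[-] x) (ℤₚ.*-identityʳ (sg (proj₂ x)))) (typeWeight-formula (suc k) b (proj₁ x) (proj₂ x))))) pos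
  term (x ∷ y ∷ as , bs) p | px ∷ py ∷ pos = block≡ (x ∷ y ∷ as) bs (cong (_*ᶻ matchings γ bs)
    (vanish (x ∷ y ∷ as) (ℤₚ.*-zeroʳ ⟦ total (x ∷ y ∷ as) + 0 ≡ᵇ suc k ⟧) (px ∷ py ∷ Allₚ.++⁻ˡ as pos))) (Allₚ.++⁻ʳ as pos)

-- Coefficient extraction as evaluation of a linear functional

evalPoly : ∀ {N} → (Mono N → ℤ) → Poly N → ℤ
evalPoly F p = ∑ p (λ (c , m) → c *ᶻ F m)

∑-coeff : ∀ {N} {X : Set} (fam : List X) (a : X → ℤ) (mono : X → Mono N) (p : Poly N) →
  ∑ fam (λ f → a f *ᶻ coeff p (mono f)) ≡ evalPoly (λ m → ∑ fam (λ f → a f *ᶻ ⟦ eqMono (mono f) m ⟧)) p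
∑-coeff fam a mono p = trans
  (∑-cong fam (λ f → trans (cong (a f *ᶻ_) (∑-cong p (λ (c , m) → indicator (eqMono (mono f) m) c)))
    (sym (∑-*ˡ p (a f)))))
  (trans (∑-swap fam p) (∑-cong p (λ (c , m) → trans (∑-cong fam (λ f → *-exchange (a f) c _)) (∑-*ˡ fam c))))
  where
  indicator : ∀ t c → (if t then c else 0ℤ) ≡ c *ᶻ ⟦ t ⟧
  indicator true c = sym (ℤₚ.*-identityʳ c)
  indicator false c = sym (ℤₚ.*-zeroʳ c)

_⊕ᴹ_ : ∀ {N} → Mono N → Mono N → Mono N
(x , y) ⊕ᴹ (x' , y') = (x ⊞ x' , y ⊞ y')

evalPoly-⊗ : ∀ {N} (F : Mono N → ℤ) p q → evalPoly F (p ⊗ q) ≡ evalPoly (λ m → evalPoly (λ m' → F (m ⊕ᴹ m')) q) p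
evalPoly-⊗ F p q = trans (∑-concatMap _ p) (∑-cong p (λ (c , m) → trans (∑-map _ q)
  (trans (∑-cong q (λ (d , m') → ℤₚ.*-assoc c d _)) (∑-*ˡ q c))))

kE-units : ∀ d N → map (kE d) (allFinL N) ≡ units d N
kE-units d N = trans (cong (map (kE d)) (allFinL≡ N)) (trans (Listₚ.map-tabulate id (kE d)) (lemma N))
  where
  tabulate-0 : ∀ N → Vec.tabulate {n = N} (λ _ → 0) ≡ zeros N
  tabulate-0 zero = refl
  tabulate-0 (suc N) = cong (0 ∷_) (tabulate-0 N)
  lemma : ∀ N → tabulate (kE {N} d) ≡ units d N
  lemma zero = refl
  lemma (suc N) = cong₂ _∷_ (cong (d ∷_) (tabulate-0 N))
    (trans (sym (Listₚ.map-tabulate (kE {N} d) (0 ∷_))) (cong (map (0 ∷_)) (lemma N)))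

powerSum≡gens : ∀ N k b → (if b then pMinus N k else pPlus N k) ≡ gens (monos N) (k , b)
powerSum≡gens N k true  = cong₂ _++_ (trans (Listₚ.map-∘ (allFinL N)) (trans (cong (map _) (kE-units k N)) (Listₚ.map-∘ (units k N))))
                                    (trans (Listₚ.map-∘ (allFinL N)) (trans (cong (map _) (kE-units k N)) (Listₚ.map-∘ (units k N))))
powerSum≡gens N k false = cong₂ _++_ (trans (Listₚ.map-∘ (allFinL N)) (trans (cong (map _) (kE-units k N)) (Listₚ.map-∘ (units k N))))
                                    (trans (Listₚ.map-∘ (allFinL N)) (trans (cong (map _) (kE-units k N)) (Listₚ.map-∘ (units k N))))

⊕ᴹ-assoc : ∀ {N} (u v w : Mono N) → u ⊕ᴹ (v ⊕ᴹ w) ≡ (u ⊕ᴹ v) ⊕ᴹ w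
⊕ᴹ-assoc (u , u') (v , v') (w , w') = cong₂ _,_ (sym (Vecₚ.zipWith-assoc ℕₚ.+-assoc u v w)) (sym (Vecₚ.zipWith-assoc ℕₚ.+-assoc u' v' w'))

⊕ᴹ-comm : ∀ {N} (u v : Mono N) → u ⊕ᴹ v ≡ v ⊕ᴹ u
⊕ᴹ-comm (u , u') (v , v') = cong₂ _,_ (Vecₚ.zipWith-comm ℕₚ.+-comm u v) (Vecₚ.zipWith-comm ℕₚ.+-comm u' v')

powerSums-monos-↭ : ∀ N {δ δ'} → δ ↭ δ' → ∀ F → powerSums (monos N) δ F ≡ powerSums (monos N) δ' F
powerSums-monos-↭ N = powerSums-↭ (monos N) (λ u v w → trans (⊕ᴹ-assoc u v w) (trans (cong (_⊕ᴹ w) (⊕ᴹ-comm u v)) (sym (⊕ᴹ-assoc v u w))))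

evalPoly-pPM : ∀ N α β F → evalPoly F (pPM N α β) ≡ powerSums (monos N) (arrangement α β) F
evalPoly-pPM N α β F = trans (evalPoly-⊗ F (prodPoly (map (pPlus N) α)) (prodPoly (map (pMinus N) β)))
  (trans (prod false α _) (trans (powerSums-cong (monos N) (map (_, false) α) (λ m → prod true β _))
    (sym (powerSums-++ (monos N) ⊕ᴹ-assoc (map (_, false) α) (map (_, true) β)))))
  where
  prod : ∀ b ks F → evalPoly F (prodPoly (map (λ k → if b then pMinus N k else pPlus N k) ks)) ≡ powerSums (monos N) (map (_, b) ks) F
  prod b [] F = trans (ℤₚ.+-identityʳ _) (ℤₚ.*-identityˡ _)
  prod b (k ∷ ks) F = trans (evalPoly-⊗ F (if b then pMinus N k else pPlus N k) _)
    (trans (cong (evalPoly _) (powerSum≡gens N k b)) (∑-cong (gens (monos N) (k , b)) (λ (s , v) → cong (s *ᶻ_) (prod b ks _))))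

coeff-matchings : ∀ {X : List Part → Set} (fam : ∀ γ → List (X γ)) (a : ∀ {γ} → X γ → ℤ) (mono : ∀ γ → X γ → Mono (total γ)) →
  Multiplicative (λ γ m → ∑ (fam γ) (λ f → a f *ᶻ ⟦ eqMono (mono γ f) m ⟧)) → ∀ γ α β δ → arrangement α β ↭ δ →
  All Positive γ → All Positive δ → ∑ (fam γ) (λ f → a f *ᶻ coeff (pPM (total γ) α β) (mono γ f)) ≡ matchings γ δ
coeff-matchings fam a mono mult γ α β δ p γ>0 δ>0 = trans (∑-coeff (fam γ) a (mono γ) (pPM (total γ) α β))
  (trans (evalPoly-pPM (total γ) α β _) (trans (powerSums-monos-↭ (total γ) p _) (powerSums-matchings _ mult γ δ γ>0 δ>0)))

-- The functional dual to a product of power sums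

∑-allVecs-suc : ∀ k {f : Vec Bool (suc k) → ℤ} → ∑ (bits (suc k)) f ≡
  ∑ (bits k) (λ v → f (true ∷ v)) +ᶻ ∑ (bits k) (λ v → f (false ∷ v))
∑-allVecs-suc k {f} = trans (∑-concatMap (λ x → map (x ∷_) (bits k)) bools {f}) (cong₂ _+ᶻ_ (∑-map (true ∷_) (bits k) {f})
  (trans (ℤₚ.+-identityʳ (∑ (map (false ∷_) (bits k)) f)) (∑-map (false ∷_) (bits k) {f})))

-- A composition is given by its vector of start bits; lastRun w weighs it by (-1)^(number of starts)
-- times the size of its last part, w being the size of the part already open.
lastRun : ℕ → ∀ {k} → Vec Bool k → ℤ
lastRun w []           = ⁺ w
lastRun w (true ∷ st)  = - lastRun 1 st
lastRun w (false ∷ st) = lastRun (suc w) st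

leading : ∀ {k} → Vec Bool k → ℕ
leading []           = 0
leading (true ∷ st)  = 0
leading (false ∷ st) = suc (leading st)

-- The exponent vector of a composition in the encoding that `runWeight` recognizes: the start
-- itself together with the non-starts after it make up the size of a part.
runs : ∀ {k} → Vec Bool k → Vec ℕ k
runs []           = []
runs (true ∷ st)  = suc (leading st) ∷ runs st
runs (false ∷ st) = 0 ∷ runs st

mask : ∀ {k} → Vec Bool k → Vec ℕ k → Vec ℕ k
mask = Vec.zipWith (λ e x → if e then x else 0)

Signing : ℕ → Set
Signing n = Vec Bool n × Vec Bool n

runsMono : ∀ {n} → Signing n → Mono n
runsMono (st , e) = (mask e (runs st) , mask (Vec.map not e) (runs st))

-- A barred part read in the variables y has sign -1, every other combination +1. The block opens
-- with a start bit, so no part of the refinement crosses from one block into the next.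
prependBlock : ∀ {n} k → Bool → Bool → Vec Bool k → ℤ × Signing n → ℤ × Signing (suc k + n)
prependBlock k b s st (c , (sts , es)) =
  ((sg (b ∧ not s) *ᶻ lastRun 1 st) *ᶻ c , ((true ∷ st) Vec.++ sts , Vec.replicate (suc k) s Vec.++ es))

-- The compositions refining γ with a sign (true for the variables x) for each block of γ, and their coefficients.
family : ∀ γ → List (ℤ × Signing (total γ))
family []                = (1ℤ , ([] , [])) ∷ []
family ((zero , b) ∷ γ)  = family γ
family ((suc k , b) ∷ γ) = concatMap (λ s → concatMap (λ st →
  map (prependBlock k b s st) (family γ)) (bits k)) bools

∑-family : ∀ k b γ {f} → ∑ (family ((suc k , b) ∷ γ)) f ≡ ∑ bools (λ s → ∑ (bits k) (λ st →
  ∑ (family γ) (λ g → f (prependBlock k b s st g))))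
∑-family k b γ {f} = trans (∑-concatMap (λ s → concatMap (λ st → map (prependBlock k b s st) (family γ)) (bits k)) bools {f})
  (∑-cong bools {λ s → ∑ (concatMap (λ st → map (prependBlock k b s st) (family γ)) (bits k)) f}
    {λ s → ∑ (bits k) (λ st → ∑ (family γ) (λ g → f (prependBlock k b s st g)))}
    (λ s → trans (∑-concatMap (λ st → map (prependBlock k b s st) (family γ)) (bits k) {f})
      (∑-cong (bits k) (λ st → ∑-map (prependBlock k b s st) (family γ) {f}))))

∈-family : ∀ k b γ {f} → f ∈ family ((suc k , b) ∷ γ) →
  ∃ λ s → ∃ λ (st : Vec Bool k) → ∃ λ g → g ∈ family γ × f ≡ prependBlock k b s st g
∈-family k b γ f∈ with find (∈-concatMap⁻ (λ s → concatMap (λ st → map (prependBlock k b s st) (family γ)) (bits k)) {xs = bools} f∈)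
... | s , _ , f∈' with find (∈-concatMap⁻ (λ st → map (prependBlock k b s st) (family γ)) {xs = bits k} f∈')
... | st , _ , f∈'' with ∈-map⁻ (prependBlock k b s st) f∈''
... | g , g∈ , refl = s , st , g , g∈ , refl

leading-family : ∀ γ {f} → f ∈ family γ → leading (proj₁ (proj₂ f)) ≡ 0
leading-family [] (here refl) = refl
leading-family ((zero , b) ∷ γ) f∈ = leading-family γ f∈
leading-family ((suc k , b) ∷ γ) f∈ with ∈-family k b γ f∈
... | _ , _ , _ , _ , refl = refl

-- `lastRun` counts what the open part has received so far, `runWeight` knows its full size; the r
-- zeros still expected make up the difference. At most one start vector has given `runs`, so the
-- sum merely decodes v.
runWeight-∑ : ∀ r w {k} (v : Vec ℕ k) → runWeight r (w + r) v ≡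
  ∑ (bits k) (λ st → lastRun w st *ᶻ ⟦ (leading st ≡ᵇ r) ∧ eqVecℕ (runs st) v ⟧)
runWeight-∑ zero w [] = trans (cong ⁺_ (ℕₚ.+-identityʳ w)) (sym (trans (ℤₚ.+-identityʳ _) (ℤₚ.*-identityʳ _)))
runWeight-∑ (suc r) w [] = sym (trans (ℤₚ.+-identityʳ _) (ℤₚ.*-zeroʳ (⁺ w)))
runWeight-∑ zero w {suc k} (c ∷ v) = sym (trans (∑-allVecs-suc k) (trans (cong₂ _+ᶻ_ (starts c)
  (∑-0 (bits k) (λ {st} _ → ℤₚ.*-zeroʳ (lastRun (suc w) st)))) (ℤₚ.+-identityʳ _)))
  where
  starts : ∀ c → ∑ (bits k) (λ st → - lastRun 1 st *ᶻ ⟦ (suc (leading st) ≡ᵇ c) ∧ eqVecℕ (runs st) v ⟧) ≡ runWeight zero (w + 0) (c ∷ v)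
  starts zero = ∑-0 (bits k) (λ {st} _ → ℤₚ.*-zeroʳ (- lastRun 1 st))
  starts (suc c) = trans (∑-cong (bits k) (λ st → sym (ℤₚ.neg-distribˡ-* (lastRun 1 st) _)))
    (trans (∑-neg (bits k)) (cong -_ (sym (runWeight-∑ c 1 v))))
runWeight-∑ (suc r) w {suc k} (c ∷ v) = sym (trans (∑-allVecs-suc k) (trans (cong₂ _+ᶻ_
  (∑-0 (bits k) (λ {st} _ → ℤₚ.*-zeroʳ (- lastRun 1 st))) (continues c)) (ℤₚ.+-identityˡ _)))
  where
  continues : ∀ c → ∑ (bits k) (λ st → lastRun (suc w) st *ᶻ ⟦ (leading st ≡ᵇ r) ∧ (0 ≡ᵇ c) ∧ eqVecℕ (runs st) v ⟧)
    ≡ runWeight (suc r) (w + suc r) (c ∷ v)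
  continues zero = trans (sym (runWeight-∑ r (suc w) v)) (cong (λ z → runWeight r z v) (sym (ℕₚ.+-suc w r)))
  continues (suc c) = ∑-0 (bits k) (λ {st} _ → trans
    (cong (λ z → lastRun (suc w) st *ᶻ ⟦ z ⟧) (Boolₚ.∧-zeroʳ (leading st ≡ᵇ r))) (ℤₚ.*-zeroʳ (lastRun (suc w) st)))

∑-lastRun : ∀ {k} (x : Vec ℕ (suc k)) →
  ∑ (bits k) (λ st → lastRun 1 st *ᶻ ⟦ eqVecℕ (runs (true ∷ st)) x ⟧) ≡ - runWeight 0 0 x
∑-lastRun {k} (zero ∷ v) = ∑-0 (bits k) (λ {st} _ → ℤₚ.*-zeroʳ (lastRun 1 st))
∑-lastRun {k} (suc c ∷ v) = trans (sym (runWeight-∑ c 1 v)) (sym (ℤₚ.neg-involutive _))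

-- `leading sts ≡ 0` keeps the last part of `st` from running on into `sts`.
runs-++ : ∀ {k m} (st : Vec Bool k) (sts : Vec Bool m) → leading sts ≡ 0 → runs (st Vec.++ sts) ≡ runs st Vec.++ runs sts
runs-++ [] sts h = refl
runs-++ {suc k} (true ∷ st) sts h = cong₂ _∷_ (cong suc (leading-++ st)) (runs-++ st sts h)
  where
  leading-++ : ∀ {k} (st : Vec Bool k) → leading (st Vec.++ sts) ≡ leading st
  leading-++ [] = h
  leading-++ (true ∷ st) = refl
  leading-++ (false ∷ st) = cong suc (leading-++ st)
runs-++ (false ∷ st) sts h = cong (0 ∷_) (runs-++ st sts h)

mask-++ : ∀ {k m} (e : Vec Bool k) (es : Vec Bool m) x xs → mask (e Vec.++ es) (x Vec.++ xs) ≡ mask e x Vec.++ mask es xs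
mask-++ [] es [] xs = refl
mask-++ (b ∷ e) es (a ∷ x) xs = cong (_ ∷_) (mask-++ e es x xs)

mask-true : ∀ {k} (x : Vec ℕ k) → mask (Vec.replicate k true) x ≡ x
mask-true [] = refl
mask-true (a ∷ x) = cong (a ∷_) (mask-true x)

mask-false : ∀ {k} (x : Vec ℕ k) → mask (Vec.replicate k false) x ≡ zeros k
mask-false [] = refl
mask-false (a ∷ x) = cong (0 ∷_) (mask-false x)

eqVecℕ-++ : ∀ {k m} (u x : Vec ℕ k) (u' x' : Vec ℕ m) → eqVecℕ (u Vec.++ u') (x Vec.++ x') ≡ eqVecℕ u x ∧ eqVecℕ u' x'
eqVecℕ-++ [] [] u' x' = refl
eqVecℕ-++ (a ∷ u) (b ∷ x) u' x' = trans (cong (eqℕ a b ∧_) (eqVecℕ-++ u x u' x')) (sym (Boolₚ.∧-assoc (eqℕ a b) _ _))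

eqMono-++ : ∀ {k m} (u u' x x' : Vec ℕ k) (v v' y y' : Vec ℕ m) →
  ⟦ eqMono (u Vec.++ v , u' Vec.++ v') (x Vec.++ y , x' Vec.++ y') ⟧ ≡ ⟦ eqMono (u , u') (x , x') ⟧ *ᶻ ⟦ eqMono (v , v') (y , y') ⟧
eqMono-++ u u' x x' v v' y y' rewrite eqVecℕ-++ u x v y | eqVecℕ-++ u' x' v' y' =
  trans (cong ⟦_⟧ (shuffle (eqVecℕ u x) (eqVecℕ v y) (eqVecℕ u' x') (eqVecℕ v' y'))) (⟦∧⟧ (eqVecℕ u x ∧ eqVecℕ u' x') _)
  where
  shuffle : ∀ a b c d → (a ∧ b) ∧ (c ∧ d) ≡ (a ∧ c) ∧ (b ∧ d)
  shuffle true  b true  d = refl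
  shuffle true  b false d = Boolₚ.∧-zeroʳ b
  shuffle false b c     d = refl

runsMono-++ : ∀ {k m} (st e : Vec Bool k) (sts es : Vec Bool m) → leading sts ≡ 0 →
  runsMono (st Vec.++ sts , e Vec.++ es) ≡ concatMono (runsMono (st , e) , runsMono (sts , es))
runsMono-++ st e sts es h = cong₂ _,_
  (trans (cong (mask (e Vec.++ es)) (runs-++ st sts h)) (mask-++ e es (runs st) (runs sts)))
  (trans (cong₂ mask (Vecₚ.map-++ not e es) (runs-++ st sts h)) (mask-++ (Vec.map not e) (Vec.map not es) (runs st) (runs sts)))

familyWeight : ∀ γ → Mono (total γ) → ℤ
familyWeight γ m = ∑ (family γ) (λ f → proj₁ f *ᶻ ⟦ eqMono (runsMono (proj₂ f)) m ⟧)

-- The sign true masks y to zero and yields the summand of `blockWeight` in x; the sign false yields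
-- the one in y.
∑-block : ∀ {k} b (x y : Vec ℕ (suc k)) → ∑ bools (λ s → ∑ (bits k) (λ st →
  (sg (b ∧ not s) *ᶻ lastRun 1 st) *ᶻ ⟦ eqMono (runsMono (true ∷ st , Vec.replicate (suc k) s)) (x , y) ⟧)) ≡ blockWeight b (x , y)
∑-block {k} b x y = cong₂ _+ᶻ_ (pos (sg (b ∧ false)) refl) (trans (ℤₚ.+-identityʳ _) neg)
  where
  masked : ∀ (st : Vec Bool k) s → runsMono (true ∷ st , Vec.replicate (suc k) s) ≡
    (if s then (runs (true ∷ st) , zeros (suc k)) else (zeros (suc k) , runs (true ∷ st)))
  masked st true = cong₂ _,_ (mask-true (runs (true ∷ st)))
    (trans (cong (λ z → mask z (runs (true ∷ st))) (Vecₚ.map-replicate not true (suc k))) (mask-false (runs (true ∷ st))))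
  masked st false = cong₂ _,_ (mask-false (runs (true ∷ st)))
    (trans (cong (λ z → mask z (runs (true ∷ st))) (Vecₚ.map-replicate not false (suc k))) (mask-true (runs (true ∷ st))))
  false-sg : sg (b ∧ false) ≡ 1ℤ
  false-sg = cong sg (Boolₚ.∧-zeroʳ b)
  true-sg : sg (b ∧ true) ≡ sg b
  true-sg = cong sg (Boolₚ.∧-identityʳ b)
  lemma₁ : ∀ l a z → (1ℤ *ᶻ l) *ᶻ (a *ᶻ z) ≡ (l *ᶻ a) *ᶻ z
  lemma₁ = ℤ-Solver.solve-∀
  lemma₂ : ∀ a z → - a *ᶻ z ≡ - 1ℤ *ᶻ (a *ᶻ z)
  lemma₂ = ℤ-Solver.solve-∀
  lemma₃ : ∀ s l a z → (s *ᶻ l) *ᶻ (z *ᶻ a) ≡ (l *ᶻ a) *ᶻ (s *ᶻ z)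
  lemma₃ = ℤ-Solver.solve-∀
  lemma₄ : ∀ s a z → - a *ᶻ (s *ᶻ z) ≡ - s *ᶻ (z *ᶻ a)
  lemma₄ = ℤ-Solver.solve-∀
  pos : ∀ c → c ≡ sg (b ∧ false) → ∑ (bits k) (λ st →
    (c *ᶻ lastRun 1 st) *ᶻ ⟦ eqMono (runsMono (true ∷ st , Vec.replicate (suc k) true)) (x , y) ⟧) ≡ - 1ℤ *ᶻ (runWeight 0 0 x *ᶻ isZero y)
  pos c c≡ = trans (∑-cong (bits k) (λ st → trans (cong₂ (λ u v → (u *ᶻ lastRun 1 st) *ᶻ ⟦ eqMono v (x , y) ⟧) (trans c≡ false-sg)
    (masked st true))
      (trans (cong ((1ℤ *ᶻ lastRun 1 st) *ᶻ_) (⟦∧⟧ (eqVecℕ (runs (true ∷ st)) x) _))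
        (lemma₁ (lastRun 1 st) ⟦ eqVecℕ (runs (true ∷ st)) x ⟧ (isZero y)))))
    (trans (∑-*ʳ (bits k) (isZero y)) (trans (cong (_*ᶻ isZero y) (∑-lastRun x)) (lemma₂ (runWeight 0 0 x) (isZero y))))
  neg : ∑ (bits k) (λ st →
    (sg (b ∧ true) *ᶻ lastRun 1 st) *ᶻ ⟦ eqMono (runsMono (true ∷ st , Vec.replicate (suc k) false)) (x , y) ⟧) ≡ - sg b *ᶻ
      (isZero x *ᶻ runWeight 0 0 y)
  neg = trans (∑-cong (bits k) (λ st → trans (cong₂ (λ u v → (u *ᶻ lastRun 1 st) *ᶻ ⟦ eqMono v (x , y) ⟧) true-sg (masked st false))
      (trans (cong ((sg b *ᶻ lastRun 1 st) *ᶻ_) (⟦∧⟧ (eqVecℕ (zeros (suc k)) x) _))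
        (lemma₃ (sg b) (lastRun 1 st) ⟦ eqVecℕ (runs (true ∷ st)) y ⟧ (isZero x)))))
    (trans (∑-*ʳ (bits k) (sg b *ᶻ isZero x)) (trans (cong (_*ᶻ (sg b *ᶻ isZero x)) (∑-lastRun y))
      (lemma₄ (sg b) (runWeight 0 0 y) (isZero x))))

familyWeight-multiplicative : Multiplicative familyWeight
familyWeight-multiplicative = refl , λ k b γ x y x' y' → trans (∑-family k b γ)
  (trans (∑-cong bools {λ s → ∑ (bits k) (λ st → ∑ (family γ) (λ g → term k b γ x y x' y' (prependBlock k b s st g)))}
      {λ s → ∑ (bits k) (block k b x y s) *ᶻ familyWeight γ (x' , y')}
      (λ s → trans (∑-cong (bits k) (λ st → factor k b γ x y x' y' s st)) (∑-*ʳ (bits k) (familyWeight γ (x' , y')))))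
    (trans (∑-*ʳ bools (familyWeight γ (x' , y')) {λ s → ∑ (bits k) (block k b x y s)})
      (cong (_*ᶻ familyWeight γ (x' , y')) (∑-block b x y))))
  where
  term : ∀ k (b : Bool) γ (x y : Vec ℕ (suc k)) (x' y' : Vec ℕ (total γ)) → ℤ × Signing (suc k + total γ) → ℤ
  term k b γ x y x' y' f = proj₁ f *ᶻ ⟦ eqMono (runsMono (proj₂ f)) (x Vec.++ x' , y Vec.++ y') ⟧
  block : ∀ k (b : Bool) (x y : Vec ℕ (suc k)) → Bool → Vec Bool k → ℤ
  block k b x y s st = (sg (b ∧ not s) *ᶻ lastRun 1 st) *ᶻ ⟦ eqMono (runsMono (true ∷ st , Vec.replicate (suc k) s)) (x , y) ⟧
  factor : ∀ k b γ x y x' y' s st → ∑ (family γ) (λ g → term k b γ x y x' y' (prependBlock k b s st g)) ≡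
    block k b x y s st *ᶻ familyWeight γ (x' , y')
  factor k b γ x y x' y' s st = trans
    (∑-cong∈ (family γ) (λ {(c , (sts , es))} f∈ →
      trans (cong (λ v → ((sg (b ∧ not s) *ᶻ lastRun 1 st) *ᶻ c) *ᶻ ⟦ eqMono v (x Vec.++ x' , y Vec.++ y') ⟧)
        (runsMono-++ (true ∷ st) (Vec.replicate (suc k) s) sts es (leading-family γ f∈)))
      (trans (cong (((sg (b ∧ not s) *ᶻ lastRun 1 st) *ᶻ c) *ᶻ_)
        (eqMono-++ (mask (Vec.replicate (suc k) s) (runs (true ∷ st))) (mask (Vec.map not (Vec.replicate (suc k) s)) (runs (true ∷ st))) x y
          (mask es (runs sts)) (mask (Vec.map not es) (runs sts)) x' y'))
        (*-interchange (sg (b ∧ not s) *ᶻ lastRun 1 st) c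
          ⟦ eqMono (runsMono (true ∷ st , Vec.replicate (suc k) s)) (x , y) ⟧ ⟦ eqMono (runsMono (sts , es)) (x' , y') ⟧))))
    (∑-*ˡ (family γ) (block k b x y s st))

-- Descents and the weight of a tableau

sign : Cell → Bool
sign = proj₁

row col : Cell → ℕ
row c = proj₁ (proj₂ c)
col c = proj₂ (proj₂ c)

descent : Cell → Cell → Bool
descent c d = not (eqBool (sign c) (sign d)) ∨ (row c <ᵇ row d)

-- A start bit lifts the condition on the step into its position; all other steps must not be
-- descents. `p` is the cell before the list, so that segments can be joined.
compatible : Cell → ∀ {k} → Vec Bool k → Vec Bool k → List Cell → Bool
compatible p []       []       Q       = true
compatible p (s ∷ st) (e ∷ es) []      = false
compatible p (s ∷ st) (e ∷ es) (c ∷ Q) = eqBool e (sign c) ∧ (s ∨ not (descent p c)) ∧ compatible c st es Q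

descents : Cell → List Cell → List Bool
descents p []      = []
descents p (c ∷ Q) = descent p c ∷ descents c Q

-- Σ lastRun w st over the start vectors st ⊇ D.
runSum : ℕ → List Bool → ℤ
runSum w []      = ⁺ w
runSum w (d ∷ D) = - runSum 1 D +ᶻ ⟦ not d ⟧ *ᶻ runSum (suc w) D

allFalse : List Bool → Bool
allFalse = all not

-- The sign of an initial segment and 0 otherwise: after the first position without descent no
-- descent may follow.
hookWeight : List Bool → ℤ
hookWeight []          = 1ℤ
hookWeight (true ∷ D)  = - hookWeight D
hookWeight (false ∷ D) = ⟦ allFalse D ⟧

-- At an unforced position the two choices give -1 and w + 1.
runSum-allFalse : ∀ w D → T (allFalse D) → runSum w D ≡ ⁺ w
runSum-allFalse w [] h = refl
runSum-allFalse w (false ∷ D) h rewrite runSum-allFalse 1 D h | runSum-allFalse (suc w) D h = lemma (⁺ w)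
  where
  lemma : ∀ a → - 1ℤ +ᶻ 1ℤ *ᶻ (1ℤ +ᶻ a) ≡ a
  lemma = ℤ-Solver.solve-∀

-- A forced start closes the open part, so its size w cannot be that of the last part.
runSum-const : ∀ w w' D → ¬ T (allFalse D) → runSum w D ≡ runSum w' D
runSum-const w w' [] h = ⊥-elim (h tt)
runSum-const w w' (true ∷ D) h = refl
runSum-const w w' (false ∷ D) h = cong (λ z → - runSum 1 D +ᶻ 1ℤ *ᶻ z) (runSum-const (suc w) (suc w') D h)

-- An unforced position contributes the difference between open sizes 2 and 1. This is 1 if nothing
-- is forced later and 0 otherwise, because a later forced start makes the value independent of the
-- open size.
runSum≡hookWeight : ∀ D → runSum 1 D ≡ hookWeight D
runSum≡hookWeight [] = refl
runSum≡hookWeight (true ∷ D) = trans (ℤₚ.+-identityʳ _) (cong -_ (runSum≡hookWeight D))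
runSum≡hookWeight (false ∷ D) with allFalse D in eq
... | true rewrite runSum-allFalse 1 D (≡⇒T eq) | runSum-allFalse 2 D (≡⇒T eq) = refl
... | false rewrite runSum-const 2 1 D (λ t → subst T eq t) = lemma (runSum 1 D)
  where
  lemma : ∀ a → - a +ᶻ 1ℤ *ᶻ a ≡ 0ℤ
  lemma = ℤ-Solver.solve-∀

-- For a constant sign the condition on the signs factors out, and the remaining condition is that
-- the start bits include all descents.
∑-compatible : ∀ w s p k Q → length Q ≡ k → ∑ (bits k) (λ st → lastRun w st *ᶻ ⟦ compatible p st (Vec.replicate k s) Q ⟧) ≡
  ⟦ all (λ c → eqBool s (sign c)) Q ⟧ *ᶻ runSum w (descents p Q)
∑-compatible w s p zero [] refl = trans (ℤₚ.+-identityʳ _) (trans (ℤₚ.*-identityʳ (⁺ w)) (sym (ℤₚ.*-identityˡ (⁺ w))))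
∑-compatible w s p (suc k) (c ∷ Q) refl = trans (∑-allVecs-suc k)
  (trans (cong₂ _+ᶻ_ (start (eqBool s (sign c))) (continue (eqBool s (sign c)) (not (descent p c))))
  (trans (lemma ⟦ eqBool s (sign c) ⟧ ⟦ all (λ c → eqBool s (sign c)) Q ⟧ (runSum 1 (descents c Q)) ⟦ not (descent p c) ⟧
    (runSum (suc w) (descents c Q)))
    (cong (_*ᶻ runSum w (descent p c ∷ descents c Q)) (sym (⟦∧⟧ (eqBool s (sign c)) _)))))
  where
  lemma : ∀ a b c d e → - a *ᶻ (b *ᶻ c) +ᶻ (a *ᶻ d) *ᶻ (b *ᶻ e) ≡ (a *ᶻ b) *ᶻ (- c +ᶻ d *ᶻ e)
  lemma = ℤ-Solver.solve-∀
  rest : Vec Bool k → Bool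
  rest st = compatible c st (Vec.replicate k s) Q
  lemma₁ : ∀ l a r → - l *ᶻ (a *ᶻ r) ≡ - a *ᶻ (l *ᶻ r)
  lemma₁ = ℤ-Solver.solve-∀
  lemma₂ : ∀ l a b r → l *ᶻ (a *ᶻ (b *ᶻ r)) ≡ (a *ᶻ b) *ᶻ (l *ᶻ r)
  lemma₂ = ℤ-Solver.solve-∀
  start : ∀ a → ∑ (bits k) (λ st → - lastRun 1 st *ᶻ ⟦ a ∧ true ∧ rest st ⟧) ≡
    - ⟦ a ⟧ *ᶻ (⟦ all (λ c → eqBool s (sign c)) Q ⟧ *ᶻ runSum 1 (descents c Q))
  start a = trans (∑-cong (bits k) (λ st → trans (cong (- lastRun 1 st *ᶻ_) (⟦∧⟧ a (rest st))) (lemma₁ (lastRun 1 st) ⟦ a ⟧ ⟦ rest st ⟧)))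
    (trans (∑-*ˡ (bits k) (- ⟦ a ⟧)) (cong (- ⟦ a ⟧ *ᶻ_) (∑-compatible 1 s c k Q refl)))
  continue : ∀ a d → ∑ (bits k) (λ st → lastRun (suc w) st *ᶻ ⟦ a ∧ d ∧ rest st ⟧) ≡
    (⟦ a ⟧ *ᶻ ⟦ d ⟧) *ᶻ (⟦ all (λ c → eqBool s (sign c)) Q ⟧ *ᶻ runSum (suc w) (descents c Q))
  continue a d = trans (∑-cong (bits k) (λ st → trans (cong (lastRun (suc w) st *ᶻ_) (trans (⟦∧⟧ a _) (cong (⟦ a ⟧ *ᶻ_) (⟦∧⟧ d (rest st)))))
      (lemma₂ (lastRun (suc w) st) ⟦ a ⟧ ⟦ d ⟧ ⟦ rest st ⟧)))
    (trans (∑-*ˡ (bits k) (⟦ a ⟧ *ᶻ ⟦ d ⟧)) (cong ((⟦ a ⟧ *ᶻ ⟦ d ⟧) *ᶻ_) (∑-compatible (suc w) s c k Q refl)))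

final : Cell → List Cell → Cell
final p []      = p
final p (c ∷ Q) = final c Q

compatible-++ : ∀ p {k m} (st e : Vec Bool k) (sts es : Vec Bool m) Q Q' → length Q ≡ k →
  compatible p (st Vec.++ sts) (e Vec.++ es) (Q ++ Q') ≡ compatible p st e Q ∧ compatible (final p Q) sts es Q'
compatible-++ p [] [] sts es [] Q' _ = refl
compatible-++ p (s ∷ st) (b ∷ e) sts es (c ∷ Q) Q' h with eqBool b (sign c) | s ∨ not (descent p c)
... | true  | true  = compatible-++ c st e sts es Q Q' (ℕₚ.suc-injective h)
... | true  | false = refl
... | false | _     = refl

blockFactor : Bool → Cell → List Cell → ℤ
blockFactor b c Q = (sg (b ∧ not (sign c)) *ᶻ ⟦ all (λ d → eqBool (sign c) (sign d)) Q ⟧) *ᶻ hookWeight (descents c Q)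

-- Of the two signs offered for the block only that of its first cell survives.
∑-blockFactor : ∀ b p c k Q → length Q ≡ k → ∑ bools (λ s → ∑ (bits k) (λ st →
  (sg (b ∧ not s) *ᶻ lastRun 1 st) *ᶻ ⟦ compatible p (true ∷ st) (Vec.replicate (suc k) s) (c ∷ Q) ⟧)) ≡ blockFactor b c Q
∑-blockFactor b p c k Q h = trans (cong₂ (λ y z → y +ᶻ (z +ᶻ 0ℤ)) (one true) (one false)) (choose (sign c) refl)
  where
  val : Bool → ℤ
  val s = (sg (b ∧ not s) *ᶻ ⟦ eqBool s (sign c) ⟧) *ᶻ (⟦ all (λ d → eqBool s (sign d)) Q ⟧ *ᶻ runSum 1 (descents c Q))
  one : ∀ s → ∑ (bits k) (λ st → (sg (b ∧ not s) *ᶻ lastRun 1 st) *ᶻ ⟦ compatible p (true ∷ st) (Vec.replicate (suc k) s) (c ∷ Q) ⟧) ≡ val s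
  one s = trans (∑-cong (bits k) (λ st → trans (cong ((sg (b ∧ not s) *ᶻ lastRun 1 st) *ᶻ_) (⟦∧⟧ (eqBool s (sign c)) _))
      (*-interchange (sg (b ∧ not s)) (lastRun 1 st) ⟦ eqBool s (sign c) ⟧ ⟦ compatible c st (Vec.replicate k s) Q ⟧)))
    (trans (∑-*ˡ (bits k) (sg (b ∧ not s) *ᶻ ⟦ eqBool s (sign c) ⟧))
      (cong ((sg (b ∧ not s) *ᶻ ⟦ eqBool s (sign c) ⟧) *ᶻ_) (∑-compatible 1 s c k Q h)))
  keep : ∀ x y z → (x *ᶻ 1ℤ) *ᶻ (y *ᶻ z) ≡ (x *ᶻ y) *ᶻ z
  keep = ℤ-Solver.solve-∀
  kill : ∀ x y → (x *ᶻ 0ℤ) *ᶻ y ≡ 0ℤ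
  kill = ℤ-Solver.solve-∀
  same : ∀ s → s ≡ sign c → val s ≡ blockFactor b c Q
  same s refl rewrite T⇒≡ (eqBool-refl s) | sym (runSum≡hookWeight (descents c Q)) =
    keep (sg (b ∧ not s)) ⟦ all (λ d → eqBool s (sign d)) Q ⟧ (runSum 1 (descents c Q))
  other : ∀ s → eqBool s (sign c) ≡ false → val s ≡ 0ℤ
  other s e rewrite e = kill (sg (b ∧ not s)) (⟦ all (λ d → eqBool s (sign d)) Q ⟧ *ᶻ runSum 1 (descents c Q))
  choose : ∀ s → s ≡ sign c → val true +ᶻ (val false +ᶻ 0ℤ) ≡ blockFactor b c Q
  choose true e = trans (cong₂ (λ y z → y +ᶻ (z +ᶻ 0ℤ)) (same true e) (other false (cong (eqBool false) (sym e)))) (ℤₚ.+-identityʳ _)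
  choose false e = trans (cong₂ (λ y z → y +ᶻ (z +ᶻ 0ℤ)) (other true (cong (eqBool true) (sym e))) (same false e))
    (trans (ℤₚ.+-identityˡ _) (ℤₚ.+-identityʳ _))

blockFactors : List Part → List Cell → ℤ
blockFactors []                Q       = 1ℤ
blockFactors ((zero , b) ∷ γ)  Q       = blockFactors γ Q
blockFactors ((suc k , b) ∷ γ) []      = 0ℤ
blockFactors ((suc k , b) ∷ γ) (c ∷ Q) = blockFactor b c (take k Q) *ᶻ blockFactors γ (drop k Q)

-- The start bit at the head of each block frees the step into it, so the sum factors over the
-- blocks.
∑-family-compatible : ∀ γ p Q → length Q ≡ total γ →
  ∑ (family γ) (λ f → proj₁ f *ᶻ ⟦ compatible p (proj₁ (proj₂ f)) (proj₂ (proj₂ f)) Q ⟧) ≡ blockFactors γ Q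
∑-family-compatible [] p [] _ = refl
∑-family-compatible ((zero , b) ∷ γ) p Q h = ∑-family-compatible γ p Q h
∑-family-compatible ((suc k , b) ∷ γ) p (c ∷ Q) h = trans (∑-family k b γ)
  (trans (∑-cong bools {λ s → ∑ (bits k) (λ st → ∑ (family γ) (λ g → term (prependBlock k b s st g)))}
      {λ s → ∑ (bits k) (block s) *ᶻ blockFactors γ (drop k Q)}
      (λ s → trans (∑-cong (bits k) (factor s)) (∑-*ʳ (bits k) (blockFactors γ (drop k Q)))))
    (trans (∑-*ʳ bools (blockFactors γ (drop k Q)) {λ s → ∑ (bits k) (block s)})
      (cong (_*ᶻ blockFactors γ (drop k Q)) (∑-blockFactor b p c k (take k Q) take-length))))
  where
  take-length : length (take k Q) ≡ k
  take-length = length-take-+ k (ℕₚ.suc-injective h)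
  term : ℤ × Signing (suc k + total γ) → ℤ
  term f = proj₁ f *ᶻ ⟦ compatible p (proj₁ (proj₂ f)) (proj₂ (proj₂ f)) (c ∷ Q) ⟧
  block : Bool → Vec Bool k → ℤ
  block s st = (sg (b ∧ not s) *ᶻ lastRun 1 st) *ᶻ ⟦ compatible p (true ∷ st) (Vec.replicate (suc k) s) (c ∷ take k Q) ⟧
  factor : ∀ s st → ∑ (family γ) (λ g → term (prependBlock k b s st g)) ≡ block s st *ᶻ blockFactors γ (drop k Q)
  factor s st = trans
    (∑-cong (family γ) (λ (a , (sts , es)) → trans
      (cong (λ z → ((sg (b ∧ not s) *ᶻ lastRun 1 st) *ᶻ a) *ᶻ ⟦ z ⟧)
        (trans (cong (λ z → compatible p ((true ∷ st) Vec.++ sts) (Vec.replicate (suc k) s Vec.++ es) (c ∷ z))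
          (sym (Listₚ.take++drop≡id k Q)))
          (compatible-++ p (true ∷ st) (Vec.replicate (suc k) s) sts es (c ∷ take k Q) (drop k Q) (cong suc take-length))))
      (trans (cong (((sg (b ∧ not s) *ᶻ lastRun 1 st) *ᶻ a) *ᶻ_)
        (⟦∧⟧ (compatible p (true ∷ st) (Vec.replicate (suc k) s) (c ∷ take k Q)) _))
        (*-interchange (sg (b ∧ not s) *ᶻ lastRun 1 st) a ⟦ compatible p (true ∷ st) (Vec.replicate (suc k) s) (c ∷ take k Q) ⟧
          ⟦ compatible (final c (take k Q)) sts es (drop k Q) ⟧))))
    (trans (∑-*ˡ (family γ) (block s st)) (cong (block s st *ᶻ_)
      (∑-family-compatible γ (final c (take k Q)) (drop k Q) (length-drop-+ k (ℕₚ.suc-injective h)))))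

-- The weight of a signed set as a product over blocks

blocksFrom : ℕ → List Part → List (ℕ × ℕ × Bool)
blocksFrom a []            = []
blocksFrom a ((c , b) ∷ γ) = (a , a + c , b) ∷ blocksFrom (a + c) γ

-- blocks and epsTilde are defined by local functions that cannot be named here: the underscores stand for
-- them and are solved by unification.
mutual
  blocks≡ : ∀ γ → blocks γ ≡ blocksFrom 0 γ
  blocks≡ [] = refl
  blocks≡ ((c , b) ∷ γ) = cong ((0 , c , b) ∷_) (blocks-tail c b γ)

  blocks-tail : ∀ c b γ → _ ≡ blocksFrom c γ
  blocks-tail c b γ with (c , b) ∷ γ
  ... | γ₀ = blocks-go γ₀ c γ

  blocks-go : ∀ γ₀ a γ → _ ≡ blocksFrom a γ
  blocks-go γ₀ a []            = refl
  blocks-go γ₀ a ((c , b) ∷ γ) = cong ((a , a + c , b) ∷_) (blocks-go γ₀ (a + c) γ)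

nextSign : (ℕ → Bool) → (ℕ → Bool) → ℕ → ℕ → Bool
nextSign S ε zero    s = ε s
nextSign S ε (suc k) s = if S s then ε s else nextSign S ε k (suc s)

mutual
  epsTilde≡ : ∀ n S ε j → epsTilde n (S , ε) j ≡ nextSign S ε (n ∸ j) j
  epsTilde≡ n S ε j with n ∸ j
  ... | zero  = refl
  ... | suc k with S j
  ...   | true  = refl
  ...   | false = epsTilde-tail n S ε j k

  epsTilde-tail : ∀ n S ε j k → _ ≡ nextSign S ε k (suc j)
  epsTilde-tail n S ε j k with suc j
  ... | s = epsTilde-go n S ε j k s

  epsTilde-go : ∀ n S ε j k s → _ ≡ nextSign S ε k s
  epsTilde-go n S ε j zero    s = refl
  epsTilde-go n S ε j (suc k) s with S s
  ... | true  = refl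
  ... | false = epsTilde-go n S ε j k (suc s)

rangeFrom : ℕ → ℕ → List ℕ
rangeFrom a zero    = []
rangeFrom a (suc m) = suc a ∷ rangeFrom (suc a) m

interval≡ : ∀ a b → interval (suc a) b ≡ rangeFrom a (b ∸ a)
interval≡ a b = trans (Listₚ.map-applyUpTo id (suc a +_) (b ∸ a)) (lemma a (b ∸ a) (suc a +_) (λ _ → refl))
  where
  lemma : ∀ a m f → (∀ t → f t ≡ suc (a + t)) → applyUpTo f m ≡ rangeFrom a m
  lemma a zero    f h = refl
  lemma a (suc m) f h = cong₂ _∷_ (trans (h 0) (cong suc (ℕₚ.+-identityʳ a)))
    (lemma (suc a) m (f ∘ suc) (λ t → trans (h (suc t)) (cong suc (ℕₚ.+-suc a t))))

rangeFrom-+ : ∀ a k m → rangeFrom a (k + m) ≡ rangeFrom a k ++ rangeFrom (a + k) m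
rangeFrom-+ a zero m = cong (λ z → rangeFrom z m) (sym (ℕₚ.+-identityʳ a))
rangeFrom-+ a (suc k) m = cong (suc a ∷_) (trans (rangeFrom-+ (suc a) k m)
  (cong (λ z → rangeFrom (suc a) k ++ rangeFrom z m) (sym (ℕₚ.+-suc a k))))

∈-rangeFrom : ∀ a m {s} → s ∈ rangeFrom a m → a < s × s ≤ a + m
∈-rangeFrom a (suc m) (here refl) = ℕₚ.≤-refl , ℕₚ.≤-trans (s≤s (ℕₚ.m≤m+n a m)) (ℕₚ.≤-reflexive (sym (ℕₚ.+-suc a m)))
∈-rangeFrom a (suc m) (there s∈) with ∈-rangeFrom (suc a) m s∈
... | p , q = ℕₚ.<-trans (ℕₚ.n<1+n a) p , ℕₚ.≤-trans q (ℕₚ.≤-reflexive (sym (ℕₚ.+-suc a m)))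

module _ {A : Set} where

  count-++ : ∀ (p : A → Bool) xs ys → count p (xs ++ ys) ≡ count p xs + count p ys
  count-++ p xs ys = trans (cong length (Listₚ.filter-++ (T? ∘ p) xs ys)) (Listₚ.length-++ (filterᵇ p xs))

  count-cong∈ : ∀ {p q : A → Bool} xs → (∀ {x} → x ∈ xs → p x ≡ q x) → count p xs ≡ count q xs
  count-cong∈ [] h = refl
  count-cong∈ {p} {q} (x ∷ xs) h with p x | q x | h (here refl)
  ... | true | .true | refl = cong suc (count-cong∈ xs (h ∘ there))
  ... | false | .false | refl = count-cong∈ xs (h ∘ there)

  count-map : ∀ {B : Set} (f : B → A) (p : A → Bool) xs → count p (map f xs) ≡ count (p ∘ f) xs
  count-map f p [] = refl
  count-map f p (x ∷ xs) with p (f x)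
  ... | true = cong suc (count-map f p xs)
  ... | false = count-map f p xs

  all-map : ∀ {B : Set} (f : B → A) (p : A → Bool) xs → all p (map f xs) ≡ all (p ∘ f) xs
  all-map f p [] = refl
  all-map f p (x ∷ xs) = cong (p (f x) ∧_) (all-map f p xs)

isEnd : ℕ → List Part → ℕ → Bool
isEnd a γ s = any (λ (_ , r , _) → eqℕ s r) (blocksFrom a γ)

≢⇒eqℕ : ∀ {m n} → m ≢ n → eqℕ m n ≡ false
≢⇒eqℕ {m} {n} h = ¬T⇒≡ (h ∘ ℕₚ.≡ᵇ⇒≡ m n)

eqℕ-refl : ∀ n → eqℕ n n ≡ true
eqℕ-refl n = T⇒≡ (ℕₚ.≡⇒≡ᵇ n n refl)

isEnd-≤ : ∀ a γ s → All Positive γ → s ≤ a → isEnd a γ s ≡ false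
isEnd-≤ a [] s _ _ = refl
isEnd-≤ a ((k , b) ∷ γ) s (k>0 ∷ pos) s≤a
  rewrite ≢⇒eqℕ (ℕₚ.<⇒≢ (ℕₚ.≤-<-trans s≤a (ℕₚ.m<m+n a k>0))) =
  isEnd-≤ (a + k) γ s pos (ℕₚ.≤-trans s≤a (ℕₚ.m≤m+n a k))

module _ (S et : ℕ → Bool) where

  blockOK : ℕ × ℕ × Bool → Bool
  blockOK (a , r , b) =
    all (λ s → not (not (S s) ∧ S (suc s))) (interval (suc a) (r ∸ 2)) ∧
    all (λ j → eqBool (et j) (et (suc j))) (interval (suc a) (r ∸ 1))

  negBarred : ℕ × ℕ × Bool → Bool
  negBarred (a , r , b) = b ∧ not (et r)

  -- The weight of the part of γ that lies after position a, generalized from a = 0 for the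
  -- recursion along γ.
  weightFrom : ℕ → List Part → ℤ
  weightFrom a γ = if all blockOK (blocksFrom a γ)
    then (- 1ℤ) ^ᶻ (count (λ s → S s ∧ not (isEnd a γ s)) (rangeFrom a (total γ)) + count negBarred (blocksFrom a γ))
    else 0ℤ

  localWeight : ℕ → ℕ → Bool → ℤ
  localWeight a k b = (⟦ blockOK (a , a + suc k , b) ⟧ *ᶻ (- 1ℤ) ^ᶻ count S (rangeFrom a k)) *ᶻ sg (b ∧ not (et (a + suc k)))

  -- The exponent of -1 is additive: the first k positions of the block are ends of no block, its
  -- last position is an end and never counted, and later positions can only be ends of later
  -- blocks.
  weightFrom-∷ : ∀ a k b γ → All Positive γ →
    weightFrom a ((suc k , b) ∷ γ) ≡ localWeight a k b *ᶻ weightFrom (a + suc k) γ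
  weightFrom-∷ a k b γ pos with blockOK (a , a + suc k , b)
  ... | false = refl
  ... | true with all blockOK (blocksFrom (a + suc k) γ)
  ...   | false = sym (ℤₚ.*-zeroʳ ((1ℤ *ᶻ (- 1ℤ) ^ᶻ count S (rangeFrom a k)) *ᶻ sg (b ∧ not (et (a + suc k)))))
  ...   | true = begin
    (- 1ℤ) ^ᶻ (count interior (rangeFrom a (suc k + total γ)) + count negBarred ((a , a + suc k , b) ∷ blocksFrom (a + suc k) γ))
      ≡⟨ cong₂ (λ y z → (- 1ℤ) ^ᶻ (y + z)) positions (count-++ negBarred ((a , a + suc k , b) ∷ []) (blocksFrom (a + suc k) γ)) ⟩
    (- 1ℤ) ^ᶻ ((x + y) + (z + w))
      ≡⟨ pow ⟩
    ((1ℤ *ᶻ (- 1ℤ) ^ᶻ x) *ᶻ (- 1ℤ) ^ᶻ z) *ᶻ (- 1ℤ) ^ᶻ (y + w)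
      ≡⟨ cong (λ v → ((1ℤ *ᶻ (- 1ℤ) ^ᶻ x) *ᶻ v) *ᶻ (- 1ℤ) ^ᶻ (y + w)) barred ⟩
    ((1ℤ *ᶻ (- 1ℤ) ^ᶻ x) *ᶻ sg (b ∧ not (et (a + suc k)))) *ᶻ (- 1ℤ) ^ᶻ (y + w) ∎
    where
    open ≡-Reasoning
    interior interior' : ℕ → Bool
    interior s = S s ∧ not (isEnd a ((suc k , b) ∷ γ) s)
    interior' s = S s ∧ not (isEnd (a + suc k) γ s)
    x y z w : ℕ
    x = count S (rangeFrom a k)
    y = count interior' (rangeFrom (a + suc k) (total γ))
    z = count negBarred ((a , a + suc k , b) ∷ [])
    w = count negBarred (blocksFrom (a + suc k) γ)
    before : ∀ {s} → s ∈ rangeFrom a k → interior s ≡ S s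
    before {s} s∈ rewrite ≢⇒eqℕ (ℕₚ.<⇒≢ (ℕₚ.≤-<-trans (proj₂ (∈-rangeFrom a k s∈)) (ℕₚ.+-monoʳ-< a (ℕₚ.n<1+n k))))
      | isEnd-≤ (a + suc k) γ s pos (ℕₚ.≤-trans (proj₂ (∈-rangeFrom a k s∈)) (ℕₚ.+-monoʳ-≤ a (ℕₚ.n≤1+n k))) = Boolₚ.∧-identityʳ (S s)
    end : interior (a + suc k) ≡ false
    end rewrite eqℕ-refl (a + suc k) = Boolₚ.∧-zeroʳ (S (a + suc k))
    after : ∀ {s} → s ∈ rangeFrom (a + suc k) (total γ) → interior s ≡ interior' s
    after s∈ rewrite ≢⇒eqℕ (ℕₚ.<⇒≢ (proj₁ (∈-rangeFrom (a + suc k) (total γ) s∈)) ∘ sym) = refl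
    last-one : count interior (suc (a + k) ∷ []) ≡ 0
    last-one rewrite sym (ℕₚ.+-suc a k) | end = refl
    positions : count interior (rangeFrom a (suc k + total γ)) ≡ x + y
    positions = begin
      count interior (rangeFrom a (suc k + total γ))
        ≡⟨ cong (count interior) (rangeFrom-+ a (suc k) (total γ)) ⟩
      count interior (rangeFrom a (suc k) ++ rangeFrom (a + suc k) (total γ))
        ≡⟨ count-++ interior (rangeFrom a (suc k)) _ ⟩
      count interior (rangeFrom a (suc k)) + count interior (rangeFrom (a + suc k) (total γ))
        ≡⟨ cong₂ _+_ (cong (count interior) (trans (cong (rangeFrom a) (ℕₚ.+-comm 1 k)) (rangeFrom-+ a k 1)))
          (count-cong∈ (rangeFrom (a + suc k) (total γ)) after) ⟩
      count interior (rangeFrom a k ++ suc (a + k) ∷ []) + y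
        ≡⟨ cong (_+ y) (trans (count-++ interior (rangeFrom a k) _)
          (trans (cong₂ _+_ (count-cong∈ (rangeFrom a k) before) last-one) (ℕₚ.+-identityʳ x))) ⟩
      x + y ∎
    pow : (- 1ℤ) ^ᶻ ((x + y) + (z + w)) ≡ ((1ℤ *ᶻ (- 1ℤ) ^ᶻ x) *ᶻ (- 1ℤ) ^ᶻ z) *ᶻ (- 1ℤ) ^ᶻ (y + w)
    pow rewrite ℤₚ.^-distribˡ-+-* (- 1ℤ) (x + y) (z + w) | ℤₚ.^-distribˡ-+-* (- 1ℤ) x y | ℤₚ.^-distribˡ-+-* (- 1ℤ) z w
      | ℤₚ.^-distribˡ-+-* (- 1ℤ) y w = lemma ((- 1ℤ) ^ᶻ x) ((- 1ℤ) ^ᶻ y) ((- 1ℤ) ^ᶻ z) ((- 1ℤ) ^ᶻ w)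
      where
      lemma : ∀ x y z w → (x *ᶻ y) *ᶻ (z *ᶻ w) ≡ ((1ℤ *ᶻ x) *ᶻ z) *ᶻ (y *ᶻ w)
      lemma = ℤ-Solver.solve-∀
    barred : (- 1ℤ) ^ᶻ z ≡ sg (b ∧ not (et (a + suc k)))
    barred with b ∧ not (et (a + suc k))
    ... | true  = refl
    ... | false = refl

wt≡weightFrom : ∀ n γ S ε → total γ ≡ n → wt n γ (S , ε) ≡ weightFrom S (epsTilde n (S , ε)) 0 γ
wt≡weightFrom n γ S ε refl rewrite blocks≡ γ | interval≡ 0 (total γ) = refl

noAscent : List Bool → Bool
noAscent []          = true
noAscent (x ∷ [])    = true
noAscent (x ∷ y ∷ D) = not (not x ∧ y) ∧ noAscent (y ∷ D)

constant : List Bool → Bool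
constant []          = true
constant (x ∷ [])    = true
constant (x ∷ y ∷ E) = eqBool x y ∧ constant (y ∷ E)

noAscent-range : ∀ S a k → all (λ s → not (not (S s) ∧ S (suc s))) (rangeFrom a (k ∸ 1)) ≡ noAscent (map S (rangeFrom a k))
noAscent-range S a zero = refl
noAscent-range S a (suc zero) = refl
noAscent-range S a (suc (suc k)) = cong (not (not (S (suc a)) ∧ S (suc (suc a))) ∧_) (noAscent-range S (suc a) (suc k))

constant-range : ∀ et a k → all (λ j → eqBool (et j) (et (suc j))) (rangeFrom a k) ≡ constant (map et (rangeFrom a (suc k)))
constant-range et a zero = refl
constant-range et a (suc k) = cong (eqBool (et (suc a)) (et (suc (suc a))) ∧_) (constant-range et (suc a) k)

-- The truth values form an initial segment exactly if false is never followed directly by true,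
-- which is how `wt` tests it.
hookWeight≡ : ∀ D → hookWeight D ≡ ⟦ noAscent D ⟧ *ᶻ (- 1ℤ) ^ᶻ count id D
hookWeight≡ [] = refl
hookWeight≡ (true ∷ []) = refl
hookWeight≡ (true ∷ d ∷ D) = trans (cong -_ (hookWeight≡ (d ∷ D))) (lemma ⟦ noAscent (d ∷ D) ⟧ ((- 1ℤ) ^ᶻ count id (d ∷ D)))
  where
  lemma : ∀ a b → - (a *ᶻ b) ≡ a *ᶻ (- 1ℤ *ᶻ b)
  lemma = ℤ-Solver.solve-∀
hookWeight≡ (false ∷ D) = lemma D
  where
  lemma : ∀ D → ⟦ allFalse D ⟧ ≡ ⟦ noAscent (false ∷ D) ⟧ *ᶻ (- 1ℤ) ^ᶻ count id D
  lemma [] = refl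
  lemma (true ∷ D) = refl
  lemma (false ∷ D) = lemma D

constant≡ : ∀ x E → constant (x ∷ E) ≡ all (eqBool x) E
constant≡ x [] = refl
constant≡ true (true ∷ E) = constant≡ true E
constant≡ true (false ∷ E) = refl
constant≡ false (true ∷ E) = refl
constant≡ false (false ∷ E) = constant≡ false E

module _ (n : ℕ) (Q : List Cell) where

  S₀ : ℕ → Bool
  S₀ = proj₁ (sDes n Q)

  et₀ : ℕ → Bool
  et₀ = epsTilde n (sDes n Q)

  S₀-descent : ∀ s → s < n → S₀ s ≡ descent (cellOf Q s) (cellOf Q (suc s))
  S₀-descent s s<n rewrite ≢⇒eqℕ (ℕₚ.<⇒≢ s<n) | T⇒≡ (ℕₚ.<⇒<ᵇ s<n) = refl

  -- No sign changes between j and the next element of S, because a change of sign between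
  -- consecutive entries is itself a descent.
  et₀-sign : ∀ j → j ≤ n → et₀ j ≡ sign (cellOf Q j)
  et₀-sign j j≤n = trans (epsTilde≡ n S₀ (λ s → sign (cellOf Q s)) j) (lemma (n ∸ j) j (ℕₚ.m+[n∸m]≡n j≤n))
    where
    lemma : ∀ k j → j + k ≡ n → nextSign S₀ (λ s → sign (cellOf Q s)) k j ≡ sign (cellOf Q j)
    lemma zero    j h = refl
    lemma (suc k) j h with S₀ j in eq
    ... | true  = refl
    ... | false = trans (lemma k (suc j) (trans (sym (ℕₚ.+-suc j k)) h)) (sym (same (sign (cellOf Q j)) (sign (cellOf Q (suc j))) _
            (trans (sym (S₀-descent j (ℕₚ.≤-trans (ℕₚ.m<m+n j z<s) (ℕₚ.≤-reflexive h)))) eq)))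
      where
      same : ∀ a b c → not (eqBool a b) ∨ c ≡ false → a ≡ b
      same true  true  c _ = refl
      same false false c _ = refl

  -- R is the rest of Q after the first a entries. It is expressed through `cellOf`, with the same
  -- default beyond the end, since `sDes` sees Q only in this way.
  Reads : ℕ → List Cell → Set
  Reads a R = ∀ t → cellOf Q (suc (a + t)) ≡ at (true , (0 , 0)) R t

  Reads-∷ : ∀ {a c R} → Reads a (c ∷ R) → Reads (suc a) R
  Reads-∷ {a} h t = trans (cong (cellOf Q ∘ suc) (sym (ℕₚ.+-suc a t))) (h (suc t))

  Reads-head : ∀ {a c R} → Reads a (c ∷ R) → cellOf Q (suc a) ≡ c
  Reads-head {a} h = trans (cong (cellOf Q ∘ suc) (sym (ℕₚ.+-identityʳ a))) (h 0)

  Reads-drop : ∀ k {a R} → Reads a R → k ≤ length R → Reads (a + k) (drop k R)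
  Reads-drop zero {a} {R} h _ = subst (λ z → Reads z R) (sym (ℕₚ.+-identityʳ a)) h
  Reads-drop (suc k) {a} {c ∷ R} h (s≤s p) = subst (λ z → Reads z (drop k R)) (sym (ℕₚ.+-suc a k)) (Reads-drop k (Reads-∷ h) p)

  S₀-range : ∀ k a c R → Reads a (c ∷ R) → k ≤ length R → a + suc k ≤ n → map S₀ (rangeFrom a k) ≡ descents c (take k R)
  S₀-range zero a c R h _ _ = refl
  S₀-range (suc k) a c (d ∷ R) h (s≤s p) q = cong₂ _∷_
    (trans (S₀-descent (suc a) (ℕₚ.≤-trans (ℕₚ.≤-trans (s≤s (s≤s (ℕₚ.m≤m+n a k)))
      (ℕₚ.≤-reflexive (trans (cong suc (sym (ℕₚ.+-suc a k))) (sym (ℕₚ.+-suc a (suc k)))))) q))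
      (cong₂ descent (Reads-head h) (Reads-head (Reads-∷ {c = c} h))))
    (S₀-range k (suc a) d R (Reads-∷ {c = c} h) p (ℕₚ.≤-trans (ℕₚ.≤-reflexive (sym (ℕₚ.+-suc a (suc k)))) q))

  et₀-range : ∀ k a R → Reads a R → k ≤ length R → a + k ≤ n → map et₀ (rangeFrom a k) ≡ map sign (take k R)
  et₀-range zero a R h _ _ = refl
  et₀-range (suc k) a (c ∷ R) h (s≤s p) q = cong₂ _∷_
    (trans (et₀-sign (suc a) (ℕₚ.≤-trans (ℕₚ.≤-trans (s≤s (ℕₚ.m≤m+n a k)) (ℕₚ.≤-reflexive (sym (ℕₚ.+-suc a k)))) q))
      (cong sign (Reads-head h)))
    (et₀-range k (suc a) R (Reads-∷ h) p (ℕₚ.≤-trans (ℕₚ.≤-reflexive (sym (ℕₚ.+-suc a k))) q))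

  et₀-end : ∀ k a x E → map et₀ (rangeFrom a (suc k)) ≡ x ∷ E → T (all (eqBool x) E) → et₀ (a + suc k) ≡ x
  et₀-end zero a x E h _ = trans (cong et₀ (trans (ℕₚ.+-suc a 0) (cong suc (ℕₚ.+-identityʳ a)))) (Listₚ.∷-injectiveˡ h)
  et₀-end (suc k) a x (y ∷ E) h t with ∧⁻ {eqBool x y} t
  ... | p , q with refl ← eqBool⇒≡ {x} {y} p = trans (cong et₀ (ℕₚ.+-suc a (suc k))) (et₀-end k (suc a) x E (Listₚ.∷-injectiveʳ h) q)

  localWeight≡ : ∀ a k b c R → Reads a (c ∷ R) → k ≤ length R → a + suc k ≤ n →
    localWeight S₀ et₀ a k b ≡ blockFactor b c (take k R)
  localWeight≡ a k b c R h p q = begin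
    (⟦ blockOK S₀ et₀ (a , a + suc k , b) ⟧ *ᶻ (- 1ℤ) ^ᶻ count S₀ (rangeFrom a k)) *ᶻ sg (b ∧ not (et₀ (a + suc k)))
      ≡⟨ cong₂ (λ y z → (⟦ y ⟧ *ᶻ (- 1ℤ) ^ᶻ z) *ᶻ sg (b ∧ not (et₀ (a + suc k)))) ok
        (trans (sym (count-map S₀ id (rangeFrom a k))) (cong (count id) D≡)) ⟩
    (⟦ noAscent D ∧ same ⟧ *ᶻ (- 1ℤ) ^ᶻ count id D) *ᶻ sg (b ∧ not (et₀ (a + suc k)))
      ≡⟨ cong (λ z → (z *ᶻ (- 1ℤ) ^ᶻ count id D) *ᶻ sg (b ∧ not (et₀ (a + suc k)))) (⟦∧⟧ (noAscent D) same) ⟩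
    ((⟦ noAscent D ⟧ *ᶻ ⟦ same ⟧) *ᶻ (- 1ℤ) ^ᶻ count id D) *ᶻ sg (b ∧ not (et₀ (a + suc k)))
      ≡⟨ rearrange ⟦ noAscent D ⟧ ⟦ same ⟧ ((- 1ℤ) ^ᶻ count id D) (sg (b ∧ not (et₀ (a + suc k)))) ⟩
    (sg (b ∧ not (et₀ (a + suc k))) *ᶻ ⟦ same ⟧) *ᶻ (⟦ noAscent D ⟧ *ᶻ (- 1ℤ) ^ᶻ count id D)
      ≡⟨ cong₂ _*ᶻ_ (end same refl) (sym (hookWeight≡ D)) ⟩
    blockFactor b c (take k R) ∎
    where
    open ≡-Reasoning
    D : List Bool
    D = descents c (take k R)
    same : Bool
    same = all (λ d → eqBool (sign c) (sign d)) (take k R)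
    D≡ : map S₀ (rangeFrom a k) ≡ D
    D≡ = S₀-range k a c R h p q
    E≡ : map et₀ (rangeFrom a (suc k)) ≡ sign c ∷ map sign (take k R)
    E≡ = et₀-range (suc k) a (c ∷ R) h (s≤s p) q
    range₁ : interval (suc a) (a + suc k ∸ 2) ≡ rangeFrom a (k ∸ 1)
    range₁ = trans (interval≡ a (a + suc k ∸ 2)) (cong (rangeFrom a) (trans (cong (λ z → z ∸ 2 ∸ a) (ℕₚ.+-suc a k))
      (trans (ℕₚ.∸-+-assoc (a + k) 1 a) (trans (cong (a + k ∸_) (ℕₚ.+-comm 1 a)) (ℕₚ.[m+n]∸[m+o]≡n∸o a k 1)))))
    range₂ : interval (suc a) (a + suc k ∸ 1) ≡ rangeFrom a k
    range₂ = trans (interval≡ a (a + suc k ∸ 1)) (cong (rangeFrom a) (trans (cong (λ z → z ∸ 1 ∸ a) (ℕₚ.+-suc a k)) (ℕₚ.m+n∸m≡n a k)))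
    ok : blockOK S₀ et₀ (a , a + suc k , b) ≡ noAscent D ∧ same
    ok = cong₂ _∧_
      (trans (cong (all _) range₁) (trans (noAscent-range S₀ a k) (cong noAscent D≡)))
      (trans (cong (all _) range₂) (trans (constant-range et₀ a k)
        (trans (cong constant E≡) (trans (constant≡ (sign c) (map sign (take k R)))
        (all-map sign (eqBool (sign c)) (take k R))))))
    rearrange : ∀ n s p g → ((n *ᶻ s) *ᶻ p) *ᶻ g ≡ (g *ᶻ s) *ᶻ (n *ᶻ p)
    rearrange = ℤ-Solver.solve-∀
    -- `wt` takes the sign at the end of the block, `blockFactor` that of the first cell. They agree
    -- if the signs are constant on the block; otherwise the other factor is 0.
    end : ∀ t → t ≡ same → sg (b ∧ not (et₀ (a + suc k))) *ᶻ ⟦ t ⟧ ≡ sg (b ∧ not (sign c)) *ᶻ ⟦ t ⟧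
    end true t≡ = cong (λ z → sg (b ∧ not z) *ᶻ 1ℤ) (et₀-end k a (sign c) (map sign (take k R)) E≡
      (≡⇒T (trans (all-map sign (eqBool (sign c)) (take k R)) (sym t≡))))
    end false t≡ = trans (ℤₚ.*-zeroʳ (sg (b ∧ not (et₀ (a + suc k))))) (sym (ℤₚ.*-zeroʳ (sg (b ∧ not (sign c)))))

  weightFrom≡blockFactors : ∀ γ a R → All Positive γ → Reads a R → length R ≡ total γ → a + total γ ≡ n →
    weightFrom S₀ et₀ a γ ≡ blockFactors γ R
  weightFrom≡blockFactors [] a R _ _ _ _ = refl
  weightFrom≡blockFactors ((suc k , b) ∷ γ) a (c ∷ R) (_ ∷ pos) h l e = trans (weightFrom-∷ S₀ et₀ a k b γ pos)
    (cong₂ _*ᶻ_ (localWeight≡ a k b c R h k≤ (ℕₚ.≤-trans (ℕₚ.m≤m+n (a + suc k) (total γ)) (ℕₚ.≤-reflexive a+≡)))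
      (weightFrom≡blockFactors γ (a + suc k) (drop k R) pos (Reads-drop (suc k) {a} {c ∷ R} h (s≤s k≤)) (length-drop-+ k l') a+≡))
    where
    a+≡ : a + suc k + total γ ≡ n
    a+≡ = trans (ℕₚ.+-assoc a (suc k) (total γ)) e
    l' : length R ≡ k + total γ
    l' = ℕₚ.suc-injective l
    k≤ : k ≤ length R
    k≤ = ℕₚ.≤-trans (ℕₚ.m≤m+n k (total γ)) (ℕₚ.≤-reflexive (sym l'))

wt≡blockFactors : ∀ γ Q → All Positive γ → length Q ≡ total γ → wt (total γ) γ (sDes (total γ) Q) ≡ blockFactors γ Q
wt≡blockFactors γ Q pos l = trans (wt≡weightFrom (total γ) γ (S₀ (total γ) Q) _ refl)
  (weightFrom≡blockFactors (total γ) Q γ 0 Q pos (λ _ → refl) l refl)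

-- Tableaux and standardization

indexFrom : {A : Set} → ℕ → List A → List (ℕ × A)
indexFrom a []       = []
indexFrom a (x ∷ xs) = (a , x) ∷ indexFrom (suc a) xs

indexed≡ : {A : Set} (xs : List A) → indexed xs ≡ indexFrom 0 xs
indexed≡ xs = lemma xs 0 id (λ _ → refl)
  where
  lemma : {A : Set} (xs : List A) → ∀ a f → (∀ t → f t ≡ a + t) → zip (applyUpTo f (length xs)) xs ≡ indexFrom a xs
  lemma []       a f h = refl
  lemma (x ∷ xs) a f h = cong₂ _∷_ (cong (_, x) (trans (h 0) (ℕₚ.+-identityʳ a)))
    (lemma xs (suc a) (f ∘ suc) (λ t → trans (h (suc t)) (ℕₚ.+-suc a t)))

module _ {A : Set} where

  indexFrom-≥ : ∀ a (xs : List A) → All (λ x → a ≤ proj₁ x) (indexFrom a xs)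
  indexFrom-≥ a []       = []
  indexFrom-≥ a (x ∷ xs) = ℕₚ.≤-refl ∷ All.map (ℕₚ.≤-trans (ℕₚ.n≤1+n a)) (indexFrom-≥ (suc a) xs)

  indexFrom-< : ∀ a (xs : List A) → AllPairs (λ x y → proj₁ x < proj₁ y) (indexFrom a xs)
  indexFrom-< a []       = []
  indexFrom-< a (x ∷ xs) = indexFrom-≥ (suc a) xs ∷ indexFrom-< (suc a) xs

  map-indexFrom : ∀ a (xs : List A) → map proj₂ (indexFrom a xs) ≡ xs
  map-indexFrom a []       = refl
  map-indexFrom a (x ∷ xs) = cong (x ∷_) (map-indexFrom (suc a) xs)

  ∈-indexFrom : ∀ a {xs : List A} {x} → x ∈ xs → ∃ λ j → (j , x) ∈ indexFrom a xs
  ∈-indexFrom a (here refl) = a , here refl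
  ∈-indexFrom a (there x∈) with ∈-indexFrom (suc a) x∈
  ... | j , m = j , there m

  AllPairs-∈ : ∀ {R : A → A → Set} {xs} → AllPairs R xs → AllPairs (λ x y → R x y × x ∈ xs × y ∈ xs) xs
  AllPairs-∈ [] = []
  AllPairs-∈ (r ∷ rs) = All.tabulate (λ y∈ → All.lookup r y∈ , here refl , there y∈) ∷
    AllPairs.map (λ (p , x∈ , y∈) → p , there x∈ , there y∈) (AllPairs-∈ rs)

  AllPairs-index : ∀ {R : A → A → Set} a {xs} → AllPairs R xs →
    AllPairs (λ x y → proj₁ x < proj₁ y × R (proj₂ x) (proj₂ y)) (indexFrom a xs)
  AllPairs-index {R} a {xs} p = AllPairs.zipWith id (indexFrom-< a xs ,
    AllPairsₚ.map⁻ (subst (AllPairs R) (sym (map-indexFrom a xs)) p))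

module _ {A B : Set} where

  map-proj₁-zip : ∀ (xs : List A) (ys : List B) → length xs ≡ length ys → map proj₁ (zip xs ys) ≡ xs
  map-proj₁-zip []       []       h = refl
  map-proj₁-zip (x ∷ xs) (y ∷ ys) h = cong (x ∷_) (map-proj₁-zip xs ys (ℕₚ.suc-injective h))

  map-proj₂-zip : ∀ (xs : List A) (ys : List B) → length xs ≡ length ys → map proj₂ (zip xs ys) ≡ ys
  map-proj₂-zip []       []       h = refl
  map-proj₂-zip (x ∷ xs) (y ∷ ys) h = cong (y ∷_) (map-proj₂-zip xs ys (ℕₚ.suc-injective h))

  zip-map-proj : ∀ (zs : List (A × B)) → zip (map proj₁ zs) (map proj₂ zs) ≡ zs
  zip-map-proj []       = refl
  zip-map-proj (z ∷ zs) = cong (z ∷_) (zip-map-proj zs)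

  AllPairs-zip : ∀ {R : A → A → Set} {xs} (ys : List B) → AllPairs R xs → AllPairs (λ x y → R (proj₁ x) (proj₁ y)) (zip xs ys)
  AllPairs-zip ys [] = []
  AllPairs-zip [] (r ∷ rs) = []
  AllPairs-zip (y ∷ ys) (r ∷ rs) = All-zip ys r ∷ AllPairs-zip ys rs
    where
    All-zip : ∀ {P : A → Set} {xs} (ys : List B) → All P xs → All (P ∘ proj₁) (zip xs ys)
    All-zip ys [] = []
    All-zip [] (p ∷ ps) = []
    All-zip (y ∷ ys) (p ∷ ps) = p ∷ All-zip ys ps

  zip-↭ : ∀ {xs ys : List A} → xs ↭ ys → ∀ (l : List B) → length xs ≡ length l →
    ∃ λ l' → length ys ≡ length l' × zip xs l ↭ zip ys l'
  zip-↭ Perm.refl l h = l , h , ↭-refl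
  zip-↭ (Perm.prep x p) (y ∷ l) h with zip-↭ p l (ℕₚ.suc-injective h)
  ... | l' , h' , q = y ∷ l' , cong suc h' , Perm.prep (x , y) q
  zip-↭ (Perm.swap x x' p) (y ∷ y' ∷ l) h with zip-↭ p l (ℕₚ.suc-injective (ℕₚ.suc-injective h))
  ... | l' , h' , q = y' ∷ y ∷ l' , cong (suc ∘ suc) h' , Perm.swap (x , y) (x' , y') q
  zip-↭ (Perm.trans p q) l h with zip-↭ p l h
  ... | l' , h' , r with zip-↭ q l' h'
  ... | l'' , h'' , s = l'' , h'' , ↭-trans r s

  -- A key stands at the same place in both lists and nowhere else, so an entry of `xs` can only be
  -- found in `ys` at its own place.
  Unique-keys-⊆⇒≡ : ∀ (xs ys : List (A × B)) → map proj₁ xs ≡ map proj₁ ys → Unique (map proj₁ xs) →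
    (∀ {x} → x ∈ xs → x ∈ ys) → xs ≡ ys
  Unique-keys-⊆⇒≡ [] [] e u s = refl
  Unique-keys-⊆⇒≡ (x ∷ xs) (y ∷ ys) e (x∉ ∷ u) s = cong₂ _∷_ heads (Unique-keys-⊆⇒≡ xs ys (Listₚ.∷-injectiveʳ e) u tails)
    where
    heads : x ≡ y
    heads with s (here refl)
    ... | here eq = eq
    ... | there x∈ = ⊥-elim (All.lookup x∉ (subst (proj₁ x ∈_) (sym (Listₚ.∷-injectiveʳ e)) (∈-map⁺ proj₁ x∈)) refl)
    tails : ∀ {z} → z ∈ xs → z ∈ ys
    tails z∈ with s (there z∈)
    ... | there m = m
    ... | here refl = ⊥-elim (All.lookup x∉ (∈-map⁺ proj₁ z∈) (Listₚ.∷-injectiveˡ e))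

sorted : {A : Set} {R : A → A → Set} → (∀ x y → R x y ⊎ R y x) → (∀ {x y z} → R x y → R y z → R x z) →
  ∀ xs → ∃ λ ys → ys ↭ xs × AllPairs R ys
sorted {A} {R} tot tr = go
  where
  insert : ∀ x ys → AllPairs R ys → ∃ λ zs → zs ↭ x ∷ ys × AllPairs R zs
  insert x [] [] = x ∷ [] , ↭-refl , [] ∷ []
  insert x (y ∷ ys) (r ∷ rs) with tot x y
  ... | inj₁ xy = x ∷ y ∷ ys , ↭-refl , (xy ∷ All.map (tr xy) r) ∷ r ∷ rs
  ... | inj₂ yx with insert x ys rs
  ... | zs , p , a = y ∷ zs , ↭-trans (Perm.prep y p) (Perm.swap y x ↭-refl) , Permₚ.All-resp-↭ (↭-sym p) (yx ∷ r) ∷ a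
  go : ∀ xs → ∃ λ ys → ys ↭ xs × AllPairs R ys
  go [] = [] , ↭-refl , []
  go (x ∷ xs) with go xs
  ... | ys , p , a with insert x ys a
  ... | zs , q , b = zs , ↭-trans q (Perm.prep x p) , b

Lex : {A : Set} → (A → ℕ) → (A → A → Set) → A → A → Set
Lex f R x y = f x < f y ⊎ (f x ≡ f y × R x y)

module _ {A : Set} (f : A → ℕ) {R : A → A → Set} where

  Lex-total : (∀ x y → R x y ⊎ R y x) → ∀ x y → Lex f R x y ⊎ Lex f R y x
  Lex-total tot x y with ℕₚ.<-cmp (f x) (f y)
  ... | tri< p _ _ = inj₁ (inj₁ p)
  ... | tri> _ _ p = inj₂ (inj₁ p)
  ... | tri≈ _ e _ with tot x y
  ...   | inj₁ r = inj₁ (inj₂ (e , r))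
  ...   | inj₂ r = inj₂ (inj₂ (sym e , r))

  Lex-trans : (∀ {x y z} → R x y → R y z → R x z) → ∀ {x y z} → Lex f R x y → Lex f R y z → Lex f R x z
  Lex-trans tr (inj₁ p) (inj₁ q) = inj₁ (ℕₚ.<-trans p q)
  Lex-trans tr (inj₁ p) (inj₂ (e , _)) = inj₁ (ℕₚ.<-≤-trans p (ℕₚ.≤-reflexive e))
  Lex-trans tr (inj₂ (e , _)) (inj₁ q) = inj₁ (ℕₚ.≤-<-trans (ℕₚ.≤-reflexive e) q)
  Lex-trans tr (inj₂ (e , r)) (inj₂ (e' , r')) = inj₂ (trans e e' , tr r r')

  Lex-≤ : ∀ {x y} → Lex f R x y → f x ≤ f y
  Lex-≤ (inj₁ p) = ℕₚ.<⇒≤ p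
  Lex-≤ (inj₂ (e , _)) = ℕₚ.≤-reflexive e

-- Cells of a bipartition and monotonicity of fillings

cellsFrom : ℕ → List ℕ → List (ℕ × ℕ)
cellsFrom a []      = []
cellsFrom a (r ∷ p) = map (λ j → (a , j)) (upTo r) ++ cellsFrom (suc a) p

cellsOfShape≡ : ∀ p → cellsOfShape p ≡ cellsFrom 0 p
cellsOfShape≡ p = trans (cong (concatMap (λ (i , r) → map (λ j → (i , j)) (upTo r))) (indexed≡ p)) (lemma 0 p)
  where
  lemma : ∀ a p → concatMap (λ (i , r) → map (λ j → (i , j)) (upTo r)) (indexFrom a p) ≡ cellsFrom a p
  lemma a []      = refl
  lemma a (r ∷ p) = cong (map (λ j → (a , j)) (upTo r) ++_) (lemma (suc a) p)

length-cellsOfShape : ∀ p → length (cellsOfShape p) ≡ size p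
length-cellsOfShape p = trans (cong length (cellsOfShape≡ p)) (lemma 0 p)
  where
  lemma : ∀ a p → length (cellsFrom a p) ≡ size p
  lemma a []      = refl
  lemma a (r ∷ p) = trans (Listₚ.length-++ (map (λ j → (a , j)) (upTo r)))
    (cong₂ _+_ (trans (Listₚ.length-map _ (upTo r)) (Listₚ.length-upTo r)) (lemma (suc a) p))

∈-cellsFrom⁻ : ∀ a p {i j} → (i , j) ∈ cellsFrom a p → a ≤ i × j < at 0 p (i ∸ a)
∈-cellsFrom⁻ a (r ∷ p) m with ∈-++⁻ (map (λ j → (a , j)) (upTo r)) m
... | inj₁ m' with ∈-map⁻ _ m'
...   | j , j∈ , refl = ℕₚ.≤-refl , subst (λ z → j < at 0 (r ∷ p) z) (sym (ℕₚ.n∸n≡0 a)) (∈-upTo⁻ j∈)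
∈-cellsFrom⁻ a (r ∷ p) {i} {j} m | inj₂ m' with ∈-cellsFrom⁻ (suc a) p m'
... | a<i , j< = ℕₚ.<⇒≤ a<i , subst (λ z → j < at 0 (r ∷ p) z) (sym (ℕₚ.+-∸-assoc 1 a<i)) j<

∈-cellsFrom⁺ : ∀ a p i j → j < at 0 p i → (a + i , j) ∈ cellsFrom a p
∈-cellsFrom⁺ a (r ∷ p) zero j h = ∈-++⁺ˡ (subst (λ z → (z , j) ∈ map (λ j → (a , j)) (upTo r)) (sym (ℕₚ.+-identityʳ a))
  (∈-map⁺ (a ,_) (∈-upTo⁺ h)))
∈-cellsFrom⁺ a (r ∷ p) (suc i) j h = ∈-++⁺ʳ (map (λ j → (a , j)) (upTo r))
  (subst (λ z → (z , j) ∈ cellsFrom (suc a) p) (sym (ℕₚ.+-suc a i)) (∈-cellsFrom⁺ (suc a) p i j h))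

∈-cellsOfShape⁻ : ∀ p {i j} → (i , j) ∈ cellsOfShape p → j < at 0 p i
∈-cellsOfShape⁻ p {i} {j} m = proj₂ (∈-cellsFrom⁻ 0 p (subst ((i , j) ∈_) (cellsOfShape≡ p) m))

∈-cellsOfShape⁺ : ∀ p {i j} → j < at 0 p i → (i , j) ∈ cellsOfShape p
∈-cellsOfShape⁺ p {i} {j} h = subst ((i , j) ∈_) (sym (cellsOfShape≡ p)) (∈-cellsFrom⁺ 0 p i j h)

cellsOfShape-Unique : ∀ p → Unique (cellsOfShape p)
cellsOfShape-Unique p = subst Unique (sym (cellsOfShape≡ p)) (lemma 0 p)
  where
  lemma : ∀ a p → Unique (cellsFrom a p)
  lemma a []      = []
  lemma a (r ∷ p) = Uniqueₚ.++⁺ (Uniqueₚ.map⁺ (λ { refl → refl }) (Uniqueₚ.upTo⁺ r)) (lemma (suc a) p) disj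
    where
    disj : ∀ {c} → c ∈ map (λ j → (a , j)) (upTo r) × c ∈ cellsFrom (suc a) p → ⊥
    disj (m , m') with ∈-map⁻ _ m
    ... | j , _ , refl = ℕₚ.<-irrefl refl (proj₁ (∈-cellsFrom⁻ (suc a) p m'))

at-antitone : ∀ {p} → Linked _≥_ p → ∀ {i i'} → i' ≤ i → at 0 p i ≤ at 0 p i'
at-antitone [] _ = z≤n
at-antitone [-] {zero} {zero} _ = ℕₚ.≤-refl
at-antitone [-] {suc i} _ = z≤n
at-antitone (h ∷ l) {zero} {zero} _ = ℕₚ.≤-refl
at-antitone (h ∷ l) {suc i} {zero} _ = ℕₚ.≤-trans (at-antitone l {i} {0} z≤n) h
at-antitone (h ∷ l) {suc i} {suc i'} (s≤s q) = at-antitone l q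

DownClosed : List Cell → Set
DownClosed cs = ∀ {t i j i' j'} → (t , (i , j)) ∈ cs → i' ≤ i → j' ≤ j → (t , (i' , j')) ∈ cs

cellsBi-DownClosed : ∀ {la mu} → Linked _≥_ la → Linked _≥_ mu → DownClosed (cellsBi la mu)
cellsBi-DownClosed {la} {mu} hl hm {t} {i} {j} {i'} {j'} m p q with ∈-++⁻ (map (true ,_) (cellsOfShape la)) m
... | inj₁ m' with ∈-map⁻ _ m'
...   | _ , c∈ , refl = ∈-++⁺ˡ (∈-map⁺ (true ,_) (∈-cellsOfShape⁺ la
  (ℕₚ.≤-<-trans q (ℕₚ.<-≤-trans (∈-cellsOfShape⁻ la c∈) (at-antitone hl p)))))
cellsBi-DownClosed {la} {mu} hl hm m p q | inj₂ m' with ∈-map⁻ _ m'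
...   | _ , c∈ , refl = ∈-++⁺ʳ (map (true ,_) (cellsOfShape la))
  (∈-map⁺ (false ,_) (∈-cellsOfShape⁺ mu (ℕₚ.≤-<-trans q (ℕₚ.<-≤-trans (∈-cellsOfShape⁻ mu c∈) (at-antitone hm p)))))

cellsBi-Unique : ∀ la mu → Unique (cellsBi la mu)
cellsBi-Unique la mu = Uniqueₚ.++⁺ (Uniqueₚ.map⁺ (λ { refl → refl }) (cellsOfShape-Unique la))
  (Uniqueₚ.map⁺ (λ { refl → refl }) (cellsOfShape-Unique mu)) disj
  where
  disj : ∀ {c} → c ∈ map (true ,_) (cellsOfShape la) × c ∈ map (false ,_) (cellsOfShape mu) → ⊥
  disj (m , m') with ∈-map⁻ (true ,_) m | ∈-map⁻ (false ,_) m'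
  ... | _ , _ , refl | _ , _ , ()

length-cellsBi : ∀ la mu → length (cellsBi la mu) ≡ size la + size mu
length-cellsBi la mu = trans (Listₚ.length-++ (map {B = Cell} (true ,_) (cellsOfShape la))) (cong₂ _+_
  (trans (Listₚ.length-map {B = Cell} (true ,_) (cellsOfShape la)) (length-cellsOfShape la))
  (trans (Listₚ.length-map {B = Cell} (false ,_) (cellsOfShape mu)) (length-cellsOfShape mu)))

-- Covers both a pair of semistandard tableaux, with letters as values, and a standard bitableau,
-- with positions of entries as values; the comparison of distant cells below serves both directions
-- of standardization.
record Filling (cs : List Cell) (W : Cell → ℕ → Set) : Set where
  field
    total∈     : ∀ {c} → c ∈ cs → ∃ λ u → W c u
    functional : ∀ {c u v} → W c u → W c v → u ≡ v
    rows       : ∀ {t i j u v} → W (t , (i , j)) u → W (t , (i , suc j)) v → u ≤ v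
    columns    : ∀ {t i j u v} → W (t , (i , j)) u → W (t , (suc i , j)) v → u < v

module _ {cs : List Cell} {W : Cell → ℕ → Set} (dc : DownClosed cs) (F : Filling cs W) where
  open Filling F

  row-≤ : ∀ k {t i j u v} → (t , (i , k + j)) ∈ cs → W (t , (i , j)) u → W (t , (i , k + j)) v → u ≤ v
  row-≤ zero    m x y = ℕₚ.≤-reflexive (functional x y)
  row-≤ (suc k) m x y with total∈ (dc m ℕₚ.≤-refl (ℕₚ.n≤1+n _))
  ... | w , z = ℕₚ.≤-trans (row-≤ k (dc m ℕₚ.≤-refl (ℕₚ.n≤1+n _)) x z) (rows z y)

  column-< : ∀ k {t i j u v} → (t , (suc k + i , j)) ∈ cs → W (t , (i , j)) u → W (t , (suc k + i , j)) v → u < v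
  column-< zero    m x y = columns x y
  column-< (suc k) m x y with total∈ (dc m (ℕₚ.n≤1+n _) ℕₚ.≤-refl)
  ... | w , z = ℕₚ.<-trans (column-< k (dc m (ℕₚ.n≤1+n _) ℕₚ.≤-refl) x z) (columns z y)

  -- Down the column to the corner (i' , j) and then along the row; the corner belongs to the shape
  -- because the shape is closed downwards.
  southeast-< : ∀ {t i j i' j' u v} → (t , (i' , j')) ∈ cs → i < i' → j ≤ j' → W (t , (i , j)) u → W (t , (i' , j')) v → u < v
  southeast-< {t} {i} {j} {i'} {j'} {u} {v} m p q x y with ℕₚ.m≤n⇒∃[o]m+o≡n p | ℕₚ.m≤n⇒∃[o]m+o≡n q
  ... | k , refl | l , refl with total∈ (dc {j' = j} m ℕₚ.≤-refl q)
  ... | w , z = ℕₚ.<-≤-trans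
    (column-< k (subst (λ a → (t , (suc a , j)) ∈ cs) (ℕₚ.+-comm i k) (dc m ℕₚ.≤-refl q)) x
      (subst (λ a → W (t , (suc a , j)) w) (ℕₚ.+-comm i k) z))
    (row-≤ l (subst (λ a → (t , (suc (i + k) , a)) ∈ cs) (ℕₚ.+-comm j l) m) z (subst (λ a → W (t , (suc (i + k) , a)) v) (ℕₚ.+-comm j l) y))

  southeast-≤ : ∀ {t i j i' j' u v} → (t , (i' , j')) ∈ cs → i ≤ i' → j ≤ j' → W (t , (i , j)) u → W (t , (i' , j')) v → u ≤ v
  southeast-≤ {t} {i} {j} {v = v} m p q x y with ℕₚ.m≤n⇒m<n∨m≡n p
  ... | inj₁ p' = ℕₚ.<⇒≤ (southeast-< m p' q x y)
  ... | inj₂ refl with ℕₚ.m≤n⇒∃[o]m+o≡n q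
  ...   | l , refl = row-≤ l (subst (λ a → (t , (i , a)) ∈ cs) (ℕₚ.+-comm j l) m) x (subst (λ a → W (t , (i , a)) v) (ℕₚ.+-comm j l) y)

-- Every position gets the position (from 0) at which its part starts.
letters : ℕ → ℕ → ∀ {k} → Vec Bool k → List ℕ
letters p cur []           = []
letters p cur (true ∷ st)  = p ∷ letters (suc p) p st
letters p cur (false ∷ st) = cur ∷ letters (suc p) cur st

length-letters : ∀ p cur {k} (st : Vec Bool k) → length (letters p cur st) ≡ k
length-letters p cur []           = refl
length-letters p cur (true ∷ st)  = cong suc (length-letters (suc p) p st)
length-letters p cur (false ∷ st) = cong suc (length-letters (suc p) cur st)

letters-< : ∀ p cur {k} (st : Vec Bool k) → cur < p + k → All (_< p + k) (letters p cur st)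
letters-< p cur [] h = []
letters-< p cur {suc k} (true ∷ st) h = ℕₚ.m<m+n p z<s ∷
  subst (λ z → All (_< z) (letters (suc p) p st)) (sym (ℕₚ.+-suc p k)) (letters-< (suc p) p st (s≤s (ℕₚ.m≤m+n p k)))
letters-< p cur {suc k} (false ∷ st) h = h ∷
  subst (λ z → All (_< z) (letters (suc p) cur st)) (sym (ℕₚ.+-suc p k)) (letters-< (suc p) cur st (subst (cur <_) (ℕₚ.+-suc p k) h))

-- Signs change only where a part starts, so every part has one sign; q is the sign of the position
-- before the vectors.
Consistent : Bool → ∀ {k} → Vec Bool k → Vec Bool k → Set
Consistent q []       []       = ⊤
Consistent q (s ∷ st) (e ∷ es) = (s ≡ true ⊎ q ≡ e) × Consistent e st es

Consistent-not : ∀ {q k} (st e : Vec Bool k) → Consistent q st e → Consistent (not q) st (Vec.map not e)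
Consistent-not [] [] _ = tt
Consistent-not (s ∷ st) (e ∷ es) (inj₁ h , c) = inj₁ h , Consistent-not st es c
Consistent-not (s ∷ st) (e ∷ es) (inj₂ h , c) = inj₂ (cong not h) , Consistent-not st es c

Consistent-++ : ∀ q s {k m} (st : Vec Bool k) (sts es : Vec Bool m) → q ≡ s → Consistent s sts es →
  Consistent q (st Vec.++ sts) (Vec.replicate k s Vec.++ es)
Consistent-++ q s [] sts es refl c = c
Consistent-++ q s (t ∷ st) sts es h c = inj₂ h , Consistent-++ s s st sts es refl c

family-Consistent : ∀ γ {f} → f ∈ family γ → ∀ q → Consistent q (proj₁ (proj₂ f)) (proj₂ (proj₂ f))
family-Consistent [] (here refl) q = tt
family-Consistent ((zero , b) ∷ γ) f∈ q = family-Consistent γ f∈ q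
family-Consistent ((suc k , b) ∷ γ) f∈ q with ∈-family k b γ f∈
... | s , st , g , g∈ , refl = inj₁ refl , Consistent-++ s s st _ _ refl (family-Consistent γ g∈ s)

-- Words of signed letters and their contents

Label : Set
Label = Bool × ℕ

_~_ : Label → Label → Set
(s , u) ~ (t , v) = u < v ⊎ (u ≡ v × s ≡ t)

labels : ℕ → ℕ → ∀ {k} → Vec Bool k → Vec Bool k → List Label
labels p cur st e = zip (Vec.toList e) (letters p cur st)

labels-Linked : ∀ q p cur {k} (st e : Vec Bool k) → cur < p → Consistent q st e → Linked _~_ ((q , cur) ∷ labels p cur st e)
labels-Linked q p cur [] [] h c = [-]
labels-Linked q p cur (true ∷ st) (b ∷ e) h (_ , c) = inj₁ h ∷ labels-Linked b (suc p) p st e ℕₚ.≤-refl c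
labels-Linked q p cur (false ∷ st) (b ∷ e) h (inj₂ r , c) = inj₂ (refl , r) ∷ labels-Linked b (suc p) cur st e (ℕₚ.m<n⇒m<1+n h) c

labels₀-Linked : ∀ {q k} (st e : Vec Bool k) → leading st ≡ 0 → Consistent q st e → Linked _~_ (labels 0 0 st e)
labels₀-Linked [] [] h c = []
labels₀-Linked (true ∷ st) (b ∷ e) h (_ , c) = labels-Linked b 1 0 st e z<s c

-- Compatibility as a condition on neighbours. Letters are start positions, so the letter grows at a
-- start and stays the same inside a part.
Step : Cell × ℕ → Cell × ℕ → Set
Step (c , u) (d , v) = u < v ⊎ (u ≡ v × ¬ T (descent c d))

compatible⇒Step : ∀ prev p cur {k} (st e : Vec Bool k) Q → length Q ≡ k → cur < p → T (compatible prev st e Q) →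
  map sign Q ≡ Vec.toList e × Linked Step ((prev , cur) ∷ zip Q (letters p cur st))
compatible⇒Step prev p cur [] [] [] _ h t = refl , [-]
compatible⇒Step prev p cur (s ∷ st) (b ∷ e) (c ∷ Q) l h t with ∧⁻ {eqBool b (sign c)} t
... | t₁ , t₂ with ∧⁻ {s ∨ not (descent prev c)} t₂
compatible⇒Step prev p cur (true ∷ st) (b ∷ e) (c ∷ Q) l h t | t₁ , t₂ | t₃ , t₄
  with compatible⇒Step c (suc p) p st e Q (ℕₚ.suc-injective l) ℕₚ.≤-refl t₄
... | r , L = cong₂ _∷_ (sym (eqBool⇒≡ t₁)) r , inj₁ h ∷ L
compatible⇒Step prev p cur (false ∷ st) (b ∷ e) (c ∷ Q) l h t | t₁ , t₂ | t₃ , t₄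
  with compatible⇒Step c (suc p) cur st e Q (ℕₚ.suc-injective l) (ℕₚ.m<n⇒m<1+n h) t₄
... | r , L = cong₂ _∷_ (sym (eqBool⇒≡ t₁)) r , inj₂ (refl , T-not⁻ t₃) ∷ L

Step⇒compatible : ∀ prev p cur {k} (st e : Vec Bool k) Q → map sign Q ≡ Vec.toList e →
  Linked Step ((prev , cur) ∷ zip Q (letters p cur st)) → T (compatible prev st e Q)
Step⇒compatible prev p cur [] [] [] r L = tt
Step⇒compatible prev p cur (true ∷ st) (b ∷ e) (c ∷ Q) r (x ∷ L) =
  ∧⁺ (≡⇒eqBool (sym (Listₚ.∷-injectiveˡ r))) (Step⇒compatible c (suc p) p st e Q (Listₚ.∷-injectiveʳ r) L)
Step⇒compatible prev p cur (false ∷ st) (b ∷ e) (c ∷ Q) r (x ∷ L) =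
  ∧⁺ (≡⇒eqBool (sym (Listₚ.∷-injectiveˡ r))) (∧⁺ (T-not⁺ (level x)) (Step⇒compatible c (suc p) cur st e Q (Listₚ.∷-injectiveʳ r) L))
  where
  level : Step (prev , cur) (c , cur) → ¬ T (descent prev c)
  level (inj₁ lt) = ⊥-elim (ℕₚ.<-irrefl refl lt)
  level (inj₂ (_ , nd)) = nd

compatible⇒Step₀ : ∀ prev {k} (st e : Vec Bool k) Q → leading st ≡ 0 → length Q ≡ k → T (compatible prev st e Q) →
  map sign Q ≡ Vec.toList e × Linked Step (zip Q (letters 0 0 st))
compatible⇒Step₀ prev [] [] [] h l t = refl , []
compatible⇒Step₀ prev (true ∷ st) (b ∷ e) (c ∷ Q) h l t with ∧⁻ {eqBool b (sign c)} t
... | t₁ , t₂ with compatible⇒Step c 1 0 st e Q (ℕₚ.suc-injective l) z<s t₂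
... | r , L = cong₂ _∷_ (sym (eqBool⇒≡ t₁)) r , L

Step₀⇒compatible : ∀ prev {k} (st e : Vec Bool k) Q → leading st ≡ 0 → map sign Q ≡ Vec.toList e →
  Linked Step (zip Q (letters 0 0 st)) → T (compatible prev st e Q)
Step₀⇒compatible prev [] [] [] h r L = tt
Step₀⇒compatible prev (true ∷ st) (b ∷ e) (c ∷ Q) h r L =
  ∧⁺ (≡⇒eqBool (sym (Listₚ.∷-injectiveˡ r))) (Step⇒compatible c 1 0 st e Q (Listₚ.∷-injectiveʳ r) L)

if-0 : ∀ b → 0 ≡ (if b then 0 else 0)
if-0 true  = refl
if-0 false = refl

if-suc : ∀ b m → (if b then 1 else 0) + (if b then m else 0) ≡ (if b then suc m else 0)
if-suc true  m = refl
if-suc false m = refl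

countLabels : ℕ → List Label → ℕ
countLabels q = count (λ (s , u) → s ∧ eqℕ u q)

countLabels-∷ : ∀ q s u L → countLabels q ((s , u) ∷ L) ≡ (if s ∧ eqℕ u q then 1 else 0) + countLabels q L
countLabels-∷ q s u L with s ∧ eqℕ u q
... | true = refl
... | false = refl

countLabels-∷-≢ : ∀ q s u L → u ≢ q → countLabels q ((s , u) ∷ L) ≡ countLabels q L
countLabels-∷-≢ q s u L h = trans (countLabels-∷ q s u L) (cong (λ z → (if z then 1 else 0) + countLabels q L)
  (trans (cong (s ∧_) (≢⇒eqℕ h)) (Boolₚ.∧-zeroʳ s)))

countLabels-∷-≡ : ∀ q s L → countLabels q ((s , q) ∷ L) ≡ (if s then 1 else 0) + countLabels q L
countLabels-∷-≡ q s L = trans (countLabels-∷ q s q L) (cong (λ z → (if z then 1 else 0) + countLabels q L)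
  (trans (cong (s ∧_) (eqℕ-refl q)) (Boolₚ.∧-identityʳ s)))

countLabels-other : ∀ q p cur {k} (st e : Vec Bool k) → q < p → q ≢ cur → countLabels q (labels p cur st e) ≡ 0
countLabels-other q p cur [] [] h h' = refl
countLabels-other q p cur (true ∷ st) (b ∷ e) h h' = trans (countLabels-∷-≢ q b p _ (ℕₚ.<⇒≢ h ∘ sym))
  (countLabels-other q (suc p) p st e (ℕₚ.m<n⇒m<1+n h) (ℕₚ.<⇒≢ h))
countLabels-other q p cur (false ∷ st) (b ∷ e) h h' = trans (countLabels-∷-≢ q b cur _ (h' ∘ sym))
  (countLabels-other q (suc p) cur st e (ℕₚ.m<n⇒m<1+n h) h')

-- The open part has `leading st` positions to come, all with the sign q₀; after it every letter is
-- at least p, hence different from `cur`.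
countLabels-current : ∀ q₀ p cur {k} (st e : Vec Bool k) → cur < p → Consistent q₀ st e →
  countLabels cur (labels p cur st e) ≡ (if q₀ then leading st else 0)
countLabels-current q₀ p cur [] [] h _ = if-0 q₀
countLabels-current q₀ p cur (true ∷ st) (b ∷ e) h _ = trans (countLabels-∷-≢ cur b p _ (ℕₚ.<⇒≢ h ∘ sym))
  (trans (countLabels-other cur (suc p) p st e (ℕₚ.m<n⇒m<1+n h) (ℕₚ.<⇒≢ h)) (if-0 q₀))
countLabels-current q₀ p cur (false ∷ st) (b ∷ e) h (inj₂ refl , c) = trans (countLabels-∷-≡ cur b _)
  (trans (cong ((if b then 1 else 0) +_) (countLabels-current b (suc p) cur st e (ℕₚ.m<n⇒m<1+n h) c)) (if-suc b (leading st)))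

countLabels-new : ∀ q₀ p cur {k} (st e : Vec Bool k) (i : Fin k) → cur < p → Consistent q₀ st e →
  countLabels (p + toℕ i) (labels p cur st e) ≡ Vec.lookup (mask e (runs st)) i
countLabels-new q₀ p cur (true ∷ st) (b ∷ e) Fin.zero h (_ , c) rewrite ℕₚ.+-identityʳ p = trans (countLabels-∷-≡ p b _)
  (trans (cong ((if b then 1 else 0) +_) (countLabels-current b (suc p) p st e ℕₚ.≤-refl c)) (if-suc b (leading st)))
countLabels-new q₀ p cur (true ∷ st) (b ∷ e) (Fin.suc i) h (_ , c) rewrite ℕₚ.+-suc p (toℕ i) =
  trans (countLabels-∷-≢ (suc (p + toℕ i)) b p _ (ℕₚ.<⇒≢ (s≤s (ℕₚ.m≤m+n p (toℕ i)))))
    (countLabels-new b (suc p) p st e i ℕₚ.≤-refl c)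
countLabels-new q₀ p cur (false ∷ st) (b ∷ e) Fin.zero h (_ , c) rewrite ℕₚ.+-identityʳ p = trans (countLabels-∷-≢ p b cur _ (ℕₚ.<⇒≢ h))
  (trans (countLabels-other p (suc p) cur st e ℕₚ.≤-refl (ℕₚ.<⇒≢ h ∘ sym)) (if-0 b))
countLabels-new q₀ p cur (false ∷ st) (b ∷ e) (Fin.suc i) h (_ , c) rewrite ℕₚ.+-suc p (toℕ i) =
  trans (countLabels-∷-≢ (suc (p + toℕ i)) b cur _ (ℕₚ.<⇒≢ (ℕₚ.<-trans h (s≤s (ℕₚ.m≤m+n p (toℕ i))))))
    (countLabels-new b (suc p) cur st e i (ℕₚ.m<n⇒m<1+n h) c)

countLabels₀ : ∀ {q₀ k} (st e : Vec Bool k) (i : Fin k) → leading st ≡ 0 → Consistent q₀ st e →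
  countLabels (toℕ i) (labels 0 0 st e) ≡ Vec.lookup (mask e (runs st)) i
countLabels₀ (true ∷ st) (b ∷ e) Fin.zero h (_ , c) = trans (countLabels-∷-≡ 0 b _)
  (trans (cong ((if b then 1 else 0) +_) (countLabels-current b 1 0 st e z<s c)) (if-suc b (leading st)))
countLabels₀ (true ∷ st) (b ∷ e) (Fin.suc i) h (_ , c) = trans (countLabels-∷-≢ (suc (toℕ i)) b 0 _ (λ ()))
  (countLabels-new b 1 0 st e i z<s c)

-- Complementing all signs exchanges the roles of x and y, so one count of positive labels yields
-- the exponents in both alphabets.
select : Bool → Bool → Bool
select true  b = b
select false b = not b

countSelected : ∀ {q₀ k} (st e : Vec Bool k) s (i : Fin k) → leading st ≡ 0 → Consistent q₀ st e →
  count (λ (t , u) → select s t ∧ eqℕ u (toℕ i)) (labels 0 0 st e) ≡ Vec.lookup (mask (Vec.map (select s) e) (runs st)) i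
countSelected st e true i h c = trans (countLabels₀ st e i h c) (cong (λ z → Vec.lookup (mask z (runs st)) i) (sym (Vecₚ.map-id e)))
countSelected {k = k} st e false i h c = trans (trans (sym (count-map (λ (t , u) → (not t , u)) _ (labels 0 0 st e)))
  (cong (countLabels (toℕ i)) (lemma e (letters 0 0 st)))) (countLabels₀ st (Vec.map not e) i h (Consistent-not st e c))
  where
  lemma : ∀ {k} (e : Vec Bool k) l → map (λ (t , u) → (not t , u)) (zip (Vec.toList e) l) ≡ zip (Vec.toList (Vec.map not e)) l
  lemma [] l = refl
  lemma (b ∷ e) [] = refl
  lemma (b ∷ e) (x ∷ l) = cong ((not b , x) ∷_) (lemma e l)

isLabel : Label → Label → Bool
isLabel (s , q) (t , u) = select s t ∧ eqℕ u q

isLabel⇒≡ : ∀ x y → T (isLabel x y) → x ≡ y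
isLabel⇒≡ (true , q) (true , u) t = cong (true ,_) (sym (ℕₚ.≡ᵇ⇒≡ u q t))
isLabel⇒≡ (false , q) (false , u) t = cong (false ,_) (sym (ℕₚ.≡ᵇ⇒≡ u q t))

isLabel-refl : ∀ x → T (isLabel x x)
isLabel-refl (true , q) = ℕₚ.≡⇒≡ᵇ q q refl
isLabel-refl (false , q) = ℕₚ.≡⇒≡ᵇ q q refl

count-∷ : {A : Set} (p : A → Bool) (x : A) → ∀ xs → count p (x ∷ xs) ≡ (if p x then 1 else 0) + count p xs
count-∷ p x xs with p x
... | true  = refl
... | false = refl

-- Removing one x from each list preserves the inequalities between the multiplicities, and equal
-- lengths leave nothing over in `ys`.
counts⇒↭ : ∀ (xs ys : List Label) → length xs ≡ length ys →
  (∀ {x} → x ∈ xs → count (isLabel x) xs ≤ count (isLabel x) ys) → xs ↭ ys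
counts⇒↭ [] [] h c = ↭-refl
counts⇒↭ (x ∷ xs) ys h c with filterᵇ (isLabel x) ys in eq | ℕₚ.≤-trans (one x xs) (c (here refl))
  where
  one : ∀ x xs → 1 ≤ count (isLabel x) (x ∷ xs)
  one x xs rewrite T⇒≡ (isLabel-refl x) = s≤s z≤n
... | y ∷ zs | _ with ∈-filterᵇ⁻ ys (subst (y ∈_) (sym eq) (here refl))
... | y∈ , t with refl ← isLabel⇒≡ x y t with ∈⇒↭∷ y∈
... | ws , p = ↭-trans (Perm.prep x (counts⇒↭ xs ws (ℕₚ.suc-injective (trans h (Permₚ.↭-length p))) c')) (↭-sym p)
  where
  c' : ∀ {z} → z ∈ xs → count (isLabel z) xs ≤ count (isLabel z) ws
  c' {z} z∈ = ℕₚ.+-cancelˡ-≤ (if isLabel z x then 1 else 0) _ _ (ℕₚ.≤-trans (ℕₚ.≤-reflexive (sym (count-∷ (isLabel z) x xs)))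
    (ℕₚ.≤-trans (c (there z∈)) (ℕₚ.≤-reflexive (trans (count-↭ (isLabel z) p) (count-∷ (isLabel z) x ws)))))

bit : Bool → ℕ
bit b = if b then 1 else 0

bit-injective : ∀ {a b} → bit a ≡ bit b → a ≡ b
bit-injective {true} {true} _ = refl
bit-injective {false} {false} _ = refl

-- An antisymmetric order that contains `_~_`, so that a word of labels can be recovered from its
-- multiset by sorting.
_⊴_ : Label → Label → Set
_⊴_ = Lex proj₂ (λ x y → bit (proj₁ x) ≤ bit (proj₁ y))

⊴-antisym : ∀ {x y} → x ⊴ y → y ⊴ x → x ≡ y
⊴-antisym (inj₁ p) q = ⊥-elim (ℕₚ.<⇒≱ p (Lex-≤ proj₂ {λ x y → bit (proj₁ x) ≤ bit (proj₁ y)} q))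
⊴-antisym (inj₂ (e , p)) (inj₁ q) = ⊥-elim (ℕₚ.<⇒≢ q (sym e))
⊴-antisym (inj₂ (refl , p)) (inj₂ (_ , q)) = cong (_, _) (bit-injective (ℕₚ.≤-antisym p q))

~⇒⊴ : ∀ {x y} → x ~ y → x ⊴ y
~⇒⊴ (inj₁ p) = inj₁ p
~⇒⊴ (inj₂ (e , refl)) = inj₂ (e , ℕₚ.≤-refl)

eqVecℕ⇒≡ : ∀ {k} (u v : Vec ℕ k) → T (eqVecℕ u v) → u ≡ v
eqVecℕ⇒≡ [] [] t = refl
eqVecℕ⇒≡ (x ∷ u) (y ∷ v) t with ∧⁻ {eqℕ x y} t
... | p , q = cong₂ _∷_ (ℕₚ.≡ᵇ⇒≡ x y p) (eqVecℕ⇒≡ u v q)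

eqVecℕ-refl : ∀ {k} (u : Vec ℕ k) → T (eqVecℕ u u)
eqVecℕ-refl [] = tt
eqVecℕ-refl (x ∷ u) = ∧⁺ (ℕₚ.≡⇒≡ᵇ x x refl) (eqVecℕ-refl u)

-- The standard and semistandard conditions

eqCell-refl : ∀ c → T (eqCell c c)
eqCell-refl (t , (i , j)) = ∧⁺ (eqBool-refl t) (∧⁺ (ℕₚ.≡⇒≡ᵇ i i refl) (ℕₚ.≡⇒≡ᵇ j j refl))

eqCell⇒≡ : ∀ c d → T (eqCell c d) → c ≡ d
eqCell⇒≡ (t , (i , j)) (t' , (i' , j')) h with ∧⁻ {eqBool t t'} h
... | p , h' with ∧⁻ {eqℕ i i'} h'
... | q , r with refl ← eqBool⇒≡ {t} {t'} p | refl ← ℕₚ.≡ᵇ⇒≡ i i' q | refl ← ℕₚ.≡ᵇ⇒≡ j j' r = refl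

Adjacent : Cell → Cell → Set
Adjacent c d = T (eqBool (sign c) (sign d) ∧ adjacentRC (proj₂ c) (proj₂ d))

rightOf⁻ : ∀ {i j i' j'} → T (rightOf (i , j) (i' , j')) → i' ≡ i × j' ≡ suc j
rightOf⁻ {i} {j} {i'} {j'} t with ∧⁻ {eqℕ i' i} t
... | p , q = ℕₚ.≡ᵇ⇒≡ i' i p , ℕₚ.≡ᵇ⇒≡ j' (suc j) q

belowOf⁻ : ∀ {i j i' j'} → T (belowOf (i , j) (i' , j')) → j' ≡ j × i' ≡ suc i
belowOf⁻ {i} {j} {i'} {j'} t with ∧⁻ {eqℕ j' j} t
... | p , q = ℕₚ.≡ᵇ⇒≡ j' j p , ℕₚ.≡ᵇ⇒≡ i' (suc i) q

rightOf-suc : ∀ i j → T (rightOf (i , j) (i , suc j))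
rightOf-suc i j = ∧⁺ (ℕₚ.≡⇒≡ᵇ i i refl) (ℕₚ.≡⇒≡ᵇ j j refl)

belowOf-suc : ∀ i j → T (belowOf (i , j) (suc i , j))
belowOf-suc i j = ∧⁺ (ℕₚ.≡⇒≡ᵇ j j refl) (ℕₚ.≡⇒≡ᵇ i i refl)

Adjacent⁻ : ∀ c d → Adjacent c d → sign c ≡ sign d × (T (rightOf (proj₂ c) (proj₂ d)) ⊎ T (belowOf (proj₂ c) (proj₂ d)))
Adjacent⁻ (t , c) (t' , d) h with ∧⁻ {eqBool t t'} h
... | p , q = eqBool⇒≡ p , Equivalence.to (T-∨ {rightOf c d}) q

right⇒Adjacent : ∀ t c d → T (rightOf c d) → Adjacent (t , c) (t , d)
right⇒Adjacent t c d h = ∧⁺ (eqBool-refl t) (Equivalence.from (T-∨ {rightOf c d}) (inj₁ h))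

below⇒Adjacent : ∀ t c d → T (belowOf c d) → Adjacent (t , c) (t , d)
below⇒Adjacent t c d h = ∧⁺ (eqBool-refl t) (Equivalence.from (T-∨ {rightOf c d}) (inj₂ h))

Adjacent-irrefl : ∀ c → ¬ Adjacent c c
Adjacent-irrefl c@(_ , (i , j)) h with Adjacent⁻ c c h
... | _ , inj₁ r = ℕₚ.1+n≢n (sym (proj₂ (rightOf⁻ {i} {j} {i} {j} r)))
... | _ , inj₂ r = ℕₚ.1+n≢n (sym (proj₂ (belowOf⁻ {i} {j} {i} {j} r)))

isSYT⁻ : ∀ Q → T (isSYT Q) → ∀ {j k c d} → (j , c) ∈ indexFrom 0 Q → (k , d) ∈ indexFrom 0 Q →
  (c ≡ d → j ≡ k) × (Adjacent c d → j < k)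
isSYT⁻ Q h {j} {k} {c} {d} c∈ d∈ with ∧⁻ {eqℕ j k ∨ not (eqCell c d)} (all-T⁻ (all-T⁻ h (to c∈)) (to d∈))
  where
  to : ∀ {x} → x ∈ indexFrom 0 Q → x ∈ indexed Q
  to = subst (_ ∈_) (sym (indexed≡ Q))
... | p , q = same , λ a → ℕₚ.<ᵇ⇒< j k (⇒⁻ q a)
  where
  same : c ≡ d → j ≡ k
  same refl with Equivalence.to (T-∨ {eqℕ j k}) p
  ... | inj₁ r = ℕₚ.≡ᵇ⇒≡ j k r
  ... | inj₂ r = ⊥-elim (T-not⁻ r (eqCell-refl c))

isSYT⁺ : ∀ Q → Unique Q → AllPairs (λ c d → ¬ Adjacent d c) Q → T (isSYT Q)
isSYT⁺ Q u a = all-T⁺ (λ {x} x∈ → all-T⁺ (λ {y} y∈ → check x y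
    (∈-AllPairs₂ (AllPairs-index 0 (AllPairs.zipWith id (u , a))) (from x∈) (from y∈))))
  where
  from : ∀ {x} → x ∈ indexed Q → x ∈ indexFrom 0 Q
  from = subst (_ ∈_) (indexed≡ Q)
  R : ℕ × Cell → ℕ × Cell → Set
  R x y = proj₁ x < proj₁ y × (proj₂ x ≢ proj₂ y × ¬ Adjacent (proj₂ y) (proj₂ x))
  check : ∀ x y → x ≡ y ⊎ R x y ⊎ R y x → T ((eqℕ (proj₁ x) (proj₁ y) ∨ not (eqCell (proj₂ x) (proj₂ y))) ∧
    (not (eqBool (proj₁ (proj₂ x)) (proj₁ (proj₂ y)) ∧ adjacentRC (proj₂ (proj₂ x)) (proj₂ (proj₂ y))) ∨ (proj₁ x <ᵇ proj₁ y)))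
  check (j , c) .(j , c) (inj₁ refl) = ∧⁺ (Equivalence.from (T-∨ {eqℕ j j}) (inj₁ (ℕₚ.≡⇒≡ᵇ j j refl)))
    (⇒⁺ (λ h → ⊥-elim (Adjacent-irrefl c h)))
  check (j , c) (k , d) (inj₂ (inj₁ (j<k , c≢d , _))) =
    ∧⁺ (Equivalence.from (T-∨ {eqℕ j k}) (inj₂ (T-not⁺ (c≢d ∘ eqCell⇒≡ c d)))) (⇒⁺ (λ _ → ℕₚ.<⇒<ᵇ j<k))
  check (j , c) (k , d) (inj₂ (inj₂ (k<j , d≢c , na))) =
    ∧⁺ (Equivalence.from (T-∨ {eqℕ j k}) (inj₂ (T-not⁺ (d≢c ∘ sym ∘ eqCell⇒≡ c d)))) (⇒⁺ (λ h → ⊥-elim (na h)))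

isSYT⇒Unique : ∀ Q → T (isSYT Q) → Unique Q
isSYT⇒Unique Q h = subst Unique (map-indexFrom 0 Q) (AllPairsₚ.map⁺ (AllPairs.map
  (λ (j<k , x∈ , y∈) e → ℕₚ.<⇒≢ j<k (proj₁ (isSYT⁻ Q h x∈ y∈) e)) (AllPairs-∈ (indexFrom-< 0 Q))))

isSSYT⁻ : ∀ {N} p (f : List (Fin N)) → T (isSSYT p f) → ∀ {c d u v} → (c , u) ∈ zip (cellsOfShape p) f → (d , v) ∈ zip (cellsOfShape p) f →
  (T (rightOf c d) → toℕ u ≤ toℕ v) × (T (belowOf c d) → toℕ u < toℕ v)
isSSYT⁻ p f h {c} {d} {u} {v} c∈ d∈ with ∧⁻ {not (rightOf c d) ∨ (toℕ u ≤ᵇ toℕ v)} (all-T⁻ (all-T⁻ h c∈) d∈)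
... | p' , q = (λ r → ℕₚ.≤ᵇ⇒≤ (toℕ u) (toℕ v) (⇒⁻ p' r)) , (λ r → ℕₚ.<ᵇ⇒< (toℕ u) (toℕ v) (⇒⁻ q r))

isSSYT⁺ : ∀ {N} p (f : List (Fin N)) → (∀ {c d u v} → (c , u) ∈ zip (cellsOfShape p) f → (d , v) ∈ zip (cellsOfShape p) f →
  (T (rightOf c d) → toℕ u ≤ toℕ v) × (T (belowOf c d) → toℕ u < toℕ v)) → T (isSSYT p f)
isSSYT⁺ p f h = all-T⁺ (λ x∈ → all-T⁺ (λ y∈ → ∧⁺ (⇒⁺ (ℕₚ.≤⇒≤ᵇ ∘ proj₁ (h x∈ y∈))) (⇒⁺ (ℕₚ.<⇒<ᵇ ∘ proj₂ (h x∈ y∈)))))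

SSYT⁻ : ∀ N p {f} → f ∈ SSYT N p → length f ≡ length (cellsOfShape p) × T (isSSYT p f)
SSYT⁻ N p f∈ with ∈-filterᵇ⁻ (allLists (length (cellsOfShape p)) (allFinL N)) f∈
... | m , t = proj₁ (∈-allLists⁻ (length (cellsOfShape p)) m) , t

SSYT⁺ : ∀ N p {f} → length f ≡ length (cellsOfShape p) → T (isSSYT p f) → f ∈ SSYT N p
SSYT⁺ N p {f} l t = ∈-filterᵇ⁺ (subst (λ z → f ∈ allLists z (allFinL N)) l (∈-allLists⁺ (All.tabulate (λ {x} _ → ∈-allFinL x)))) t

SSYT-Unique : ∀ N p → Unique (SSYT N p)
SSYT-Unique N p = Uniqueₚ.filter⁺ (T? ∘ isSSYT p) (allLists-Unique (length (cellsOfShape p)) (allFinL-Unique N))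

toFins : ∀ {n} f → All (_< n) f → ∃ λ (g : List (Fin n)) → map toℕ g ≡ f
toFins [] [] = [] , refl
toFins (x ∷ f) (h ∷ hs) with toFins f hs
... | g , e = Fin.fromℕ< h ∷ g , cong₂ _∷_ (Finₚ.toℕ-fromℕ< h) e

labelOf : Cell × ℕ → Label
labelOf (c , u) = (sign c , u)

zip-labels : ∀ Q l → zip (map sign Q) l ≡ map labelOf (zip Q l)
zip-labels [] l = refl
zip-labels (c ∷ Q) [] = refl
zip-labels (c ∷ Q) (u ∷ l) = cong (_ ∷_) (zip-labels Q l)

module _ (la mu : List ℕ) {N : ℕ} where

  -- Both tableaux as one association list from cells to letters: up to order, this can be compared
  -- with a standard bitableau zipped with its word.
  fill : List (Fin N) → List (Fin N) → List (Cell × ℕ)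
  fill F G = map (λ (c , u) → ((true , c) , toℕ u)) (zip (cellsOfShape la) F) ++ map (λ (c , u) → ((false , c) , toℕ u))
    (zip (cellsOfShape mu) G)

  module _ {F G : List (Fin N)} (lF : length F ≡ length (cellsOfShape la)) (lG : length G ≡ length (cellsOfShape mu)) where

    fill-zip : fill F G ≡ zip (cellsBi la mu) (map toℕ F ++ map toℕ G)
    fill-zip = lemma (cellsOfShape la) F lF
      where
      single : ∀ t (cs : List (ℕ × ℕ)) (G : List (Fin N)) → map (λ (c , u) → ((t , c) , toℕ u)) (zip cs G) ≡ zip (map (t ,_) cs) (map toℕ G)
      single t [] G = refl
      single t (c ∷ cs) [] = refl
      single t (c ∷ cs) (u ∷ G) = cong (_ ∷_) (single t cs G)
      lemma : ∀ (cs : List (ℕ × ℕ)) F → length F ≡ length cs →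
        map (λ (c , u) → ((true , c) , toℕ u)) (zip cs F) ++ map (λ (c , u) → ((false , c) , toℕ u)) (zip (cellsOfShape mu) G) ≡
        zip (map (true ,_) cs ++ map (false ,_) (cellsOfShape mu)) (map toℕ F ++ map toℕ G)
      lemma [] [] l = single false (cellsOfShape mu) G
      lemma (c ∷ cs) (u ∷ F) l = cong (_ ∷_) (lemma cs F (ℕₚ.suc-injective l))

    fill-length : length (cellsBi la mu) ≡ length (map toℕ F ++ map toℕ G)
    fill-length = trans (length-++′ (cellsOfShape la) (cellsOfShape mu)) (trans (cong₂ _+_ (sym lF) (sym lG))
      (sym (trans (Listₚ.length-++ (map toℕ F)) (cong₂ _+_ (Listₚ.length-map toℕ F) (Listₚ.length-map toℕ G)))))
      where
      length-++′ : ∀ (xs ys : List (ℕ × ℕ)) → length (map {B = Cell} (true ,_) xs ++ map (false ,_) ys) ≡ length xs + length ys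
      length-++′ xs ys = trans (Listₚ.length-++ (map {B = Cell} (true ,_) xs))
        (cong₂ _+_ (Listₚ.length-map {B = Cell} (true ,_) xs) (Listₚ.length-map {B = Cell} (false ,_) ys))

    fill-keys : map proj₁ (fill F G) ≡ cellsBi la mu
    fill-keys = trans (cong (map proj₁) fill-zip) (map-proj₁-zip (cellsBi la mu) (map toℕ F ++ map toℕ G) fill-length)

    fill-values : map proj₂ (fill F G) ≡ map toℕ F ++ map toℕ G
    fill-values = trans (cong (map proj₂) fill-zip) (map-proj₂-zip (cellsBi la mu) (map toℕ F ++ map toℕ G) fill-length)

    fill-labels : map labelOf (fill F G) ≡ map (λ u → (true , toℕ u)) F ++ map (λ u → (false , toℕ u)) G
    fill-labels = trans (Listₚ.map-++ labelOf (map _ (zip (cellsOfShape la) F)) _)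
      (cong₂ _++_ (part true (cellsOfShape la) F lF) (part false (cellsOfShape mu) G lG))
      where
      part : ∀ t (cs : List (ℕ × ℕ)) (F : List (Fin N)) → length F ≡ length cs →
        map labelOf (map (λ (c , u) → ((t , c) , toℕ u)) (zip cs F)) ≡ map (λ u → (t , toℕ u)) F
      part t [] [] l = refl
      part t (c ∷ cs) (u ∷ F) l = cong (_ ∷_) (part t cs F (ℕₚ.suc-injective l))

    fill-count : ∀ s q → count (isLabel (s , q)) (map labelOf (fill F G)) ≡ count (λ u → eqℕ (toℕ u) q) (if s then F else G)
    fill-count s q = trans (cong (count (isLabel (s , q))) fill-labels) (trans (count-++ (isLabel (s , q)) (map (λ u → (true , toℕ u)) F) _)
      (trans (cong₂ _+_ (count-map _ (isLabel (s , q)) F) (count-map _ (isLabel (s , q)) G)) (sum≡ s)))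
      where
      none : ∀ (xs : List (Fin N)) → count (λ _ → false) xs ≡ 0
      none [] = refl
      none (x ∷ xs) = none xs
      sum≡ : ∀ s → count (λ u → isLabel (s , q) (true , toℕ u)) F + count (λ u → isLabel (s , q) (false , toℕ u)) G ≡
        count (λ u → eqℕ (toℕ u) q) (if s then F else G)
      sum≡ true = trans (cong (count (λ u → eqℕ (toℕ u) q) F +_) (none G)) (ℕₚ.+-identityʳ _)
      sum≡ false = cong (_+ count (λ u → eqℕ (toℕ u) q) G) (none F)

  fill-∈ : ∀ {F G c t u} → ((t , c) , u) ∈ fill F G →
    ∃ λ v → toℕ v ≡ u × (c , v) ∈ zip (cellsOfShape (if t then la else mu)) (if t then F else G)
  fill-∈ {F} {G} m with ∈-++⁻ (map (λ (c , u) → ((true , c) , toℕ u)) (zip (cellsOfShape la) F)) m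
  ... | inj₁ m' with ∈-map⁻ _ m'
  ...   | (c , v) , c∈ , refl = v , refl , c∈
  fill-∈ {F} {G} m | inj₂ m' with ∈-map⁻ _ m'
  ...   | (c , v) , c∈ , refl = v , refl , c∈

  ∈-fill : ∀ {F G c v} t → (c , v) ∈ zip (cellsOfShape (if t then la else mu)) (if t then F else G) → ((t , c) , toℕ v) ∈ fill F G
  ∈-fill true m = ∈-++⁺ˡ (∈-map⁺ _ m)
  ∈-fill {F} false m = ∈-++⁺ʳ (map _ (zip (cellsOfShape la) F)) (∈-map⁺ _ m)

  fill-injective : ∀ {F G F' G'} → length F ≡ length (cellsOfShape la) → length G ≡ length (cellsOfShape mu) →
    length F' ≡ length (cellsOfShape la) → length G' ≡ length (cellsOfShape mu) → fill F G ↭ fill F' G' → F ≡ F' × G ≡ G'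
  fill-injective {F} {G} {F'} {G'} lF lG lF' lG' p = Listₚ.map-injective Finₚ.toℕ-injective (proj₁ both) , Listₚ.map-injective
    Finₚ.toℕ-injective (proj₂ both)
    where
    fills : fill F G ≡ fill F' G'
    fills = Unique-keys-⊆⇒≡ (fill F G) (fill F' G') (trans (fill-keys lF lG) (sym (fill-keys lF' lG')))
      (subst Unique (sym (fill-keys lF lG)) (cellsBi-Unique la mu)) (Permₚ.∈-resp-↭ p)
    both : map toℕ F ≡ map toℕ F' × map toℕ G ≡ map toℕ G'
    both = ++-cancel (map toℕ F) (map toℕ F') (trans (Listₚ.length-map toℕ F) (trans (trans lF (sym lF')) (sym (Listₚ.length-map toℕ F'))))
      (trans (sym (fill-values lF lG)) (trans (cong (map proj₂) fills) (fill-values lF' lG')))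

  fill-Filling : ∀ {F G} → F ∈ SSYT N la → G ∈ SSYT N mu → Filling (cellsBi la mu) (λ c u → (c , u) ∈ fill F G)
  fill-Filling {F} {G} F∈ G∈ = record
    { total∈ = λ c∈ → find-value (∈-map⁻ proj₁ (subst (_ ∈_) (sym keys) c∈))
    ; functional = unique-value (subst Unique (sym keys) (cellsBi-Unique la mu))
    ; rows = λ {t} {i} {j} x y → monotone t (λ m m' → proj₁ (order t m m') (rightOf-suc i j)) (fill-∈ {F} {G} {t = t} x)
      (fill-∈ {F} {G} {t = t} y)
    ; columns = λ {t} {i} {j} x y → monotone t (λ m m' → proj₂ (order t m m') (belowOf-suc i j)) (fill-∈ {F} {G} {t = t} x)
      (fill-∈ {F} {G} {t = t} y)
    }
    where
    keys : map proj₁ (fill F G) ≡ cellsBi la mu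
    keys = fill-keys (proj₁ (SSYT⁻ N la F∈)) (proj₁ (SSYT⁻ N mu G∈))
    find-value : ∀ {c} → (∃ λ x → x ∈ fill F G × c ≡ proj₁ x) → ∃ λ u → (c , u) ∈ fill F G
    find-value ((c , u) , m , refl) = u , m
    unique-value : ∀ {xs : List (Cell × ℕ)} → Unique (map proj₁ xs) → ∀ {c u v} → (c , u) ∈ xs → (c , v) ∈ xs → u ≡ v
    unique-value (x∉ ∷ U) (here refl) (here refl) = refl
    unique-value (x∉ ∷ U) (here refl) (there m) = ⊥-elim (All.lookup x∉ (∈-map⁺ proj₁ m) refl)
    unique-value (x∉ ∷ U) (there m) (here refl) = ⊥-elim (All.lookup x∉ (∈-map⁺ proj₁ m) refl)
    unique-value (x∉ ∷ U) (there m) (there m') = unique-value U m m'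
    order : ∀ t {c d u v} → (c , u) ∈ zip (cellsOfShape (if t then la else mu)) (if t then F else G) →
      (d , v) ∈ zip (cellsOfShape (if t then la else mu)) (if t then F else G) →
      (T (rightOf c d) → toℕ u ≤ toℕ v) × (T (belowOf c d) → toℕ u < toℕ v)
    order true = isSSYT⁻ la F (proj₂ (SSYT⁻ N la F∈))
    order false = isSSYT⁻ mu G (proj₂ (SSYT⁻ N mu G∈))
    monotone : ∀ t {c d u v} {R : ℕ → ℕ → Set} → (∀ {u v} → (c , u) ∈ zip (cellsOfShape (if t then la else mu)) (if t then F else G) →
      (d , v) ∈ zip (cellsOfShape (if t then la else mu)) (if t then F else G) → R (toℕ u) (toℕ v)) →
      (∃ λ w → toℕ w ≡ u × (c , w) ∈ zip (cellsOfShape (if t then la else mu)) (if t then F else G)) →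
      (∃ λ w → toℕ w ≡ v × (d , w) ∈ zip (cellsOfShape (if t then la else mu)) (if t then F else G)) → R u v
    monotone t f (w , refl , m) (w' , refl , m') = f m m'

-- The reading order on the standard side: by letter, and from left to right among equal letters.
-- Signs are not compared, since all positions of a part carry the same sign.
_≺_ : Cell × ℕ → Cell × ℕ → Set
_≺_ = Lex proj₂ (λ x y → col (proj₁ x) < col (proj₁ y))

≺-antisym : ∀ {x y} → x ≺ y → y ≺ x → x ≡ y
≺-antisym {x} {y} (inj₁ p) q = ⊥-elim (ℕₚ.<⇒≱ p (Lex-≤ proj₂ {λ x y → col (proj₁ x) < col (proj₁ y)} {y} {x} q))
≺-antisym (inj₂ (e , _)) (inj₁ q) = ⊥-elim (ℕₚ.<⇒≢ q (sym e))
≺-antisym (inj₂ (_ , p)) (inj₂ (_ , q)) = ⊥-elim (ℕₚ.<-asym p q)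

-- Standardization: equal letters are read from left to right.
_⊑_ : Cell × ℕ → Cell × ℕ → Set
_⊑_ = Lex proj₂ (Lex (bit ∘ sign ∘ proj₁) (λ x y → col (proj₁ x) ≤ col (proj₁ y)))

⊑-total : ∀ x y → x ⊑ y ⊎ y ⊑ x
⊑-total = Lex-total proj₂ (Lex-total (bit ∘ sign ∘ proj₁) (λ x y → ℕₚ.≤-total (col (proj₁ x)) (col (proj₁ y))))

⊑-trans : ∀ {x y z} → x ⊑ y → y ⊑ z → x ⊑ z
⊑-trans {x} {y} {z} = Lex-trans proj₂ (λ {x} {y} {z} → Lex-trans (bit ∘ sign ∘ proj₁)
  (λ {x} {y} {z} → ℕₚ.≤-trans {col (proj₁ x)} {col (proj₁ y)} {col (proj₁ z)}) {x} {y} {z}) {x} {y} {z}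

⊑⇒⊴ : ∀ {x y} → x ⊑ y → labelOf x ⊴ labelOf y
⊑⇒⊴ (inj₁ p) = inj₁ p
⊑⇒⊴ {x} {y} (inj₂ (e , p)) = inj₂ (e , Lex-≤ (bit ∘ sign ∘ proj₁) {λ x y → col (proj₁ x) ≤ col (proj₁ y)} {x} {y} p)

⊑-col : ∀ {x y} → x ⊑ y → proj₂ x ≡ proj₂ y → sign (proj₁ x) ≡ sign (proj₁ y) → col (proj₁ x) ≤ col (proj₁ y)
⊑-col (inj₁ p) e s = ⊥-elim (ℕₚ.<⇒≢ p e)
⊑-col (inj₂ (_ , inj₁ p)) e s = ⊥-elim (ℕₚ.<⇒≢ p (cong bit s))
⊑-col (inj₂ (_ , inj₂ (_ , p))) e s = p

¬descent⁻ : ∀ c d → ¬ T (descent c d) → sign c ≡ sign d × row d ≤ row c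
¬descent⁻ c d h = same (sign c) (sign d) (λ t → h (Equivalence.from (T-∨ {not (eqBool (sign c) (sign d))}) (inj₁ t))) ,
  ℕₚ.≮⇒≥ (λ p → h (Equivalence.from (T-∨ {not (eqBool (sign c) (sign d))}) (inj₂ (ℕₚ.<⇒<ᵇ p))))
  where
  same : ∀ a b → ¬ T (not (eqBool a b)) → a ≡ b
  same true true _ = refl
  same true false f = ⊥-elim (f tt)
  same false true f = ⊥-elim (f tt)
  same false false _ = refl

¬descent⁺ : ∀ c d → sign c ≡ sign d → row d ≤ row c → ¬ T (descent c d)
¬descent⁺ c d e p t with Equivalence.to (T-∨ {not (eqBool (sign c) (sign d))}) t
... | inj₁ x = T-not⁻ x (≡⇒eqBool e)
... | inj₂ x = ℕₚ.<⇒≱ (ℕₚ.<ᵇ⇒< (row c) (row d) x) p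

-- Standardization as a bijection

module _ (la mu : List ℕ) (hla : Linked _≥_ la) (hmu : Linked _≥_ mu) where

  shape : List Cell
  shape = cellsBi la mu

  SYT⁻ : ∀ {Q} → Q ∈ SYT (size la + size mu) la mu → length Q ≡ size la + size mu × Q ↭ shape × T (isSYT Q)
  SYT⁻ {Q} Q∈ with ∈-filterᵇ⁻ (allLists (size la + size mu) shape) Q∈
  ... | m , t with ∈-allLists⁻ (size la + size mu) m
  ... | word , a = word , Unique-⊆-↭ (isSYT⇒Unique Q t) (All.lookup a) (ℕₚ.≤-reflexive (trans (length-cellsBi la mu) (sym word))) , t

  SYT⁺ : ∀ {Q} → Q ↭ shape → T (isSYT Q) → Q ∈ SYT (size la + size mu) la mu
  SYT⁺ {Q} p t = ∈-filterᵇ⁺ (subst (λ z → Q ∈ allLists z shape) (trans (Permₚ.↭-length p) (length-cellsBi la mu))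
    (∈-allLists⁺ (All.tabulate (Permₚ.∈-resp-↭ p)))) t

  SYT-Unique : Unique (SYT (size la + size mu) la mu)
  SYT-Unique = Uniqueₚ.filter⁺ (T? ∘ isSYT) (allLists-Unique (size la + size mu) (cellsBi-Unique la mu))

  shape-DownClosed : DownClosed shape
  shape-DownClosed {t} {i} {j} {i'} {j'} = cellsBi-DownClosed hla hmu {t} {i} {j} {i'} {j'}

  module _ {Q : List Cell} (perm : Q ↭ shape) (syt : T (isSYT Q)) where

    SYT-Filling : Filling shape (λ c j → (j , c) ∈ indexFrom 0 Q)
    SYT-Filling = record
      { total∈ = λ c∈ → ∈-indexFrom 0 (Permₚ.∈-resp-↭ (↭-sym perm) c∈)
      ; functional = λ x y → proj₁ (isSYT⁻ Q syt x y) refl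
      ; rows = λ {t} {i} {j} x y → ℕₚ.<⇒≤ (proj₂ (isSYT⁻ Q syt x y) (right⇒Adjacent t (i , j) (i , suc j) (rightOf-suc i j)))
      ; columns = λ {t} {i} {j} x y → proj₂ (isSYT⁻ Q syt x y) (below⇒Adjacent t (i , j) (suc i , j) (belowOf-suc i j))
      }

    Indexed : Cell → Cell → Set
    Indexed c d = ∃ λ j → ∃ λ k → j < k × (j , c) ∈ indexFrom 0 Q × (k , d) ∈ indexFrom 0 Q

    SYT-Indexed : AllPairs Indexed Q
    SYT-Indexed = subst (AllPairs Indexed) (map-indexFrom 0 Q)
      (AllPairsₚ.map⁺ (AllPairs.map (λ {x} {y} (p , x∈ , y∈) → proj₁ x , proj₁ y , p , x∈ , y∈) (AllPairs-∈ (indexFrom-< 0 Q))))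

    -- Without a descent d lies in the same tableau as c and not below it. Were it not strictly to
    -- the right either, c would be weakly south-east of d and could not hold the smaller entry.
    Step⇒≺ : ∀ {x y} → Step x y × Indexed (proj₁ x) (proj₁ y) → x ≺ y
    Step⇒≺ (inj₁ p , _) = inj₁ p
    Step⇒≺ {(c@(t , (i , j)) , u)} {(d@(t' , (i' , j')) , v)} (inj₂ (e , nd) , (a , b , a<b , c∈ , d∈)) with ¬descent⁻ c d nd
    ... | refl , i'≤i with j ℕₚ.<? j'
    ...   | yes p = inj₂ (e , p)
    ...   | no ¬p = ⊥-elim (ℕₚ.<⇒≱ a<b (southeast-≤ {W = λ c j → (j , c) ∈ indexFrom 0 Q} shape-DownClosed SYT-Filling
              (Permₚ.∈-resp-↭ perm (subst (c ∈_) (map-indexFrom 0 Q) (∈-map⁺ proj₂ c∈))) i'≤i (ℕₚ.≮⇒≥ ¬p) d∈ c∈))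

    SYT-sorted : ∀ word → Linked Step (zip Q word) → AllPairs (λ x y → x ≺ y × ¬ Adjacent (proj₁ y) (proj₁ x)) (zip Q word)
    SYT-sorted word L = AllPairs.zipWith id
      ( Linkedₚ.Linked⇒AllPairs (λ {x} {y} {z} → Lex-trans proj₂
        (λ {x} {y} {z} → ℕₚ.<-trans {col (proj₁ x)} {col (proj₁ y)} {col (proj₁ z)}) {x} {y} {z})
          (Linked.zipWith (λ {x} {y} → Step⇒≺ {x} {y}) (L , Linkedₚ.AllPairs⇒Linked (AllPairs-zip word SYT-Indexed)))
      , AllPairs.map (λ (j , k , j<k , x∈ , y∈) a → ℕₚ.<-asym j<k (proj₂ (isSYT⁻ Q syt y∈ x∈) a)) (AllPairs-zip word SYT-Indexed) )

  -- Adjacent cells occur in Z in their natural order, which gives the weak inequality. Equal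
  -- letters stand in strictly increasing columns, so two letters in one column differ.
  sorted-order : ∀ {Z} → AllPairs (λ x y → x ≺ y × ¬ Adjacent (proj₁ y) (proj₁ x)) Z → ∀ {c d u v} → (c , u) ∈ Z → (d , v) ∈ Z →
    sign c ≡ sign d → (T (rightOf (proj₂ c) (proj₂ d)) → u ≤ v) × (T (belowOf (proj₂ c) (proj₂ d)) → u < v)
  sorted-order A {c@(t , (i , j))} {d@(_ , (i' , j'))} {u} {v} c∈ d∈ refl with ∈-AllPairs₂ A c∈ d∈
  ... | inj₁ refl = (λ _ → ℕₚ.≤-refl) , λ b → ⊥-elim (Adjacent-irrefl c (below⇒Adjacent t (i , j) (i , j) b))
  ... | inj₂ (inj₁ (p , _)) = (λ _ → Lex-≤ proj₂ {λ x y → col (proj₁ x) < col (proj₁ y)} {c , u} {d , v} p) , below p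
    where
    below : (c , u) ≺ (d , v) → T (belowOf (i , j) (i' , j')) → u < v
    below (inj₁ q) b = q
    below (inj₂ (_ , q)) b = ⊥-elim (ℕₚ.<⇒≢ q (sym (proj₁ (belowOf⁻ {i} {j} {i'} {j'} b))))
  ... | inj₂ (inj₂ (_ , na)) = (λ r → ⊥-elim (na (right⇒Adjacent t (i , j) (i' , j') r))) ,
    (λ b → ⊥-elim (na (below⇒Adjacent t (i , j) (i' , j') b)))

  module _ (st e : Vec Bool (size la + size mu)) (lead : leading st ≡ 0) {q₀ : Bool} (cons : Consistent q₀ st e) (prev : Cell) where

    cellCount : ℕ
    cellCount = size la + size mu

    word : List ℕ
    word = letters 0 0 st

    compatibleSYT : List (List Cell)
    compatibleSYT = filterᵇ (compatible prev st e) (SYT cellCount la mu)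

    matchesContent : List (Fin cellCount) × List (Fin cellCount) → Bool
    matchesContent (F , G) = eqMono (runsMono (st , e)) (content F , content G)

    matchingSSYT : List (List (Fin cellCount) × List (Fin cellCount))
    matchingSSYT = filterᵇ matchesContent (cartesianProduct (SSYT cellCount la) (SSYT cellCount mu))

    Standardizes : List Cell → List (Fin cellCount) × List (Fin cellCount) → Set
    Standardizes Q (F , G) = zip Q word ↭ fill la mu F G

    letters-bound : All (_< cellCount) word
    letters-bound = bound st lead
      where
      bound : ∀ {k} (st : Vec Bool k) → leading st ≡ 0 → All (_< k) (letters 0 0 st)
      bound [] _ = []
      bound (true ∷ st) _ = z<s ∷ letters-< 1 0 st z<s

    masked : Bool → Vec ℕ cellCount
    masked s = mask (Vec.map (select s) e) (runs st)

    masked-true : masked true ≡ mask e (runs st)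
    masked-true = cong (λ z → mask z (runs st)) (Vecₚ.map-id e)

    content⇒counts : ∀ {F G} → T (matchesContent (F , G)) → ∀ s (i : Fin cellCount) →
      count (λ u → eqℕ (toℕ u) (toℕ i)) (if s then F else G) ≡ count (isLabel (s , toℕ i)) (labels 0 0 st e)
    content⇒counts {F} {G} t s i with ∧⁻ {eqVecℕ (mask e (runs st)) (content F)} t
    ... | p , q = trans (sym (Vecₚ.lookup∘tabulate _ i))
      (trans (cong (λ z → Vec.lookup z i) (contents s)) (sym (countSelected st e s i lead cons)))
      where
      contents : ∀ s → content (if s then F else G) ≡ masked s
      contents true = sym (trans masked-true (eqVecℕ⇒≡ _ _ p))
      contents false = sym (eqVecℕ⇒≡ _ _ q)

    counts⇒content : ∀ {F G} → (∀ s (i : Fin cellCount) → count (λ u → eqℕ (toℕ u) (toℕ i)) (if s then F else G) ≡ count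
      (isLabel (s , toℕ i)) (labels 0 0 st e)) →
      T (matchesContent (F , G))
    counts⇒content {F} {G} h = ∧⁺ (equal (trans (sym masked-true) (contents true))) (equal (contents false))
      where
      equal : ∀ {k} {u v : Vec ℕ k} → u ≡ v → T (eqVecℕ u v)
      equal {u = u} refl = eqVecℕ-refl u
      contents : ∀ s → masked s ≡ content (if s then F else G)
      contents s = trans (sym (Vecₚ.tabulate∘lookup (masked s)))
        (Vecₚ.tabulate-cong (λ i → trans (sym (countSelected st e s i lead cons)) (sym (h s i))))

    -- The entry j is replaced by the j-th letter of `word`. Rearranging the cells into the order of
    -- `cellsBi` turns the word into one list of letters, which is cut after the cells of `la` into
    -- the two tableaux.
    sytToSSYT : ∀ {Q} → Q ∈ compatibleSYT → ∃ λ FG → FG ∈ matchingSSYT × Standardizes Q FG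
    sytToSSYT {Q} Q∈ with ∈-filterᵇ⁻ (SYT cellCount la mu) Q∈
    ... | Q∈' , comp with SYT⁻ Q∈'
    ... | lQ , perm , syt with compatible⇒Step₀ prev st e Q lead lQ comp
    ... | signs≡ , steps with zip-↭ perm word (trans lQ (sym (length-letters 0 0 st)))
    ... | f , lf , p with toFins f (values f lf (Permₚ.All-resp-↭ p (bounded Q word letters-bound)))
      where
      bounded : ∀ (Q : List Cell) word → All (_< cellCount) word → All (λ x → proj₂ x < cellCount) (zip Q word)
      bounded [] word a = []
      bounded (c ∷ Q) [] a = []
      bounded (c ∷ Q) (u ∷ word) (h ∷ a) = h ∷ bounded Q word a
      values : ∀ f → length shape ≡ length f → All (λ x → proj₂ x < cellCount) (zip shape f) → All (_< cellCount) f
      values f lf a = subst (All (_< cellCount)) (map-proj₂-zip shape f lf) (Allₚ.map⁺ a)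
    ... | g , refl = (F , G) , ∈-filterᵇ⁺ (∈-cartesianProduct⁺ (SSYT⁺ cellCount la lF (isSSYT⁺ la F (λ m m' → order true m m')))
        (SSYT⁺ cellCount mu lG (isSSYT⁺ mu G (λ m m' → order false m m')))) (counts⇒content counts) , std
      where
      a : ℕ
      a = length (cellsOfShape la)
      F G : List (Fin cellCount)
      F = take a g
      G = drop a g
      lg : length g ≡ a + length (cellsOfShape mu)
      lg = trans (sym (Listₚ.length-map toℕ g)) (trans (sym lf)
        (trans (length-cellsBi la mu) (cong₂ _+_ (sym (length-cellsOfShape la)) (sym (length-cellsOfShape mu)))))
      lF : length F ≡ a
      lF = length-take-+ a lg
      lG : length G ≡ length (cellsOfShape mu)
      lG = length-drop-+ a lg
      std : zip Q word ↭ fill la mu F G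
      std = ↭-trans p (↭-reflexive (trans (cong (zip shape)
        (trans (cong (map toℕ) (sym (Listₚ.take++drop≡id a g))) (Listₚ.map-++ toℕ F G))) (sym (fill-zip la mu lF lG))))
      order : ∀ t {c d u v} → (c , u) ∈ zip (cellsOfShape (if t then la else mu)) (if t then F else G) →
        (d , v) ∈ zip (cellsOfShape (if t then la else mu)) (if t then F else G) →
        (T (rightOf c d) → toℕ u ≤ toℕ v) × (T (belowOf c d) → toℕ u < toℕ v)
      order t m m' = sorted-order (SYT-sorted perm syt word steps) (Permₚ.∈-resp-↭ (↭-sym std) (∈-fill la mu t m))
        (Permₚ.∈-resp-↭ (↭-sym std) (∈-fill la mu t m')) refl
      counts : ∀ s (i : Fin cellCount) → count (λ u → eqℕ (toℕ u) (toℕ i)) (if s then F else G) ≡ count (isLabel (s , toℕ i))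
        (labels 0 0 st e)
      counts s i = trans (sym (fill-count la mu lF lG s (toℕ i))) (trans (count-↭ (isLabel (s , toℕ i)) (Permₚ.map⁺ labelOf (↭-sym std)))
        (cong (count (isLabel (s , toℕ i))) (trans (sym (zip-labels Q word)) (cong (λ z → zip z word) signs≡))))

    -- The cells are numbered in the order `_⊑_`. Their labels then form a sorted list with the
    -- prescribed multiplicities, and `labels 0 0 st e` is the only such list.
    ssytToSYT : ∀ {FG} → FG ∈ matchingSSYT → ∃ λ Q → Q ∈ compatibleSYT × Standardizes Q FG
    ssytToSYT {F , G} FG∈ with ∈-filterᵇ⁻ (cartesianProduct (SSYT cellCount la) (SSYT cellCount mu)) FG∈
    ... | FG∈' , matches with ∈-cartesianProduct⁻ (SSYT cellCount la) (SSYT cellCount mu) FG∈'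
    ... | F∈ , G∈ with sorted {R = _⊑_} ⊑-total (λ {x} {y} {z} → ⊑-trans {x} {y} {z}) (fill la mu F G)
    ... | Z , perm , srt = Q , ∈-filterᵇ⁺ (SYT⁺ Q↭ (isSYT⁺ Q (Unique-↭ (↭-sym Q↭) (cellsBi-Unique la mu)) nonadjacent))
      (Step₀⇒compatible prev st e Q lead signs≡ steps) ,
        subst (λ z → z ↭ fill la mu F G) (sym Z≡) perm
      where
      lF : length F ≡ length (cellsOfShape la)
      lF = proj₁ (SSYT⁻ cellCount la F∈)
      lG : length G ≡ length (cellsOfShape mu)
      lG = proj₁ (SSYT⁻ cellCount mu G∈)
      Q : List Cell
      Q = map proj₁ Z
      Q↭ : Q ↭ shape
      Q↭ = ↭-trans (Permₚ.map⁺ proj₁ perm) (↭-reflexive (fill-keys la mu lF lG))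
      length-e : length (Vec.toList e) ≡ length word
      length-e = trans (Vecₚ.length-toList e) (sym (length-letters 0 0 st))
      lengths : length (map labelOf (fill la mu F G)) ≡ length (labels 0 0 st e)
      lengths = trans (Listₚ.length-map labelOf (fill la mu F G)) (trans (sym (Listₚ.length-map proj₁ (fill la mu F G)))
        (trans (cong length (fill-keys la mu lF lG)) (trans (length-cellsBi la mu)
          (sym (trans (sym (Listₚ.length-map proj₁ (labels 0 0 st e)))
          (trans (cong length (map-proj₁-zip (Vec.toList e) word length-e)) (Vecₚ.length-toList e)))))))
      bounded : ∀ {x} → x ∈ map labelOf (fill la mu F G) → ∃ λ (i : Fin cellCount) → toℕ i ≡ proj₂ x
      bounded m with ∈-map⁻ labelOf m
      ... | ((t , c) , u) , m' , refl with fill-∈ la mu {F = F} {G = G} {t = t} m'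
      ... | v , eq , _ = v , eq
      counts : ∀ {x} → x ∈ map labelOf (fill la mu F G) → count (isLabel x) (map labelOf (fill la mu F G)) ≤ count (isLabel x)
        (labels 0 0 st e)
      counts {s , u} m with bounded m
      ... | i , refl = ℕₚ.≤-reflexive (trans (fill-count la mu lF lG s (toℕ i)) (content⇒counts matches s i))
      labels≡ : map labelOf Z ≡ labels 0 0 st e
      labels≡ = AllPairs-↭⇒≡ {R = _⊴_} ⊴-antisym (AllPairsₚ.map⁺ (AllPairs.map (λ {x} {y} → ⊑⇒⊴ {x} {y}) srt))
        (Linkedₚ.Linked⇒AllPairs (λ {x} {y} {z} → Lex-trans proj₂
          (λ {x} {y} {z} → ℕₚ.≤-trans {bit (proj₁ x)} {bit (proj₁ y)} {bit (proj₁ z)}) {x} {y} {z})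
          (Linked.map ~⇒⊴ (labels₀-Linked st e lead cons)))
        (↭-trans (Permₚ.map⁺ labelOf perm) (counts⇒↭ _ _ lengths counts))
      letters≡ : map proj₂ Z ≡ word
      letters≡ = trans (Listₚ.map-∘ Z) (trans (cong (map proj₂) labels≡) (map-proj₂-zip (Vec.toList e) word length-e))
      signs≡ : map sign Q ≡ Vec.toList e
      signs≡ = trans (trans (sym (Listₚ.map-∘ Z)) (Listₚ.map-∘ Z))
        (trans (cong (map proj₁) labels≡) (map-proj₁-zip (Vec.toList e) word length-e))
      Z≡ : zip Q word ≡ Z
      Z≡ = trans (cong (zip Q) (sym letters≡)) (zip-map-proj Z)
      filling : Filling shape (λ c u → (c , u) ∈ fill la mu F G)
      filling = fill-Filling la mu F∈ G∈
      ordered : AllPairs (λ x y → x ⊑ y × x ∈ Z × y ∈ Z) Z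
      ordered = AllPairs-∈ srt
      nonadjacent : AllPairs (λ c d → ¬ Adjacent d c) Q
      nonadjacent = AllPairsₚ.map⁺ (AllPairs.map (λ {x} {y} (p , x∈ , y∈) → clash x y p x∈ y∈) ordered)
        where
        -- If x were right of y, the letters would be equal and the columns in the wrong order; if x
        -- were below y, its letter would be larger although x comes first.
        clash : ∀ x y → x ⊑ y → x ∈ Z → y ∈ Z → ¬ Adjacent (proj₁ y) (proj₁ x)
        clash (c@(t , (i , j)) , u) (d@(t' , (i' , j')) , v) p x∈ y∈ adj with Adjacent⁻ d c adj
        ... | refl , inj₁ r with rightOf⁻ {i'} {j'} {i} {j} r
        ...   | refl , refl = ℕₚ.<⇒≱ (ℕₚ.n<1+n j') (⊑-col {c , u} {d , v} p
          (ℕₚ.≤-antisym (Lex-≤ proj₂ {Lex (bit ∘ sign ∘ proj₁) (λ x y → col (proj₁ x) ≤ col (proj₁ y))} {c , u} {d , v} p)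
                  (Filling.rows filling (Permₚ.∈-resp-↭ perm y∈) (Permₚ.∈-resp-↭ perm x∈))) refl)
        clash (c@(t , (i , j)) , u) (d@(t' , (i' , j')) , v) p x∈ y∈ adj | refl , inj₂ b with belowOf⁻ {i'} {j'} {i} {j} b
        ...   | refl , refl = ℕₚ.<⇒≱ (Filling.columns filling (Permₚ.∈-resp-↭ perm y∈) (Permₚ.∈-resp-↭ perm x∈))
                  (Lex-≤ proj₂ {Lex (bit ∘ sign ∘ proj₁) (λ x y → col (proj₁ x) ≤ col (proj₁ y))} {c , u} {d , v} p)
      steps : Linked Step (zip Q word)
      steps = subst (Linked Step) (sym Z≡) (Linked.zipWith (λ {x} {y} (r , (p , x∈ , y∈)) → step x y r p x∈ y∈)
        (Linkedₚ.map⁻ (subst (Linked _~_) (sym labels≡) (labels₀-Linked st e lead cons)) , Linkedₚ.AllPairs⇒Linked ordered))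
        where
        step : ∀ x y → labelOf x ~ labelOf y → x ⊑ y → x ∈ Z → y ∈ Z → Step x y
        step x y (inj₁ q) p x∈ y∈ = inj₁ q
        -- Equal letters are read by increasing columns. In a lower row d would lie south-east of c
        -- and carry a larger letter.
        step (c@(t , (i , j)) , u) (d@(t' , (i' , j')) , v) (inj₂ (u≡v , refl)) p x∈ y∈ = inj₂ (u≡v , ¬descent⁺ c d refl (ℕₚ.≮⇒≥ (λ i<i' →
          ℕₚ.<⇒≢ (southeast-< {W = λ c u → (c , u) ∈ fill la mu F G} shape-DownClosed filling (Permₚ.∈-resp-↭ Q↭ (∈-map⁺ proj₁ y∈)) i<i'
            (⊑-col {c , u} {d , v} p u≡v refl)
            (Permₚ.∈-resp-↭ perm x∈) (Permₚ.∈-resp-↭ perm y∈)) u≡v)))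

    -- Each side of `Standardizes` determines the other: `zip Q word` is the unique `_≺_`-sorted
    -- arrangement of its entries, and a filling is recovered from the values at the cells.
    standardization : length compatibleSYT ≡ length matchingSSYT
    standardization = ℕₚ.≤-antisym
      (injective⇒length≤ Standardizes (Uniqueₚ.filter⁺ (T? ∘ compatible prev st e) SYT-Unique) sytToSSYT
        (λ Q∈ Q'∈ r r' → left Q∈ Q'∈ (↭-trans r (↭-sym r'))))
      (injective⇒length≤ (λ FG Q → Standardizes Q FG) (Uniqueₚ.filter⁺ (T? ∘ matchesContent)
        (Uniqueₚ.cartesianProduct⁺ (SSYT-Unique cellCount la) (SSYT-Unique cellCount mu))) ssytToSYT
        (λ x∈ y∈ r r' → right x∈ y∈ (↭-trans (↭-sym r) r')))
      where
      left : ∀ {Q Q'} → Q ∈ compatibleSYT → Q' ∈ compatibleSYT → zip Q word ↭ zip Q' word → Q ≡ Q'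
      left {Q} {Q'} Q∈ Q'∈ p with ∈-filterᵇ⁻ (SYT cellCount la mu) Q∈ | ∈-filterᵇ⁻ (SYT cellCount la mu) Q'∈
      ... | Q∈₁ , comp | Q'∈₁ , comp' with SYT⁻ Q∈₁ | SYT⁻ Q'∈₁
      ... | lQ , perm , syt | lQ' , perm' , syt' = trans (sym (map-proj₁-zip Q word (trans lQ (sym (length-letters 0 0 st)))))
        (trans (cong (map proj₁) (AllPairs-↭⇒≡ {R = _≺_} (λ {x} {y} → ≺-antisym {x} {y})
          (AllPairs.map proj₁ (SYT-sorted perm syt word (proj₂ (compatible⇒Step₀ prev st e Q lead lQ comp))))
          (AllPairs.map proj₁ (SYT-sorted perm' syt' word (proj₂ (compatible⇒Step₀ prev st e Q' lead lQ' comp')))) p))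
        (map-proj₁-zip Q' word (trans lQ' (sym (length-letters 0 0 st)))))
      right : ∀ {x y} → x ∈ matchingSSYT → y ∈ matchingSSYT → fill la mu (proj₁ x) (proj₂ x) ↭ fill la mu (proj₁ y) (proj₂ y) → x ≡ y
      right {F , G} {F' , G'} x∈ y∈ p with ∈-cartesianProduct⁻ (SSYT cellCount la) (SSYT cellCount mu)
        (proj₁ (∈-filterᵇ⁻ (cartesianProduct (SSYT cellCount la) (SSYT cellCount mu)) x∈))
        | ∈-cartesianProduct⁻ (SSYT cellCount la) (SSYT cellCount mu)
          (proj₁ (∈-filterᵇ⁻ (cartesianProduct (SSYT cellCount la) (SSYT cellCount mu)) y∈))
      ... | F∈ , G∈ | F'∈ , G'∈ with fill-injective la mu (proj₁ (SSYT⁻ cellCount la F∈)) (proj₁ (SSYT⁻ cellCount mu G∈))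
        (proj₁ (SSYT⁻ cellCount la F'∈)) (proj₁ (SSYT⁻ cellCount mu G'∈)) p
      ... | refl , refl = refl

    coeff-schurXY : coeff (schurXY cellCount la mu) (runsMono (st , e)) ≡ ∑ (SYT cellCount la mu) (λ Q → ⟦ compatible prev st e Q ⟧)
    coeff-schurXY = trans (∑-concatMap _ (SSYT cellCount la)) (trans (∑-cong (SSYT cellCount la) (λ F → ∑-map _ (SSYT cellCount mu)))
      (trans (sym (∑-cartesian (SSYT cellCount la) (SSYT cellCount mu)))
        (trans (sym (count-∑ matchesContent (cartesianProduct (SSYT cellCount la) (SSYT cellCount mu))))
        (trans (cong ⁺_ (sym standardization)) (count-∑ (compatible prev st e) (SYT cellCount la mu))))))
      where
      ∑-cartesian : {A B : Set} (xs : List A) (ys : List B) {f : A × B → ℤ} →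
        ∑ (cartesianProduct xs ys) f ≡ ∑ xs (λ x → ∑ ys (λ y → f (x , y)))
      ∑-cartesian [] ys = refl
      ∑-cartesian (x ∷ xs) ys {f} = trans (∑-++ (map (x ,_) ys) _) (cong₂ _+ᶻ_ (∑-map (x ,_) ys {f}) (∑-cartesian xs ys))

-- Cycles of signed permutations

firstReturn : ∀ {n} → SignedPerm n → Fin n → List ℕ → ℕ
firstReturn {n} w i []       = n
firstReturn     w i (k ∷ ks) = if eqℕ (toℕ (proj₁ (iter w k (i , false)))) (toℕ i) then k else firstReturn w i ks

-- As above, the underscore stands for the local function in returnTime.
mutual
  returnTime≡ : ∀ {n} (w : SignedPerm n) i → returnTime w i ≡ firstReturn w i (interval 1 n)
  returnTime≡ {n} w i with interval 1 n
  ... | ks = returnTime-go w i ks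

  returnTime-go : ∀ {n} (w : SignedPerm n) i ks → _ ≡ firstReturn w i ks
  returnTime-go w i []       = refl
  returnTime-go w i (k ∷ ks) = cong (λ z → if eqℕ (toℕ (proj₁ (iter w k (i , false)))) (toℕ i) then k else z) (returnTime-go w i ks)

∈-rangeFrom⁺ : ∀ a m {s} → a < s → s ≤ a + m → s ∈ rangeFrom a m
∈-rangeFrom⁺ a zero p q = ⊥-elim (ℕₚ.<⇒≱ p (ℕₚ.≤-trans q (ℕₚ.≤-reflexive (ℕₚ.+-identityʳ a))))
∈-rangeFrom⁺ a (suc m) p q with ℕₚ.m≤n⇒m<n∨m≡n p
... | inj₁ p' = there (∈-rangeFrom⁺ (suc a) m p' (ℕₚ.≤-trans q (ℕₚ.≤-reflexive (ℕₚ.+-suc a m))))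
... | inj₂ refl = here refl

argmin : ∀ m (f : ℕ → ℕ) → ∃ λ k → k < suc m × (∀ {j} → j < suc m → f k ≤ f j)
argmin zero f = 0 , z<s , λ { {zero} _ → ℕₚ.≤-refl ; {suc j} (s≤s ()) }
argmin (suc m) f with argmin m f
... | k , k< , h with ℕₚ.≤-total (f k) (f (suc m))
... | inj₁ p = k , ℕₚ.m<n⇒m<1+n k< , λ j< → [ (λ q → h q) , (λ { refl → p }) ]′ (ℕₚ.m≤n⇒m<n∨m≡n (ℕₚ.≤-pred j<))
... | inj₂ p = suc m , ℕₚ.≤-refl , λ j< → [ (λ q → ℕₚ.≤-trans p (h q)) , (λ { refl → ℕₚ.≤-refl }) ]′ (ℕₚ.m≤n⇒m<n∨m≡n (ℕₚ.≤-pred j<))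

xor-cancelˡ : ∀ a {b c} → a xor b ≡ a xor c → b ≡ c
xor-cancelˡ true  {true}  {true}  _ = refl
xor-cancelˡ true  {false} {false} _ = refl
xor-cancelˡ false e = e

Unique-⊇-↭ : {A : Set} {xs ys : List A} → Unique xs → Unique ys → (∀ {x} → x ∈ xs → x ∈ ys) → (∀ {x} → x ∈ ys → x ∈ xs) → xs ↭ ys
Unique-⊇-↭ u v s t = Unique-⊆-↭ u s (injective⇒length≤ _≡_ v (λ {y} y∈ → y , t y∈ , refl) (λ _ _ p q → trans p (sym q)))

module Orbits {n : ℕ} (w : SignedPerm n) (injective : ∀ {i j} → Vec.lookup (proj₁ w) i ≡ Vec.lookup (proj₁ w) j → i ≡ j) where

  pow : ℕ → Fin n → Fin n
  pow k i = proj₁ (iter w k (i , false))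

  turn : ℕ → Fin n → Bool
  turn k i = proj₂ (iter w k (i , false))

  iter-+ : ∀ j k x → iter w (j + k) x ≡ iter w j (iter w k x)
  iter-+ zero    k x = refl
  iter-+ (suc j) k x = cong (act w) (iter-+ j k x)

  -- w commutes with the bar, so an initial bar is merely carried along.
  iter-sign : ∀ k i s → iter w k (i , s) ≡ (pow k i , s xor turn k i)
  iter-sign zero i s = cong (i ,_) (sym (Boolₚ.xor-identityʳ s))
  iter-sign (suc k) i s = trans (cong (act w) (iter-sign k i s)) (cong (_ ,_) (Boolₚ.xor-assoc s (turn k i) _))

  pow-+ : ∀ j k i → pow (j + k) i ≡ pow j (pow k i)
  pow-+ j k i = cong proj₁ (trans (iter-+ j k (i , false)) (iter-sign j (pow k i) (turn k i)))

  pow-comm : ∀ j k i → pow j (pow k i) ≡ pow k (pow j i)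
  pow-comm j k i = trans (sym (pow-+ j k i)) (trans (cong (λ z → pow z i) (ℕₚ.+-comm j k)) (pow-+ k j i))

  pow-injective : ∀ k {i j} → pow k i ≡ pow k j → i ≡ j
  pow-injective zero    e = e
  pow-injective (suc k) e = pow-injective k (injective e)

  record Return (i : Fin n) (r : ℕ) : Set where
    field
      positive : 0 < r
      returns  : pow r i ≡ i
      first    : ∀ {k} → 0 < k → k < r → pow k i ≢ i

  open Return

  Return-unique : ∀ {i r r'} → Return i r → Return i r' → r ≡ r'
  Return-unique {r = r} {r'} R R' with ℕₚ.<-cmp r r'
  ... | tri< p _ _ = ⊥-elim (first R' (positive R) p (returns R))
  ... | tri≈ _ e _ = e
  ... | tri> _ _ p = ⊥-elim (first R (positive R') p (returns R'))

  Return-pow : ∀ k {i r} → Return i r → Return (pow k i) r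
  Return-pow k {i} {r} R = record
    { positive = positive R
    ; returns = trans (pow-comm r k i) (cong (pow k) (returns R))
    ; first = λ {j} p q e → first R p q (pow-injective k (trans (pow-comm k j i) e))
    }

  -- Two of the first n + 1 powers agree at i by the pigeonhole principle, and injectivity cancels
  -- the smaller one.
  some-return : ∀ i → ∃ λ k → 0 < k × k ≤ n × pow k i ≡ i
  some-return i with Finₚ.pigeonhole {n} {suc n} ℕₚ.≤-refl (λ k → pow (toℕ k) i)
  ... | j , k , j<k , e = toℕ k ∸ toℕ j , ℕₚ.m<n⇒0<n∸m j<k , ℕₚ.≤-trans (ℕₚ.m∸n≤m (toℕ k) (toℕ j)) (ℕₚ.≤-pred (Finₚ.toℕ<n k)) ,
    pow-injective (toℕ j) (trans (sym (pow-+ (toℕ j) _ i)) (trans (cong (λ z → pow z i) (ℕₚ.m+[n∸m]≡n (ℕₚ.<⇒≤ j<k))) (sym e)))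

  firstReturn-spec : ∀ i a m → (∃ λ k → a < k × k ≤ a + m × pow k i ≡ i) → let r = firstReturn w i (rangeFrom a m) in
    a < r × pow r i ≡ i × (∀ {k} → a < k → k < r → pow k i ≢ i)
  firstReturn-spec i a zero (k , p , q , _) = ⊥-elim (ℕₚ.<⇒≱ p (ℕₚ.≤-trans q (ℕₚ.≤-reflexive (ℕₚ.+-identityʳ a))))
  firstReturn-spec i a (suc m) (k , p , q , e) with eqℕ (toℕ (pow (suc a) i)) (toℕ i) in eq
  ... | true = ℕₚ.≤-refl , Finₚ.toℕ-injective (ℕₚ.≡ᵇ⇒≡ _ _ (≡⇒T eq)) , λ x y → ⊥-elim (ℕₚ.<⇒≱ y x)
  ... | false with firstReturn-spec i (suc a) m (k , later , ℕₚ.≤-trans q (ℕₚ.≤-reflexive (ℕₚ.+-suc a m)) , e)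
    where
    not-now : pow (suc a) i ≢ i
    not-now h = subst T eq (ℕₚ.≡⇒≡ᵇ _ _ (cong toℕ h))
    later : suc a < k
    later = [ id , (λ { refl → ⊥-elim (not-now e) }) ]′ (ℕₚ.m≤n⇒m<n∨m≡n p)
  ... | a<r , ret , fst = ℕₚ.<-trans (ℕₚ.n<1+n a) a<r , ret ,
    λ x y → [ (λ z → fst z y) , (λ { refl h → subst T eq (ℕₚ.≡⇒≡ᵇ _ _ (cong toℕ h)) }) ]′ (ℕₚ.m≤n⇒m<n∨m≡n x)

  period : Fin n → ℕ
  period = returnTime w

  period-Return : ∀ i → Return i (period i)
  period-Return i = subst (Return i) (sym (trans (returnTime≡ w i) (cong (firstReturn w i) (interval≡ 0 n))))
    (record { positive = proj₁ spec ; returns = proj₁ (proj₂ spec) ; first = proj₂ (proj₂ spec) })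
    where
    spec = firstReturn-spec i 0 n (some-return i)

  period-pow : ∀ k i → period (pow k i) ≡ period i
  period-pow k i = Return-unique (period-Return (pow k i)) (Return-pow k (period-Return i))

  -- k steps followed by a full turn are the same as a full turn followed by k steps; the sign
  -- picked up on the k steps cancels.
  negCycle-pow : ∀ k i → negCycle w (pow k i) ≡ negCycle w i
  negCycle-pow k i = trans (cong (λ r → turn r (pow k i)) (period-pow k i)) (xor-cancelˡ (turn k i) signs≡)
    where
    r : ℕ
    r = period i
    there-back : iter w r (pow k i , turn k i) ≡ iter w k (i , turn r i)
    there-back = trans (sym (iter-+ r k (i , false))) (trans (cong (λ z → iter w z (i , false)) (ℕₚ.+-comm r k))
      (trans (iter-+ k r (i , false)) (cong (λ z → iter w k (z , turn r i)) (returns (period-Return i)))))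
    signs≡ : turn k i xor turn r (pow k i) ≡ turn k i xor turn r i
    signs≡ = trans (cong proj₂ (sym (iter-sign r (pow k i) (turn k i)))) (trans (cong proj₂ there-back)
      (trans (cong proj₂ (iter-sign k i (turn r i))) (Boolₚ.xor-comm (turn r i) (turn k i))))

  reduce : ∀ k i → ∃ λ j → j < period i × pow k i ≡ pow j i
  reduce zero i = 0 , positive (period-Return i) , refl
  reduce (suc k) i with reduce k i
  ... | j , j< , e with ℕₚ.m≤n⇒m<n∨m≡n j<
  ... | inj₁ p = suc j , p , cong (Vec.lookup (proj₁ w)) e
  ... | inj₂ p = 0 , positive (period-Return i) , trans (cong (Vec.lookup (proj₁ w)) e)
    (trans (cong (λ z → pow z i) p) (returns (period-Return i)))

  pow-distinct : ∀ {j k} i → j < k → k < period i → pow j i ≢ pow k i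
  pow-distinct {j} {k} i j<k k< e = first (period-Return i) (ℕₚ.m<n⇒0<n∸m j<k) (ℕₚ.≤-<-trans (ℕₚ.m∸n≤m k j) k<)
    (pow-injective j (trans (sym (pow-+ j (k ∸ j) i)) (trans (cong (λ z → pow z i) (ℕₚ.m+[n∸m]≡n (ℕₚ.<⇒≤ j<k))) (sym e))))

  pow-back : ∀ k i → ∃ λ j → pow j (pow k i) ≡ i
  pow-back k i with reduce k i
  ... | j , j< , e = period i ∸ j , trans (cong (pow (period i ∸ j)) e) (trans (sym (pow-+ (period i ∸ j) j i))
    (trans (cong (λ z → pow z i) (ℕₚ.m∸n+n≡m (ℕₚ.<⇒≤ j<))) (returns (period-Return i))))

  isRep⁻ : ∀ {i} → T (isRep w i) → ∀ {k} → 0 < k → k < period i → toℕ i < toℕ (pow k i)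
  isRep⁻ {i} h {k} p q = ℕₚ.<ᵇ⇒< _ _ (all-T⁻ h (subst (k ∈_) (sym (interval≡ 0 (period i ∸ 1)))
    (∈-rangeFrom⁺ 0 (period i ∸ 1) p (ℕₚ.<⇒≤pred q))))

  isRep⁺ : ∀ {i} → (∀ {k} → 0 < k → k < period i → toℕ i < toℕ (pow k i)) → T (isRep w i)
  isRep⁺ {i} h = all-T⁺ (λ {k} k∈ → ℕₚ.<⇒<ᵇ (bounds (∈-rangeFrom 0 (period i ∸ 1) (subst (k ∈_) (interval≡ 0 (period i ∸ 1)) k∈))))
    where
    bounds : ∀ {k} → 0 < k × k ≤ period i ∸ 1 → toℕ i < toℕ (pow k i)
    bounds (p , q) = h p (ℕₚ.≤-<-trans q (ℕₚ.∸-monoʳ-< {period i} z<s (positive (period-Return i))))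

  -- The representative is the least point of the cycle. It is strictly smaller than the others
  -- because no earlier power returns to it.
  rep-exists : ∀ i → ∃ λ r → T (isRep w r) × ∃ λ k → k < period r × pow k r ≡ i
  rep-exists i with argmin (period i ∸ 1) (λ k → toℕ (pow k i))
  ... | k , _ , least = pow k i , isRep⁺ minimal , back
    where
    1+pred : suc (period i ∸ 1) ≡ period i
    1+pred = ℕₚ.m+[n∸m]≡n (positive (period-Return i))
    minimal : ∀ {j} → 0 < j → j < period (pow k i) → toℕ (pow k i) < toℕ (pow j (pow k i))
    minimal {j} p q with reduce (j + k) i
    ... | m , m< , e = ℕₚ.≤∧≢⇒< (ℕₚ.≤-trans (least (ℕₚ.≤-trans m< (ℕₚ.≤-reflexive (sym 1+pred))))
      (ℕₚ.≤-reflexive (cong toℕ (trans (sym e) (pow-+ j k i)))))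
      (λ h → first (period-Return (pow k i)) p q (sym (Finₚ.toℕ-injective h)))
    back : ∃ λ j → j < period (pow k i) × pow j (pow k i) ≡ i
    back with pow-back k i
    ... | j , e with reduce j (pow k i)
    ... | m , m< , e' = m , m< , trans (sym e') e

  -- Two different representatives on one cycle would each be smaller than the other.
  rep-unique : ∀ {r r'} → T (isRep w r) → T (isRep w r') → ∀ k → pow k r ≡ r' → r ≡ r'
  rep-unique {r} {r'} h h' k e with reduce k r
  ... | zero , _ , e' = trans (sym e') e
  ... | suc j , j< , e' = ⊥-elim (ℕₚ.<-asym (subst (λ z → toℕ r < toℕ z) fwd (isRep⁻ h z<s j<))
    (subst (λ z → toℕ r' < toℕ z) bwd (isRep⁻ h' (ℕₚ.m<n⇒0<n∸m j<) bound)))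
    where
    fwd : pow (suc j) r ≡ r'
    fwd = trans (sym e') e
    bwd : pow (period r ∸ suc j) r' ≡ r
    bwd = trans (cong (pow (period r ∸ suc j)) (sym fwd)) (trans (sym (pow-+ (period r ∸ suc j) (suc j) r))
      (trans (cong (λ z → pow z r) (ℕₚ.m∸n+n≡m (ℕₚ.<⇒≤ j<))) (returns (period-Return r))))
    bound : period r ∸ suc j < period r'
    bound = subst (period r ∸ suc j <_) (trans (sym (period-pow (suc j) r)) (cong period fwd)) (ℕₚ.∸-monoʳ-< {period r} z<s (ℕₚ.<⇒≤ j<))

  reps : List (Fin n)
  reps = filterᵇ (isRep w) (allFinL n)

  reps-Unique : Unique reps
  reps-Unique = Uniqueₚ.filter⁺ (T? ∘ isRep w) (allFinL-Unique n)

  orbit : Fin n → List (Fin n)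
  orbit r = map (λ k → pow k r) (upTo (period r))

  orbit-Unique : ∀ r → Unique (orbit r)
  orbit-Unique r = subst Unique (sym (Listₚ.map-applyUpTo id (λ k → pow k r) (period r)))
    (Uniqueₚ.applyUpTo⁺₁ (λ k → pow k r) (period r) (λ p q → pow-distinct r p q))

  orbits-↭ : concatMap orbit reps ↭ allFinL n
  orbits-↭ = Unique-⊇-↭ (Uniqueₚ.concat⁺ (Allₚ.map⁺ (All.tabulate (λ {r} _ → orbit-Unique r)))
      (AllPairsₚ.map⁺ (AllPairs.map (λ {r} {r'} (r≢r' , r∈ , r'∈) {x} → disjoint r≢r' r∈ r'∈ {x}) (AllPairs-∈ reps-Unique))))
    (allFinL-Unique n) (λ {x} _ → ∈-allFinL x) covers
    where
    disjoint : ∀ {r r'} → r ≢ r' → r ∈ reps → r' ∈ reps → ∀ {x} → ¬ (x ∈ orbit r × x ∈ orbit r')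
    disjoint {r} {r'} r≢r' r∈ r'∈ (m , m') with ∈-map⁻ (λ k → pow k r) m | ∈-map⁻ (λ k → pow k r') m'
    ... | k , _ , refl | k' , _ , e with pow-back k' r'
    ... | j , e' = r≢r' (rep-unique (proj₂ (∈-filterᵇ⁻ (allFinL n) r∈)) (proj₂ (∈-filterᵇ⁻ (allFinL n) r'∈)) (j + k)
      (trans (pow-+ j k r) (trans (cong (pow j) e) e')))
    covers : ∀ {x} → x ∈ allFinL n → x ∈ concatMap orbit reps
    covers {x} _ with rep-exists x
    ... | r , h , k , k< , refl = ∈-concatMap⁺ orbit (lose (∈-filterᵇ⁺ (∈-allFinL r) h) (∈-map⁺ (λ k → pow k r) (∈-upTo⁺ k<)))

  ∑-orbits : ∀ (G : Fin n → ℤ) → (∀ k r → G (pow k r) ≡ G r) → ∑ (allFinL n) G ≡ ∑ reps (λ r → ⁺ period r *ᶻ G r)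
  ∑-orbits G h = trans (sym (∑-↭ orbits-↭)) (trans (∑-concatMap orbit reps) (∑-cong reps (λ r →
    trans (∑-map (λ k → pow k r) (upTo (period r))) (trans (∑-cong (upTo (period r)) (λ k → trans (h k r) (sym (ℤₚ.*-identityˡ (G r)))))
      (trans (∑-*ʳ (upTo (period r)) (G r) {λ _ → 1ℤ}) (cong (_*ᶻ G r)
        (trans (sym (length-∑ (upTo (period r)))) (cong ⁺_ (Listₚ.length-upTo (period r))))))))))

bools-Unique : Unique bools
bools-Unique = ((λ ()) ∷ []) ∷ [] ∷ []

∈-bools : ∀ b → b ∈ bools
∈-bools true = here refl
∈-bools false = there (here refl)

-- Lists of points that spell the cycles

Point : ℕ → Set
Point n = Fin n × Bool

points : ∀ n → List (Point n)
points n = cartesianProduct (allFinL n) bools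

∈-points : ∀ {n} (x : Point n) → x ∈ points n
∈-points (i , s) = ∈-cartesianProduct⁺ (∈-allFinL i) (∈-bools s)

points-Unique : ∀ n → Unique (points n)
points-Unique n = Uniqueₚ.cartesianProduct⁺ (allFinL-Unique n) bools-Unique

∑-points : ∀ n (G : Fin n → ℤ) → ∑ (points n) (G ∘ proj₁) ≡ ⁺ 2 *ᶻ ∑ (allFinL n) G
∑-points n G = lemma (allFinL n)
  where
  twice : ∀ a b → a +ᶻ (a +ᶻ ⁺ 2 *ᶻ b) ≡ ⁺ 2 *ᶻ (a +ᶻ b)
  twice = ℤ-Solver.solve-∀
  lemma : ∀ xs → ∑ (cartesianProduct xs bools) (G ∘ proj₁) ≡ ⁺ 2 *ᶻ ∑ xs G
  lemma []       = refl
  lemma (x ∷ xs) = trans (cong (λ z → G x +ᶻ (G x +ᶻ z)) (lemma xs)) (twice (G x) (∑ xs G))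

elem : ∀ {n} → Fin n → List (Fin n) → Bool
elem i = any (λ j → eqℕ (toℕ i) (toℕ j))

elem⁻ : ∀ {n} {i : Fin n} xs → T (elem i xs) → i ∈ xs
elem⁻ {i = i} (x ∷ xs) t with Equivalence.to (T-∨ {eqℕ (toℕ i) (toℕ x)}) t
... | inj₁ p = here (Finₚ.toℕ-injective (ℕₚ.≡ᵇ⇒≡ _ _ p))
... | inj₂ p = there (elem⁻ xs p)

elem⁺ : ∀ {n} {i : Fin n} {xs} → i ∈ xs → T (elem i xs)
elem⁺ {i = i} (here refl) = Equivalence.from (T-∨ {eqℕ (toℕ i) (toℕ i)}) (inj₁ (ℕₚ.≡⇒≡ᵇ (toℕ i) _ refl))
elem⁺ {i = i} {x ∷ xs} (there m) = Equivalence.from (T-∨ {eqℕ (toℕ i) (toℕ x)}) (inj₂ (elem⁺ m))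

not-∨ : ∀ a b → not (a ∨ b) ≡ not a ∧ not b
not-∨ true  b = refl
not-∨ false b = refl

elem-cong : ∀ {n} (i j : Fin n) xs ys → (i ∈ xs → j ∈ ys) → (j ∈ ys → i ∈ xs) → elem i xs ≡ elem j ys
elem-cong i j xs ys f g = T-ext (λ t → elem⁺ {i = j} {ys} (f (elem⁻ xs t))) (λ t → elem⁺ {i = i} {xs} (g (elem⁻ ys t)))

elem-++ : ∀ {n} (i : Fin n) xs ys → elem i (xs ++ ys) ≡ elem i xs ∨ elem i ys
elem-++ i []       ys = refl
elem-++ i (x ∷ xs) ys = trans (cong (eqℕ (toℕ i) (toℕ x) ∨_) (elem-++ i xs ys)) (sym (Boolₚ.∨-assoc (eqℕ (toℕ i) (toℕ x)) _ _))

eqPoint : ∀ {n} → Point n → Point n → Bool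
eqPoint (i , s) (j , t) = eqℕ (toℕ i) (toℕ j) ∧ eqBool s t

eqPoint⁻ : ∀ {n} {x y : Point n} → T (eqPoint x y) → x ≡ y
eqPoint⁻ {x = i , s} {j , t} h with ∧⁻ {eqℕ (toℕ i) (toℕ j)} h
... | p , q = cong₂ _,_ (Finₚ.toℕ-injective (ℕₚ.≡ᵇ⇒≡ _ _ p)) (eqBool⇒≡ q)

eqPoint⁺ : ∀ {n} {x y : Point n} → x ≡ y → T (eqPoint x y)
eqPoint⁺ {x = i , s} refl = ∧⁺ (ℕₚ.≡⇒≡ᵇ (toℕ i) _ refl) (eqBool-refl s)

∑-eqPoint : ∀ {n} (x : Point n) (H : Point n → ℤ) → ∑ (points n) (λ y → ⟦ eqPoint x y ⟧ *ᶻ H y) ≡ H x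
∑-eqPoint {n} x H = trans (∑-single (points-Unique n) (∈-points x) (λ {y} _ y≢x →
    cong (λ z → ⟦ z ⟧ *ᶻ H y) (¬T⇒≡ (λ t → y≢x (sym (eqPoint⁻ {x = x} {y} t))))))
  (trans (cong (λ z → ⟦ z ⟧ *ᶻ H x) (T⇒≡ (eqPoint⁺ {x = x} refl))) (ℤₚ.*-identityˡ (H x)))

-- Bars are ignored when comparing points, so a fresh list of length n is a signed arrangement of
-- all points. The accumulator carries the points already visited.
fresh : ∀ {n} → List (Fin n) → List (Point n) → Bool
fresh used []      = true
fresh used (x ∷ u) = not (elem (proj₁ x) used) ∧ fresh (proj₁ x ∷ used) u

mark : ∀ {n} → List (Fin n) → List (Point n) → List (Fin n)
mark used []      = used
mark used (x ∷ u) = mark (proj₁ x ∷ used) u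

fresh-++ : ∀ {n} (used : List (Fin n)) u v → fresh used (u ++ v) ≡ fresh used u ∧ fresh (mark used u) v
fresh-++ used []      v = refl
fresh-++ used (x ∷ u) v = trans (cong (not (elem (proj₁ x) used) ∧_) (fresh-++ (proj₁ x ∷ used) u v))
  (sym (Boolₚ.∧-assoc (not (elem (proj₁ x) used)) _ _))

mark-↭ : ∀ {n} (used : List (Fin n)) u → mark used u ↭ map proj₁ u ++ used
mark-↭ used []      = ↭-refl
mark-↭ used (x ∷ u) = ↭-trans (mark-↭ (proj₁ x ∷ used) u) (Permₚ.shift (proj₁ x) (map proj₁ u) used)

fresh⁻ : ∀ {n} (used : List (Fin n)) u → T (fresh used u) → ∀ {y} → y ∈ u → proj₁ y ∉ used
fresh⁻ used (x ∷ u) t (here refl) m = T-not⁻ (proj₁ (∧⁻ {not (elem (proj₁ x) used)} t)) (elem⁺ m)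
fresh⁻ used (x ∷ u) t (there y∈) m = fresh⁻ (proj₁ x ∷ used) u (proj₂ (∧⁻ {not (elem (proj₁ x) used)} t)) y∈ (there m)

fresh⁺ : ∀ {n} (used : List (Fin n)) u → (∀ {i} → i ∈ map proj₁ u → i ∉ used) → Unique (map proj₁ u) → T (fresh used u)
fresh⁺ used [] d U = tt
fresh⁺ used (x ∷ u) d (x∉ ∷ U) = ∧⁺ (T-not⁺ (d (here refl) ∘ elem⁻ used))
  (fresh⁺ (proj₁ x ∷ used) u (λ { i∈ (here refl) → All.lookup x∉ i∈ refl ; i∈ (there m) → d (there i∈) m }) U)

flip : ∀ {n} → Bool → Point n → Point n
flip b (i , s) = (i , s xor b)

chain : ∀ {n} → SignedPerm n → Point n → Point n → List (Point n) → Bool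
chain w t y []       = eqPoint (act w y) t
chain w t y (z ∷ zs) = eqPoint (act w y) z ∧ chain w t z zs

-- u spells the cycles of w, block by block: then u conjugates the standard element of cycle type γ to w.
spells : ∀ {n} → SignedPerm n → List Part → List (Point n) → Bool
spells w []                u       = true
spells w ((zero , b) ∷ γ)  u       = spells w γ u
spells w ((suc k , b) ∷ γ) []      = false
spells w ((suc k , b) ∷ γ) (x ∷ u) = chain w (flip b x) x (take k u) ∧ spells w γ (drop k u)

path : ∀ {n} → SignedPerm n → ℕ → Point n → List (Point n)
path w zero    y = []
path w (suc k) y = act w y ∷ path w k (act w y)

iter-act : ∀ {n} (w : SignedPerm n) k y → iter w k (act w y) ≡ iter w (suc k) y
iter-act w zero    y = refl
iter-act w (suc k) y = cong (act w) (iter-act w k y)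

-- In a chain every point is forced by its predecessor, so only `path` can contribute, and it does
-- if it closes up at t.
∑-chain : ∀ {n} (w : SignedPerm n) t k y (H : List (Point n) → ℤ) →
  ∑ (allLists k (points n)) (λ u → ⟦ chain w t y u ⟧ *ᶻ H u) ≡ ⟦ eqPoint (iter w (suc k) y) t ⟧ *ᶻ H (path w k y)
∑-chain w t zero y H = ℤₚ.+-identityʳ _
∑-chain {n} w t (suc k) y H = begin
  ∑ (allLists (suc k) (points n)) (λ u → ⟦ chain w t y u ⟧ *ᶻ H u)
    ≡⟨ ∑-allLists-suc k (points n) ⟩
  ∑ (points n) (λ z → ∑ (allLists k (points n)) (λ u → ⟦ eqPoint (act w y) z ∧ chain w t z u ⟧ *ᶻ H (z ∷ u)))
    ≡⟨ ∑-cong (points n) (λ z → trans (∑-cong (allLists k (points n))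
      (λ u → trans (cong (_*ᶻ H (z ∷ u)) (⟦∧⟧ (eqPoint (act w y) z) (chain w t z u)))
         (ℤₚ.*-assoc ⟦ eqPoint (act w y) z ⟧ ⟦ chain w t z u ⟧ (H (z ∷ u))))) (∑-*ˡ (allLists k (points n)) ⟦ eqPoint (act w y) z ⟧)) ⟩
  ∑ (points n) (λ z → ⟦ eqPoint (act w y) z ⟧ *ᶻ ∑ (allLists k (points n)) (λ u → ⟦ chain w t z u ⟧ *ᶻ H (z ∷ u)))
    ≡⟨ ∑-eqPoint (act w y) (λ z → ∑ (allLists k (points n)) (λ u → ⟦ chain w t z u ⟧ *ᶻ H (z ∷ u))) ⟩
  ∑ (allLists k (points n)) (λ u → ⟦ chain w t (act w y) u ⟧ *ᶻ H (act w y ∷ u))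
    ≡⟨ ∑-chain w t k (act w y) (λ u → H (act w y ∷ u)) ⟩
  ⟦ eqPoint (iter w (suc k) (act w y)) t ⟧ *ᶻ H (act w y ∷ path w k (act w y))
    ≡⟨ cong (λ z → ⟦ eqPoint z t ⟧ *ᶻ H (act w y ∷ path w k (act w y))) (iter-act w (suc k) y) ⟩
  ⟦ eqPoint (iter w (suc (suc k)) y) t ⟧ *ᶻ H (path w (suc k) y) ∎
  where
  open ≡-Reasoning

spellings : ∀ {n} → SignedPerm n → List Part → List (Fin n) → ℤ
spellings {n} w γ used = ∑ (allLists (total γ) (points n)) (λ u → ⟦ fresh used u ∧ spells w γ u ⟧)

take-++ : {A : Set} (xs ys : List A) → take (length xs) (xs ++ ys) ≡ xs
take-++ []       ys = refl
take-++ (x ∷ xs) ys = cong (x ∷_) (take-++ xs ys)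

drop-++ : {A : Set} (xs ys : List A) → drop (length xs) (xs ++ ys) ≡ ys
drop-++ []       ys = refl
drop-++ (x ∷ xs) ys = drop-++ xs ys

-- The first block is determined by its first point x; the other blocks are spelled on points
-- outside it.
spellings-∷ : ∀ {n} (w : SignedPerm n) k b γ used → spellings w ((suc k , b) ∷ γ) used ≡
  ∑ (points n) (λ x → ⟦ eqPoint (iter w (suc k) x) (flip b x) ⟧ *ᶻ
    (⟦ fresh used (x ∷ path w k x) ⟧ *ᶻ spellings w γ (mark used (x ∷ path w k x))))
spellings-∷ {n} w k b γ used = trans (∑-allLists-suc (k + total γ) (points n)) (∑-cong (points n) (λ x →
  trans (∑-allLists-+ k (total γ) (points n))
  (trans (∑-cong∈ (allLists k (points n)) (λ {u} u∈ → trans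
    (∑-cong (allLists (total γ) (points n)) (λ v → term x u v (proj₁ (∈-allLists⁻ k u∈))))
    (trans (∑-*ˡ (allLists (total γ) (points n)) (⟦ chain w (flip b x) x u ⟧ *ᶻ ⟦ fresh used (x ∷ u) ⟧))
      (ℤₚ.*-assoc ⟦ chain w (flip b x) x u ⟧ ⟦ fresh used (x ∷ u) ⟧ (spellings w γ (mark used (x ∷ u)))))))
  (∑-chain w (flip b x) k x (λ u → ⟦ fresh used (x ∷ u) ⟧ *ᶻ spellings w γ (mark used (x ∷ u)))))))
  where
  rearrange : ∀ f g c s → (f *ᶻ g) *ᶻ (c *ᶻ s) ≡ (c *ᶻ f) *ᶻ (g *ᶻ s)
  rearrange = ℤ-Solver.solve-∀
  term : ∀ x u v → length u ≡ k → ⟦ fresh used (x ∷ (u ++ v)) ∧ (chain w (flip b x) x (take k (u ++ v)) ∧ spells w γ (drop k (u ++ v))) ⟧ ≡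
    (⟦ chain w (flip b x) x u ⟧ *ᶻ ⟦ fresh used (x ∷ u) ⟧) *ᶻ ⟦ fresh (mark used (x ∷ u)) v ∧ spells w γ v ⟧
  term x u v refl rewrite take-++ u v | drop-++ u v = trans (⟦∧⟧ (fresh used (x ∷ (u ++ v))) _) (trans
    (cong₂ _*ᶻ_ (trans (cong ⟦_⟧ (fresh-++ used (x ∷ u) v)) (⟦∧⟧ (fresh used (x ∷ u)) _)) (⟦∧⟧ (chain w (flip b x) x u) _))
    (trans (rearrange ⟦ fresh used (x ∷ u) ⟧ ⟦ fresh (mark used (x ∷ u)) v ⟧ ⟦ chain w (flip b x) x u ⟧ ⟦ spells w γ v ⟧)
      (cong ((⟦ chain w (flip b x) x u ⟧ *ᶻ ⟦ fresh used (x ∷ u) ⟧) *ᶻ_) (sym (⟦∧⟧ (fresh (mark used (x ∷ u)) v) _)))))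

picks-map : {A B : Set} (f : A → B) (xs : List A) → picks (map f xs) ≡ map (λ (x , ys) → (f x , map f ys)) (picks xs)
picks-map f [] = refl
picks-map f (x ∷ xs) = cong ((f x , map f xs) ∷_) (trans (cong (map _) (picks-map f xs))
  (trans (sym (Listₚ.map-∘ (picks xs))) (Listₚ.map-∘ (picks xs))))

distinctFrom : ∀ {n} → Fin n → Fin n → Bool
distinctFrom r i = not (eqℕ (toℕ i) (toℕ r))

distinctFrom⁺ : ∀ {n} {r i : Fin n} → i ≢ r → distinctFrom r i ≡ true
distinctFrom⁺ h = T⇒≡ (T-not⁺ (λ t → h (Finₚ.toℕ-injective (ℕₚ.≡ᵇ⇒≡ _ _ t))))

filterᵇ-cong∈ : {A : Set} {p q : A → Bool} → ∀ xs → (∀ {x} → x ∈ xs → p x ≡ q x) → filterᵇ p xs ≡ filterᵇ q xs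
filterᵇ-cong∈ [] h = refl
filterᵇ-cong∈ {p = p} {q} (x ∷ xs) h with p x | q x | h (here refl)
... | true | .true | refl = cong (x ∷_) (filterᵇ-cong∈ xs (h ∘ there))
... | false | .false | refl = filterᵇ-cong∈ xs (h ∘ there)

filterᵇ-all : {A : Set} {p : A → Bool} → ∀ xs → (∀ {x} → x ∈ xs → p x ≡ true) → filterᵇ p xs ≡ xs
filterᵇ-all [] h = refl
filterᵇ-all {p = p} (x ∷ xs) h with p x | h (here refl)
... | true | _ = cong (x ∷_) (filterᵇ-all xs (h ∘ there))

filterᵇ-none : {A : Set} {p : A → Bool} → ∀ xs → (∀ {x} → x ∈ xs → p x ≡ false) → filterᵇ p xs ≡ []
filterᵇ-none [] h = refl
filterᵇ-none {p = p} (x ∷ xs) h with p x | h (here refl)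
... | false | _ = filterᵇ-none xs (h ∘ there)

∑-picks : ∀ {n} {xs : List (Fin n)} → Unique xs → (H : Fin n → List (Fin n) → ℤ) →
  ∑ (picks xs) (λ (r , ys) → H r ys) ≡ ∑ xs (λ r → H r (filterᵇ (distinctFrom r) xs))
∑-picks [] H = refl
∑-picks {xs = x ∷ xs} (x∉ ∷ U) H = cong₂ _+ᶻ_ (cong (H x) (sym self)) (trans (∑-map _ (picks xs))
  (trans (∑-picks U (λ r ys → H r (x ∷ ys))) (∑-cong∈ xs (λ {r} r∈ → cong (H r) (sym (other r∈))))))
  where
  self : filterᵇ (distinctFrom x) (x ∷ xs) ≡ xs
  self rewrite eqℕ-refl (toℕ x) = filterᵇ-all xs (λ {y} y∈ → distinctFrom⁺ {r = x} {y} (λ { refl → All.lookup x∉ y∈ refl }))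
  other : ∀ {r} → r ∈ xs → filterᵇ (distinctFrom r) (x ∷ xs) ≡ x ∷ filterᵇ (distinctFrom r) xs
  other {r} r∈ rewrite distinctFrom⁺ {r = r} {x} (λ { refl → All.lookup x∉ r∈ refl }) = refl

module _ {n : ℕ} (w : SignedPerm n) (injective : ∀ {i j} → Vec.lookup (proj₁ w) i ≡ Vec.lookup (proj₁ w) j → i ≡ j) where
  open Orbits w injective

  cycleType : Fin n → Part
  cycleType i = (returnTime w i , negCycle w i)

  hasType : Part → Fin n → Bool
  hasType (k , b) i = (period i ≡ᵇ k) ∧ eqBool (negCycle w i) b

  Closed : List (Fin n) → Set
  Closed used = ∀ {i} → i ∈ used → pow 1 i ∈ used

  Closed-pow : ∀ {used} → Closed used → ∀ k {i} → i ∈ used → pow k i ∈ used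
  Closed-pow c zero    m = m
  Closed-pow c (suc k) m = c (Closed-pow c k m)

  -- Cycles are finite, so going on from `pow k i` leads back to i: a closed set is a union of
  -- cycles.
  Closed-pow⁻ : ∀ {used} → Closed used → ∀ k {i} → pow k i ∈ used → i ∈ used
  Closed-pow⁻ {used} c k {i} m with pow-back k i
  ... | j , e = subst (_∈ used) e (Closed-pow c j m)

  ∈-orbit : ∀ k i → pow k i ∈ orbit i
  ∈-orbit k i with reduce k i
  ... | j , j< , e = subst (_∈ orbit i) (sym e) (∈-map⁺ (λ j → pow j i) (∈-upTo⁺ j<))

  orbit⁻ : ∀ {j i} → j ∈ orbit i → ∃ λ k → j ≡ pow k i
  orbit⁻ m with ∈-map⁻ _ m
  ... | k , _ , e = k , e

  path-points : ∀ k i s → map proj₁ ((i , s) ∷ path w k (i , s)) ≡ map (λ j → pow j i) (upTo (suc k))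
  path-points k i s = trans (lemma k 0 (i , s)) (sym (Listₚ.map-applyUpTo id (λ j → pow j i) (suc k)))
    where
    lemma : ∀ k a x → map proj₁ (iter w a x ∷ path w k (iter w a x)) ≡ applyUpTo (λ j → pow (a + j) (proj₁ x)) (suc k)
    lemma zero    a x = cong (_∷ []) (trans (cong proj₁ (iter-sign a (proj₁ x) (proj₂ x)))
      (cong (λ z → pow z (proj₁ x)) (sym (ℕₚ.+-identityʳ a))))
    lemma (suc k) a x = cong₂ _∷_ (trans (cong proj₁ (iter-sign a (proj₁ x) (proj₂ x)))
      (cong (λ z → pow z (proj₁ x)) (sym (ℕₚ.+-identityʳ a))))
      (trans (lemma k (suc a) x) (applyUpTo-cong (suc k) (λ j → cong (λ z → pow z (proj₁ x)) (sym (ℕₚ.+-suc a j)))))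
      where
      applyUpTo-cong : ∀ m {f g : ℕ → Fin n} → (∀ j → f j ≡ g j) → applyUpTo f m ≡ applyUpTo g m
      applyUpTo-cong zero h = refl
      applyUpTo-cong (suc m) h = cong₂ _∷_ (h 0) (applyUpTo-cong m (h ∘ suc))

  ∈-path : ∀ k j x → 0 < j → j ≤ k → iter w j x ∈ path w k x
  ∈-path (suc k) (suc zero) x p q = here refl
  ∈-path (suc k) (suc (suc j)) x p (s≤s q) = there (subst (_∈ path w k (act w x)) (iter-act w (suc j) x) (∈-path k (suc j) (act w x) z<s q))

  orbit-points : ∀ k i s → period i ≡ suc k → map proj₁ ((i , s) ∷ path w k (i , s)) ≡ orbit i
  orbit-points k i s e = trans (path-points k i s) (cong (λ z → map (λ j → pow j i) (upTo z)) (sym e))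

  fresh-orbit : ∀ {used} → Closed used → ∀ k b i s →
    eqPoint (iter w (suc k) (i , s)) (flip b (i , s)) ∧ fresh used ((i , s) ∷ path w k (i , s)) ≡ hasType (suc k , b) i ∧ not (elem i used)
  fresh-orbit {used} c k b i s = T-ext to from
    where
    x : Point n
    x = (i , s)
    to : T (eqPoint (iter w (suc k) x) (flip b x) ∧ fresh used (x ∷ path w k x)) → T (hasType (suc k , b) i ∧ not (elem i used))
    to t with ∧⁻ {eqPoint (iter w (suc k) x) (flip b x)} t
    ... | p , q with trans (sym (iter-sign (suc k) i s)) (eqPoint⁻ {x = iter w (suc k) x} p)
    ... | e = ∧⁺ (∧⁺ (ℕₚ.≡⇒≡ᵇ (period i) (suc k) r≡) (≡⇒eqBool (trans (cong (λ r → turn r i) r≡) (xor-cancelˡ s (cong proj₂ e)))))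
        (T-not⁺ (fresh⁻ used (x ∷ path w k x) q (here refl) ∘ elem⁻ used))
      where
      no-earlier : ∀ {j} → 0 < j → j < suc k → pow j i ≢ i
      no-earlier {j} 0<j j<k h = fresh⁻ (i ∷ used) (path w k x) (proj₂ (∧⁻ {not (elem i used)} q)) (∈-path k j x 0<j (ℕₚ.≤-pred j<k))
        (here (trans (cong proj₁ (iter-sign j i s)) h))
      r≡ : period i ≡ suc k
      r≡ = Return-unique (period-Return i) (record { positive = z<s ; returns = cong proj₁ e ; first = no-earlier })
    from : T (hasType (suc k , b) i ∧ not (elem i used)) → T (eqPoint (iter w (suc k) x) (flip b x) ∧ fresh used (x ∷ path w k x))
    from t with ∧⁻ {hasType (suc k , b) i} t
    ... | t₁ , t₂ with ∧⁻ {period i ≡ᵇ suc k} t₁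
    ... | t₃ , t₄ with ℕₚ.≡ᵇ⇒≡ (period i) (suc k) t₃
    ... | r≡ = ∧⁺ (eqPoint⁺ {x = iter w (suc k) x} (trans (iter-sign (suc k) i s)
      (cong₂ _,_ (trans (cong (λ z → pow z i) (sym r≡)) (Return.returns (period-Return i)))
          (cong (s xor_) (trans (cong (λ z → turn z i) (sym r≡)) (eqBool⇒≡ t₄))))))
        (fresh⁺ used (x ∷ path w k x) disjoint (subst Unique (sym (orbit-points k i s r≡)) (orbit-Unique i)))
      where
      disjoint : ∀ {j} → j ∈ map proj₁ (x ∷ path w k x) → j ∉ used
      disjoint {j'} j∈ m with orbit⁻ {j'} {i} (subst (j' ∈_) (orbit-points k i s r≡) j∈)
      ... | j , refl = T-not⁻ t₂ (elem⁺ (Closed-pow⁻ c j m))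

  types : List (Fin n) → List Part
  types used = map cycleType (filterᵇ (λ r → not (elem r used)) reps)

  spellings≡matchings : ∀ γ used → All Positive γ → Closed used → Unique used → length used + total γ ≡ n →
    spellings w γ used ≡ matchings γ (types used)
  -- With no parts left `used` contains n distinct points, hence every representative.
  spellings≡matchings [] used _ c U l = sym (cong (matchings [] ∘ map cycleType)
    (filterᵇ-none reps (λ {r} _ → cong not (T⇒≡ (elem⁺ (Unique-full U (trans (sym (ℕₚ.+-identityʳ _)) l) r))))))
  spellings≡matchings ((suc k , b) ∷ γ) used (_ ∷ pos) c U l = begin
    spellings w ((suc k , b) ∷ γ) used
      ≡⟨ spellings-∷ w k b γ used ⟩
    ∑ (points n) (λ x → ⟦ eqPoint (iter w (suc k) x) (flip b x) ⟧ *ᶻ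
      (⟦ fresh used (x ∷ path w k x) ⟧ *ᶻ spellings w γ (mark used (x ∷ path w k x))))
      ≡⟨ ∑-cong (points n) (λ (i , s) → inner i s) ⟩
    ∑ (points n) (λ x → G (proj₁ x))
      ≡⟨ ∑-points n G ⟩
    ⁺ 2 *ᶻ ∑ (allFinL n) G
      ≡⟨ cong (⁺ 2 *ᶻ_) (∑-orbits G G-pow) ⟩
    ⁺ 2 *ᶻ ∑ reps (λ r → ⁺ period r *ᶻ G r)
      ≡⟨ sym (∑-*ˡ reps (⁺ 2)) ⟩
    ∑ reps (λ r → ⁺ 2 *ᶻ (⁺ period r *ᶻ G r))
      ≡⟨ ∑-cong∈ reps (λ {r} r∈ → term r r∈) ⟩
    ∑ reps (λ r → ⟦ not (elem r used) ⟧ *ᶻ (typeWeight (suc k , b) (cycleType r) *ᶻ matchings γ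
      (map cycleType (filterᵇ (distinctFrom r) xs))))
      ≡⟨ sym (∑-filter (λ r → not (elem r used)) reps) ⟩
    ∑ xs (λ r → typeWeight (suc k , b) (cycleType r) *ᶻ matchings γ (map cycleType (filterᵇ (distinctFrom r) xs)))
      ≡⟨ sym (∑-picks (Uniqueₚ.filter⁺ (T? ∘ (λ r → not (elem r used))) reps-Unique)
        (λ r ys → typeWeight (suc k , b) (cycleType r) *ᶻ matchings γ (map cycleType ys))) ⟩
    ∑ (picks xs) (λ (r , ys) → typeWeight (suc k , b) (cycleType r) *ᶻ matchings γ (map cycleType ys))
      ≡⟨ sym (trans (cong (λ z → ∑ z (λ (a , δ') → typeWeight (suc k , b) a *ᶻ matchings γ δ')) (picks-map cycleType xs))
        (∑-map _ (picks xs))) ⟩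
    matchings ((suc k , b) ∷ γ) (types used) ∎
    where
    open ≡-Reasoning
    xs : List (Fin n)
    xs = filterᵇ (λ r → not (elem r used)) reps
    remaining : Fin n → Fin n → Bool
    remaining i r = not (elem r used) ∧ not (elem r (orbit i))
    G : Fin n → ℤ
    G i = ⟦ hasType (suc k , b) i ∧ not (elem i used) ⟧ *ᶻ matchings γ (map cycleType (filterᵇ (remaining i) reps))
    inner : ∀ i s → ⟦ eqPoint (iter w (suc k) (i , s)) (flip b (i , s)) ⟧ *ᶻ
      (⟦ fresh used ((i , s) ∷ path w k (i , s)) ⟧ *ᶻ spellings w γ (mark used ((i , s) ∷ path w k (i , s)))) ≡ G i
    inner i s = trans (sym (ℤₚ.*-assoc ⟦ eqPoint (iter w (suc k) (i , s)) (flip b (i , s)) ⟧ ⟦ fresh used ((i , s) ∷ path w k (i , s)) ⟧ _))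
      (trans (cong (_*ᶻ spellings w γ (mark used ((i , s) ∷ path w k (i , s))))
        (trans (sym (⟦∧⟧ (eqPoint (iter w (suc k) (i , s)) (flip b (i , s))) _)) (cong ⟦_⟧ (fresh-orbit c k b i s))))
        (rest (hasType (suc k , b) i ∧ not (elem i used)) refl))
      where
      used' : List (Fin n)
      used' = mark used ((i , s) ∷ path w k (i , s))
      rest : ∀ t → t ≡ hasType (suc k , b) i ∧ not (elem i used) →
        ⟦ t ⟧ *ᶻ spellings w γ used' ≡ ⟦ t ⟧ *ᶻ matchings γ (map cycleType (filterᵇ (remaining i) reps))
      rest false _ = refl
      rest true t≡ with ∧⁻ {hasType (suc k , b) i} (≡⇒T (sym t≡))
      ... | t₁ , i∉ = cong (1ℤ *ᶻ_) (trans (spellings≡matchings γ used' pos closed unique len)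
        (cong (matchings γ ∘ map cycleType) (filterᵇ-cong same reps)))
        where
        r≡ : period i ≡ suc k
        r≡ = ℕₚ.≡ᵇ⇒≡ (period i) (suc k) (proj₁ (∧⁻ {period i ≡ᵇ suc k} t₁))
        used'-↭ : used' ↭ orbit i ++ used
        used'-↭ = ↭-trans (mark-↭ used ((i , s) ∷ path w k (i , s))) (↭-reflexive (cong (_++ used) (orbit-points k i s r≡)))
        closed : Closed used'
        closed m with ∈-++⁻ (orbit i) (Permₚ.∈-resp-↭ used'-↭ m)
        ... | inj₂ m' = Permₚ.∈-resp-↭ (↭-sym used'-↭) (∈-++⁺ʳ (orbit i) (c m'))
        ... | inj₁ m' with orbit⁻ m'
        ...   | j , refl = Permₚ.∈-resp-↭ (↭-sym used'-↭) (∈-++⁺ˡ (subst (_∈ orbit i) (pow-+ 1 j i) (∈-orbit (suc j) i)))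
        unique : Unique used'
        unique = Unique-↭ (↭-sym used'-↭) (Uniqueₚ.++⁺ (orbit-Unique i) U (λ (m , m') → away (orbit⁻ m) m'))
          where
          away : ∀ {j} → (∃ λ a → j ≡ pow a i) → j ∉ used
          away (a , refl) m = T-not⁻ i∉ (elem⁺ (Closed-pow⁻ c a m))
        len : length used' + total γ ≡ n
        len = trans (cong (_+ total γ) (trans (Permₚ.↭-length used'-↭) (trans (Listₚ.length-++ (orbit i)) (cong (_+ length used)
          (trans (Listₚ.length-map _ (upTo (period i))) (trans (Listₚ.length-upTo (period i)) r≡))))))
            (trans (lemma (suc k) (length used) (total γ)) l)
          where
          lemma : ∀ a b c → (a + b) + c ≡ b + (a + c)
          lemma = ℕ-Solver.solve-∀
        same : ∀ r → not (elem r used') ≡ remaining i r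
        same r = trans (cong not (trans (elem-cong r r used' (used ++ orbit i) (Permₚ.∈-resp-↭ flipped) (Permₚ.∈-resp-↭ (↭-sym flipped)))
          (elem-++ r used (orbit i))))
          (not-∨ (elem r used) (elem r (orbit i)))
          where
          flipped : used' ↭ used ++ orbit i
          flipped = ↭-trans used'-↭ (Permₚ.++-comm (orbit i) used)
    G-pow : ∀ j r → G (pow j r) ≡ G r
    G-pow j r = cong₂ (λ y z → ⟦ y ⟧ *ᶻ matchings γ (map cycleType z))
      (cong₂ _∧_ (cong₂ (λ y z → (y ≡ᵇ suc k) ∧ eqBool z b) (period-pow j r) (negCycle-pow j r))
        (cong not (elem-cong (pow j r) r used used (Closed-pow⁻ c j) (Closed-pow c j))))
      (filterᵇ-cong (λ i → cong (λ z → not (elem i used) ∧ not z) (elem-cong i i (orbit (pow j r)) (orbit r) shrink grow)) reps)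
      where
      shrink : ∀ {i} → i ∈ orbit (pow j r) → i ∈ orbit r
      shrink m with orbit⁻ m
      ... | a , refl = subst (_∈ orbit r) (pow-+ a j r) (∈-orbit (a + j) r)
      grow : ∀ {i} → i ∈ orbit r → i ∈ orbit (pow j r)
      grow m with orbit⁻ m | pow-back j r
      ... | a , refl | d , e = subst (_∈ orbit (pow j r)) (trans (pow-+ a d (pow j r)) (cong (pow a) e)) (∈-orbit (a + d) (pow j r))
    term : ∀ r → r ∈ reps → ⁺ 2 *ᶻ (⁺ period r *ᶻ G r) ≡
      ⟦ not (elem r used) ⟧ *ᶻ (typeWeight (suc k , b) (cycleType r) *ᶻ matchings γ (map cycleType (filterᵇ (distinctFrom r) xs)))
    term r r∈ = trans (cong (λ z → ⁺ 2 *ᶻ (⁺ period r *ᶻ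
      (⟦ hasType (suc k , b) r ∧ not (elem r used) ⟧ *ᶻ matchings γ (map cycleType z)))) filters)
      (weights (hasType (suc k , b) r) refl)
      where
      filters : filterᵇ (remaining r) reps ≡ filterᵇ (distinctFrom r) xs
      filters = trans (filterᵇ-cong∈ reps (λ {r'} r'∈ → cong (not (elem r' used) ∧_) (T-ext
          (λ t → T-not⁺ (λ e → T-not⁻ t (elem⁺ (subst (_∈ orbit r) (sym (Finₚ.toℕ-injective (ℕₚ.≡ᵇ⇒≡ (toℕ r') (toℕ r) e))) (∈-orbit 0 r)))))
          (λ t → T-not⁺ (λ m → T-not⁻ t (ℕₚ.≡⇒≡ᵇ (toℕ r') (toℕ r) (cong toℕ (sym (same-rep r'∈ (orbit⁻ (elem⁻ (orbit r) m)))))))))))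
            (sym (filterᵇ-∧ (distinctFrom r) (λ r → not (elem r used)) reps))
        where
        same-rep : ∀ {r'} → r' ∈ reps → (∃ λ a → r' ≡ pow a r) → r ≡ r'
        same-rep r'∈ (a , e) = rep-unique (proj₂ (∈-filterᵇ⁻ (allFinL n) r∈)) (proj₂ (∈-filterᵇ⁻ (allFinL n) r'∈)) a (sym e)
      M : ℤ
      M = matchings γ (map cycleType (filterᵇ (distinctFrom r) xs))
      rearrange : ∀ k f m → ⁺ 2 *ᶻ (k *ᶻ (f *ᶻ m)) ≡ f *ᶻ ((⁺ 2 *ᶻ k) *ᶻ m)
      rearrange = ℤ-Solver.solve-∀
      weights : ∀ t → t ≡ hasType (suc k , b) r → ⁺ 2 *ᶻ (⁺ period r *ᶻ (⟦ t ∧ not (elem r used) ⟧ *ᶻ M)) ≡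
        ⟦ not (elem r used) ⟧ *ᶻ ((if t then ⁺ (2 * suc k) else 0ℤ) *ᶻ M)
      weights true t≡ = trans (cong (λ z → ⁺ 2 *ᶻ (⁺ z *ᶻ (⟦ not (elem r used) ⟧ *ᶻ M))) r≡)
        (trans (rearrange (⁺ suc k) ⟦ not (elem r used) ⟧ M) (cong (λ z → ⟦ not (elem r used) ⟧ *ᶻ (z *ᶻ M)) (sym (ℤₚ.pos-* 2 (suc k)))))
        where
        r≡ : period r ≡ suc k
        r≡ = ℕₚ.≡ᵇ⇒≡ (period r) (suc k) (proj₁ (∧⁻ {period r ≡ᵇ suc k} (≡⇒T (sym t≡))))
      weights false t≡ = trans (cong (⁺ 2 *ᶻ_) (ℤₚ.*-zeroʳ (⁺ period r))) (sym (ℤₚ.*-zeroʳ ⟦ not (elem r used) ⟧))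

-- Centralizers and conjugacy classes

∑-fresh : ∀ {n} k (used : List (Fin n)) → Unique used → length used + k ≡ n →
  ∑ (allLists k (points n)) (λ u → ⟦ fresh used u ⟧) ≡ ⁺ (2 ^ k * k !)
∑-fresh zero used U l = refl
∑-fresh {n} (suc k) used U l = begin
  ∑ (allLists (suc k) (points n)) (λ u → ⟦ fresh used u ⟧)
    ≡⟨ ∑-allLists-suc k (points n) ⟩
  ∑ (points n) (λ x → ∑ (allLists k (points n)) (λ u → ⟦ not (elem (proj₁ x) used) ∧ fresh (proj₁ x ∷ used) u ⟧))
    ≡⟨ ∑-cong (points n) (λ x → trans (∑-cong (allLists k (points n)) (λ u → ⟦∧⟧ (not (elem (proj₁ x) used)) _))
         (trans (∑-*ˡ (allLists k (points n)) ⟦ not (elem (proj₁ x) used) ⟧) (extend (proj₁ x) (elem (proj₁ x) used) refl))) ⟩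
  ∑ (points n) (λ x → ⟦ not (elem (proj₁ x) used) ⟧ *ᶻ C)
    ≡⟨ ∑-*ʳ (points n) C ⟩
  ∑ (points n) (λ x → ⟦ not (elem (proj₁ x) used) ⟧) *ᶻ C
    ≡⟨ cong (_*ᶻ C) (trans (∑-points n (λ i → ⟦ not (elem i used) ⟧))
      (cong (⁺ 2 *ᶻ_) (trans (sym (count-∑ (λ i → not (elem i used)) (allFinL n))) (cong ⁺_ unused)))) ⟩
  (⁺ 2 *ᶻ ⁺ suc k) *ᶻ C
    ≡⟨ trans (cong (_*ᶻ C) (sym (ℤₚ.pos-* 2 (suc k)))) (trans (sym (ℤₚ.pos-* (2 * suc k) (2 ^ k * k !)))
      (cong ⁺_ (arith (suc k) (2 ^ k) (k !)))) ⟩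
  ⁺ (2 ^ suc k * suc k !) ∎
  where
  open ≡-Reasoning
  C : ℤ
  C = ⁺ (2 ^ k * k !)
  arith : ∀ a b c → 2 * a * (b * c) ≡ 2 * b * (a * c)
  arith = ℕ-Solver.solve-∀
  extend : ∀ i t → t ≡ elem i used → ⟦ not t ⟧ *ᶻ ∑ (allLists k (points n)) (λ u → ⟦ fresh (i ∷ used) u ⟧) ≡ ⟦ not t ⟧ *ᶻ C
  extend i true _ = refl
  extend i false e = cong (1ℤ *ᶻ_) (∑-fresh k (i ∷ used)
    (All.tabulate (λ {x} x∈ i≡x → subst T (sym e) (elem⁺ (subst (_∈ used) (sym i≡x) x∈))) ∷ U)
    (trans (sym (ℕₚ.+-suc (length used) k)) l))
  free : List (Fin n)
  free = filterᵇ (λ i → not (elem i used)) (allFinL n)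
  all-points : used ++ free ↭ allFinL n
  all-points = Unique-⊇-↭ (Uniqueₚ.++⁺ U (Uniqueₚ.filter⁺ (T? ∘ (λ i → not (elem i used))) (allFinL-Unique n))
      (λ (m , m') → T-not⁻ (proj₂ (∈-filterᵇ⁻ (allFinL n) m')) (elem⁺ m))) (allFinL-Unique n) (λ {x} _ → ∈-allFinL x)
        (λ {x} _ → cover x (elem x used) refl)
    where
    cover : ∀ x t → t ≡ elem x used → x ∈ used ++ free
    cover x true e = ∈-++⁺ˡ (elem⁻ used (≡⇒T (sym e)))
    cover x false e = ∈-++⁺ʳ used (∈-filterᵇ⁺ (∈-allFinL x) (T-not⁺ (subst T (sym e))))
  unused : count (λ i → not (elem i used)) (allFinL n) ≡ suc k
  unused = ℕₚ.+-cancelˡ-≡ (length used) _ _ (trans (sym (Listₚ.length-++ used)) (trans (Permₚ.↭-length all-points)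
    (trans (length-allFinL n) (sym l))))

-- Signed permutations determined by their values on a list of points

injectiveV⁻ : ∀ {n} (π : Vec (Fin n) n) → T (injectiveV π) → ∀ {i j} → Vec.lookup π i ≡ Vec.lookup π j → i ≡ j
injectiveV⁻ π h {i} {j} e with Equivalence.to (T-∨ {eqℕ (toℕ i) (toℕ j)}) (all-T⁻ (all-T⁻ h (∈-allFinL i)) (∈-allFinL j))
... | inj₁ p = Finₚ.toℕ-injective (ℕₚ.≡ᵇ⇒≡ _ _ p)
... | inj₂ p = ⊥-elim (T-not⁻ p (ℕₚ.≡⇒≡ᵇ _ _ (cong toℕ e)))

injectiveV⁺ : ∀ {n} (π : Vec (Fin n) n) → (∀ {i j} → Vec.lookup π i ≡ Vec.lookup π j → i ≡ j) → T (injectiveV π)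
injectiveV⁺ {n} π h = all-T⁺ {p = λ i → all (λ j → distinct i j) (allFinL n)} {allFinL n}
  (λ {i} _ → all-T⁺ {p = distinct i} {allFinL n} (λ {j} _ → test i j))
  where
  distinct : Fin n → Fin n → Bool
  distinct i j = eqℕ (toℕ i) (toℕ j) ∨ not (eqℕ (toℕ (Vec.lookup π i)) (toℕ (Vec.lookup π j)))
  test : ∀ i j → T (distinct i j)
  test i j with eqℕ (toℕ (Vec.lookup π i)) (toℕ (Vec.lookup π j)) in eq
  ... | false = Equivalence.from (T-∨ {eqℕ (toℕ i) (toℕ j)}) (inj₂ tt)
  ... | true = Equivalence.from (T-∨ {eqℕ (toℕ i) (toℕ j)}) (inj₁ (ℕₚ.≡⇒≡ᵇ _ _ (cong toℕ (h (Finₚ.toℕ-injective (ℕₚ.≡ᵇ⇒≡ _ _ (≡⇒T eq)))))))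

Bn≡ : ∀ n → Bn n ≡ cartesianProduct (filterᵇ injectiveV (allVecs n (allFinL n))) (bits n)
Bn≡ n = lemma (filterᵇ injectiveV (allVecs n (allFinL n)))
  where
  lemma : ∀ (xs : List (Vec (Fin n) n)) → concatMap (λ π → map (λ ε → (π , ε)) (bits n)) xs ≡ cartesianProduct xs (bits n)
  lemma [] = refl
  lemma (x ∷ xs) = cong (map (x ,_) (bits n) ++_) (lemma xs)

Bn-Unique : ∀ n → Unique (Bn n)
Bn-Unique n = subst Unique (sym (Bn≡ n)) (Uniqueₚ.cartesianProduct⁺
  (Uniqueₚ.filter⁺ (T? ∘ injectiveV) (allVecs-Unique n (allFinL-Unique n))) (allVecs-Unique n bools-Unique))

Bn⁻ : ∀ {n} {w : SignedPerm n} → w ∈ Bn n → T (injectiveV (proj₁ w))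
Bn⁻ {n} {w} m = proj₂ (∈-filterᵇ⁻ (allVecs n (allFinL n))
  (proj₁ (∈-cartesianProduct⁻ (filterᵇ injectiveV (allVecs n (allFinL n))) (bits n) (subst (w ∈_) (Bn≡ n) m))))

Bn⁺ : ∀ {n} {w : SignedPerm n} → T (injectiveV (proj₁ w)) → w ∈ Bn n
Bn⁺ {n} {π , ε} h = subst (_ ∈_) (sym (Bn≡ n)) (∈-cartesianProduct⁺ (∈-filterᵇ⁺ (∈-allVecs⁺ π (λ i → ∈-allFinL (Vec.lookup π i))) h)
  (∈-allVecs⁺ ε (λ i → ∈-bools (Vec.lookup ε i))))

-- The images that the points of u must have if u spells the cycles of w: every block moves up by
-- one place, and its first point returns at the end, with the bar changed for a negative cycle.
shift : ∀ {n} → List Part → List (Point n) → List (Point n)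
shift []                u       = []
shift ((zero , b) ∷ γ)  u       = shift γ u
shift ((suc k , b) ∷ γ) []      = []
shift ((suc k , b) ∷ γ) (x ∷ u) = (take k u ++ flip b x ∷ []) ++ shift γ (drop k u)

chain⁻ : ∀ {n} (w : SignedPerm n) t y zs → T (chain w t y zs) → map (act w) (y ∷ zs) ≡ zs ++ t ∷ []
chain⁻ w t y [] h = cong (_∷ []) (eqPoint⁻ {x = act w y} h)
chain⁻ w t y (z ∷ zs) h with ∧⁻ {eqPoint (act w y) z} h
... | p , q = cong₂ _∷_ (eqPoint⁻ {x = act w y} p) (chain⁻ w t z zs q)

chain⁺ : ∀ {n} (w : SignedPerm n) t y zs → map (act w) (y ∷ zs) ≡ zs ++ t ∷ [] → T (chain w t y zs)
chain⁺ w t y [] h = eqPoint⁺ {x = act w y} (Listₚ.∷-injectiveˡ h)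
chain⁺ w t y (z ∷ zs) h = ∧⁺ (eqPoint⁺ {x = act w y} (Listₚ.∷-injectiveˡ h)) (chain⁺ w t z zs (Listₚ.∷-injectiveʳ h))

spells⁻ : ∀ {n} (w : SignedPerm n) γ u → length u ≡ total γ → T (spells w γ u) → map (act w) u ≡ shift γ u
spells⁻ w [] [] l h = refl
spells⁻ w ((zero , b) ∷ γ) u l h = spells⁻ w γ u l h
spells⁻ w ((suc k , b) ∷ γ) (x ∷ u) l h with ∧⁻ {chain w (flip b x) x (take k u)} h
... | p , q = trans (cong (λ z → map (act w) (x ∷ z)) (sym (Listₚ.take++drop≡id k u)))
  (trans (Listₚ.map-++ (act w) (x ∷ take k u) (drop k u))
  (cong₂ _++_ (chain⁻ w (flip b x) x (take k u) p) (spells⁻ w γ (drop k u)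
    (length-drop-+ k (ℕₚ.suc-injective l)) q)))

spells⁺ : ∀ {n} (w : SignedPerm n) γ u → length u ≡ total γ → map (act w) u ≡ shift γ u → T (spells w γ u)
spells⁺ w [] u l h = tt
spells⁺ w ((zero , b) ∷ γ) u l h = spells⁺ w γ u l h
spells⁺ w ((suc k , b) ∷ γ) (x ∷ u) l h with ++-cancel (map (act w) (x ∷ take k u)) (take k u ++ flip b x ∷ []) lens
    (trans (sym (trans (cong (λ z → map (act w) (x ∷ z)) (sym (Listₚ.take++drop≡id k u)))
      (Listₚ.map-++ (act w) (x ∷ take k u) (drop k u)))) h)
  where
  lens : length (map (act w) (x ∷ take k u)) ≡ length (take k u ++ flip b x ∷ [])
  lens = trans (Listₚ.length-map (act w) (x ∷ take k u)) (trans (ℕₚ.+-comm 1 (length (take k u))) (sym (Listₚ.length-++ (take k u))))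
... | p , q = ∧⁺ (chain⁺ w (flip b x) x (take k u) p) (spells⁺ w γ (drop k u)
    (length-drop-+ k (ℕₚ.suc-injective l)) q)

shift-↭ : ∀ {n} γ (u : List (Point n)) → length u ≡ total γ → map proj₁ (shift γ u) ↭ map proj₁ u
shift-↭ [] [] l = ↭-refl
shift-↭ ((zero , b) ∷ γ) u l = shift-↭ γ u l
shift-↭ ((suc k , b) ∷ γ) (x ∷ u) l = ↭-trans (↭-reflexive (trans (Listₚ.map-++ proj₁ (take k u ++ flip b x ∷ []) _)
    (cong (_++ map proj₁ (shift γ (drop k u))) (Listₚ.map-++ proj₁ (take k u) (flip b x ∷ [])))))
  (↭-trans (Permₚ.++⁺ (Permₚ.shift (proj₁ x) (map proj₁ (take k u)) []) (shift-↭ γ (drop k u)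
      (length-drop-+ k (ℕₚ.suc-injective l))))
    (↭-reflexive (cong (proj₁ x ∷_) (trans (cong (_++ map proj₁ (drop k u)) (Listₚ.++-identityʳ (map proj₁ (take k u))))
      (trans (sym (Listₚ.map-++ proj₁ (take k u) (drop k u))) (cong (map proj₁) (Listₚ.take++drop≡id k u)))))))

fresh⇒Unique : ∀ {n} (used : List (Fin n)) u → T (fresh used u) → Unique (map proj₁ u)
fresh⇒Unique used [] t = []
fresh⇒Unique used (x ∷ u) t with ∧⁻ {not (elem (proj₁ x) used)} t
... | _ , t' = Allₚ.map⁺ (All.tabulate (λ {y} y∈ e → fresh⁻ (proj₁ x ∷ used) u t' y∈ (here (sym e)))) ∷ fresh⇒Unique (proj₁ x ∷ used) u t'

∈-zip₁ : {A B : Set} (xs : List A) (ys : List B) → ∀ {x y} → (x , y) ∈ zip xs ys → x ∈ xs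
∈-zip₁ (a ∷ xs) (b ∷ ys) (here refl) = here refl
∈-zip₁ (a ∷ xs) (b ∷ ys) (there m) = there (∈-zip₁ xs ys m)

module _ {A B C : Set} (f : A → C) where

  zip-functional : ∀ (xs : List A) (ys : List B) → Unique (map f xs) → ∀ {x x' y y'} → (x , y) ∈ zip xs ys → (x' , y') ∈ zip xs ys →
    f x ≡ f x' → (x , y) ≡ (x' , y')
  zip-functional (a ∷ xs) (b ∷ ys) (a∉ ∷ U) (here refl) (here refl) e = refl
  zip-functional (a ∷ xs) (b ∷ ys) (a∉ ∷ U) (here refl) (there m) e = ⊥-elim (All.lookup a∉ (∈-map⁺ f (∈-zip₁ xs ys m)) e)
  zip-functional (a ∷ xs) (b ∷ ys) (a∉ ∷ U) (there m) (here refl) e = ⊥-elim (All.lookup a∉ (∈-map⁺ f (∈-zip₁ xs ys m)) (sym e))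
  zip-functional (a ∷ xs) (b ∷ ys) (a∉ ∷ U) (there m) (there m') e = zip-functional xs ys U m m' e

∈-zip-swap : {A B : Set} (xs : List A) (ys : List B) → ∀ {x y} → (x , y) ∈ zip xs ys → (y , x) ∈ zip ys xs
∈-zip-swap (a ∷ xs) (b ∷ ys) (here refl) = here refl
∈-zip-swap (a ∷ xs) (b ∷ ys) (there m) = there (∈-zip-swap xs ys m)

∈-zip-partner : {A B : Set} (xs : List A) (ys : List B) → length xs ≡ length ys → ∀ {x} → x ∈ xs → ∃ λ y → (x , y) ∈ zip xs ys
∈-zip-partner (a ∷ xs) (b ∷ ys) l (here refl) = b , here refl
∈-zip-partner (a ∷ xs) (b ∷ ys) l (there m) with ∈-zip-partner xs ys (ℕₚ.suc-injective l) m
... | y , m' = y , there m'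

module _ {n : ℕ} (u t : List (Point n)) (lt : length u ≡ length t) (Uu : Unique (map proj₁ u)) (Ut : Unique (map proj₁ t))
  (cover : ∀ i → i ∈ map proj₁ u) where

  assigned : ∀ i → ∃ λ s → ∃ λ y → ((i , s) , y) ∈ zip u t
  assigned i with ∈-map⁻ proj₁ (cover i)
  ... | (_ , s) , x∈ , refl with ∈-zip-partner u t lt x∈
  ... | y , m = s , y , m

  -- The point i may occur in u with a bar; the sign of w at i is the sign of its image corrected by
  -- that bar.
  interpolant : SignedPerm n
  interpolant = Vec.tabulate (λ i → proj₁ (proj₁ (proj₂ (assigned i)))) , Vec.tabulate
    (λ i → proj₁ (assigned i) xor proj₂ (proj₁ (proj₂ (assigned i))))

  interpolant-injective : ∀ {i j} → Vec.lookup (proj₁ interpolant) i ≡ Vec.lookup (proj₁ interpolant) j → i ≡ j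
  interpolant-injective {i} {j} e = cong (proj₁ ∘ proj₂)
    (zip-functional proj₁ t u Ut (∈-zip-swap u t (proj₂ (proj₂ (assigned i)))) (∈-zip-swap u t (proj₂ (proj₂ (assigned j))))
    (trans (sym (Vecₚ.lookup∘tabulate _ i)) (trans e (Vecₚ.lookup∘tabulate _ j))))

  interpolates : map (act interpolant) u ≡ t
  interpolates = pointwise u t lt (λ {x} {y} m → agree x y m)
    where
    xor-twice : ∀ s b → s xor (s xor b) ≡ b
    xor-twice true true = refl
    xor-twice true false = refl
    xor-twice false b = refl
    agree : ∀ x y → (x , y) ∈ zip u t → act interpolant x ≡ y
    agree (i , s) y m with zip-functional proj₁ u t Uu m (proj₂ (proj₂ (assigned i))) refl
    ... | e = trans (cong₂ _,_ (Vecₚ.lookup∘tabulate _ i) (cong (s xor_) (Vecₚ.lookup∘tabulate _ i)))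
      (trans (cong₂ (λ a b → (proj₁ a , s xor (b xor proj₂ a))) (sym (cong proj₂ e)) (sym (cong (proj₂ ∘ proj₁) e)))
        (cong (proj₁ y ,_) (xor-twice s (proj₂ y))))
    pointwise : ∀ (u t : List (Point n)) → length u ≡ length t → (∀ {x y} → (x , y) ∈ zip u t → act interpolant x ≡ y) → map
      (act interpolant) u ≡ t
    pointwise [] [] l h = refl
    pointwise (x ∷ u) (y ∷ t) l h = cong₂ _∷_ (h (here refl)) (pointwise u t (ℕₚ.suc-injective l) (h ∘ there))

  act-determined : ∀ (w w' : SignedPerm n) → map (act w) u ≡ map (act w') u → w ≡ w'
  act-determined (π , ε) (π' , ε') e = cong₂ _,_ (ext (λ i → cong proj₁ (proj₂ (same i))))
    (ext (λ i → xor-cancelˡ (proj₁ (same i)) (cong proj₂ (proj₂ (same i)))))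
    where
    ext : ∀ {A : Set} {k} {v v' : Vec A k} → (∀ i → Vec.lookup v i ≡ Vec.lookup v' i) → v ≡ v'
    ext {v = v} {v'} h = trans (sym (Vecₚ.tabulate∘lookup v)) (trans (Vecₚ.tabulate-cong h) (Vecₚ.tabulate∘lookup v'))
    at-member : ∀ (u : List (Point n)) → map (act (π , ε)) u ≡ map (act (π' , ε')) u → ∀ {x} → x ∈ u → act (π , ε) x ≡ act (π' , ε') x
    at-member (x ∷ u) h (here refl) = Listₚ.∷-injectiveˡ h
    at-member (x ∷ u) h (there m) = at-member u (Listₚ.∷-injectiveʳ h) m
    same : ∀ i → ∃ λ s → act (π , ε) (i , s) ≡ act (π' , ε') (i , s)
    same i with ∈-map⁻ proj₁ (cover i)
    ... | (_ , s) , x∈ , refl = s , at-member u e x∈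

-- u contains one of the two points over every i, so prescribing the images `shift γ u` of its
-- members determines w, and `interpolant` realizes them.
∑-spells : ∀ γ (u : List (Point (total γ))) → length u ≡ total γ → T (fresh [] u) → ∑ (Bn (total γ)) (λ w → ⟦ spells w γ u ⟧) ≡ 1ℤ
∑-spells γ u l f = trans (∑-single (Bn-Unique (total γ)) (Bn⁺ (injectiveV⁺ (proj₁ w₀) (interpolant-injective u t lt Uu Ut cover)))
  (λ {w} w∈ w≢ →
    cong ⟦_⟧ (¬T⇒≡ (λ h → w≢ (act-determined u t lt Uu Ut cover w w₀
      (trans (spells⁻ w γ u l h) (sym (interpolates u t lt Uu Ut cover))))))))
  (cong ⟦_⟧ (T⇒≡ (spells⁺ w₀ γ u l (interpolates u t lt Uu Ut cover))))
  where
  t : List (Point (total γ))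
  t = shift γ u
  lt : length u ≡ length t
  lt = trans (sym (Listₚ.length-map proj₁ u)) (trans (sym (Permₚ.↭-length (shift-↭ γ u l))) (Listₚ.length-map proj₁ t))
  Uu : Unique (map proj₁ u)
  Uu = fresh⇒Unique [] u f
  Ut : Unique (map proj₁ t)
  Ut = Unique-↭ (↭-sym (shift-↭ γ u l)) Uu
  cover : ∀ i → i ∈ map proj₁ u
  cover = Unique-full Uu (trans (Listₚ.length-map proj₁ u) l)
  w₀ : SignedPerm (total γ)
  w₀ = interpolant u t lt Uu Ut cover

cycleTypes : ∀ {n} → SignedPerm n → List Part
cycleTypes {n} w = map (λ i → (returnTime w i , negCycle w i)) (filterᵇ (isRep w) (allFinL n))

-- The size of a conjugacy class times the order of its centralizer is 2^n n!.
∑-matchings : ∀ γ → All Positive γ → ∑ (Bn (total γ)) (λ w → matchings γ (cycleTypes w)) ≡ ⁺ (2 ^ total γ * total γ !)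
∑-matchings γ pos = begin
  ∑ (Bn (total γ)) (λ w → matchings γ (cycleTypes w))
    ≡⟨ ∑-cong∈ (Bn (total γ)) (λ {w} w∈ → sym (trans (spellings≡matchings w (injectiveV⁻ (proj₁ w) (Bn⁻ w∈)) γ [] pos (λ ()) [] refl)
         (cong (matchings γ ∘ map _) (filterᵇ-all (filterᵇ (isRep w) (allFinL (total γ))) (λ _ → refl))))) ⟩
  ∑ (Bn (total γ)) (λ w → ∑ us (λ u → ⟦ fresh [] u ∧ spells w γ u ⟧))
    ≡⟨ ∑-swap (Bn (total γ)) us ⟩
  ∑ us (λ u → ∑ (Bn (total γ)) (λ w → ⟦ fresh [] u ∧ spells w γ u ⟧))
    ≡⟨ ∑-cong∈ us (λ {u} u∈ → trans (∑-cong (Bn (total γ)) (λ w → ⟦∧⟧ (fresh [] u) _))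
      (trans (∑-*ˡ (Bn (total γ)) ⟦ fresh [] u ⟧) (one u (proj₁ (∈-allLists⁻ (total γ) u∈)) (fresh [] u) refl))) ⟩
  ∑ us (λ u → ⟦ fresh [] u ⟧)
    ≡⟨ ∑-fresh (total γ) [] [] refl ⟩
  ⁺ (2 ^ total γ * total γ !) ∎
  where
  open ≡-Reasoning
  us : List (List (Point (total γ)))
  us = allLists (total γ) (points (total γ))
  one : ∀ u → length u ≡ total γ → ∀ t → t ≡ fresh [] u → ⟦ t ⟧ *ᶻ ∑ (Bn (total γ)) (λ w → ⟦ spells w γ u ⟧) ≡ ⟦ t ⟧
  one u l true e = cong (1ℤ *ᶻ_) (∑-spells γ u l (≡⇒T (sym e)))
  one u l false e = refl

-- Cycle types up to rearrangement

insertDesc-↭ : ∀ x ys → insertDesc x ys ↭ x ∷ ys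
insertDesc-↭ x [] = ↭-refl
insertDesc-↭ x (y ∷ ys) with y ≤ᵇ x
... | true = ↭-refl
... | false = ↭-trans (Perm.prep y (insertDesc-↭ x ys)) (Perm.swap y x ↭-refl)

sortDesc-↭ : ∀ xs → sortDesc xs ↭ xs
sortDesc-↭ [] = ↭-refl
sortDesc-↭ (x ∷ xs) = ↭-trans (insertDesc-↭ x (sortDesc xs)) (Perm.prep x (sortDesc-↭ xs))

insertDesc-sorted : ∀ x {ys} → AllPairs _≥_ ys → AllPairs _≥_ (insertDesc x ys)
insertDesc-sorted x [] = [] ∷ []
insertDesc-sorted x {y ∷ ys} (r ∷ rs) with y ≤ᵇ x in eq
... | true = (ℕₚ.≤ᵇ⇒≤ y x (≡⇒T eq) ∷ All.map (λ h → ℕₚ.≤-trans h (ℕₚ.≤ᵇ⇒≤ y x (≡⇒T eq))) r) ∷ r ∷ rs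
... | false = Permₚ.All-resp-↭ (↭-sym (insertDesc-↭ x ys)) (ℕₚ.<⇒≤ (ℕₚ.≰⇒> (λ h → subst T eq (ℕₚ.≤⇒≤ᵇ h))) ∷ r) ∷ insertDesc-sorted x rs

sortDesc-sorted : ∀ xs → AllPairs _≥_ (sortDesc xs)
sortDesc-sorted [] = []
sortDesc-sorted (x ∷ xs) = insertDesc-sorted x (sortDesc-sorted xs)

partition-↭ : {A : Set} (p q : A → Bool) → ∀ xs → filterᵇ (λ x → p x ∧ not (q x)) xs ++ filterᵇ (λ x → p x ∧ q x) xs ↭ filterᵇ p xs
partition-↭ p q [] = ↭-refl
partition-↭ p q (x ∷ xs) with p x | q x
... | false | _ = partition-↭ p q xs
... | true | false = Perm.prep x (partition-↭ p q xs)
... | true | true = ↭-trans (Permₚ.shift x (filterᵇ (λ x → p x ∧ not (q x)) xs) (filterᵇ (λ x → p x ∧ q x) xs))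
  (Perm.prep x (partition-↭ p q xs))

arrangement-↭ : ∀ {n} (w : SignedPerm n) → arrangement (alphaOf w) (betaOf w) ↭ cycleTypes w
arrangement-↭ {n} w = ↭-trans (Permₚ.++⁺ (class false pos (λ m → ¬T⇒≡ (T-not⁻ (proj₂ (∧⁻ {isRep w _} (proj₂ (∈-filterᵇ⁻ (allFinL n) m)))))))
    (class true neg (λ m → T⇒≡ (proj₂ (∧⁻ {isRep w _} (proj₂ (∈-filterᵇ⁻ (allFinL n) m)))))))
  (↭-trans (↭-reflexive (sym (Listₚ.map-++ cycle pos neg))) (Permₚ.map⁺ cycle (partition-↭ (isRep w) (negCycle w) (allFinL n))))
  where
  cycle : Fin n → Part
  cycle i = (returnTime w i , negCycle w i)
  pos neg : List (Fin n)
  pos = filterᵇ (λ i → isRep w i ∧ not (negCycle w i)) (allFinL n)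
  neg = filterᵇ (λ i → isRep w i ∧ negCycle w i) (allFinL n)
  class : ∀ b xs → (∀ {i} → i ∈ xs → negCycle w i ≡ b) → map (_, b) (sortDesc (map (returnTime w) xs)) ↭ map cycle xs
  class b xs h = ↭-trans (Permₚ.map⁺ (_, b) (sortDesc-↭ (map (returnTime w) xs))) (↭-reflexive (trans (sym (Listₚ.map-∘ xs)) (lemma xs h)))
    where
    lemma : ∀ xs → (∀ {i} → i ∈ xs → negCycle w i ≡ b) → map (λ i → (returnTime w i , b)) xs ≡ map cycle xs
    lemma [] h = refl
    lemma (x ∷ xs) h = cong₂ _∷_ (cong (returnTime w x ,_) (sym (h (here refl)))) (lemma xs (h ∘ there))

picks-↭ : {A : Set} (xs : List A) → ∀ {p} → p ∈ picks xs → xs ↭ proj₁ p ∷ proj₂ p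
picks-↭ (x ∷ xs) (here refl) = ↭-refl
picks-↭ (x ∷ xs) (there m) with ∈-map⁻ _ m
... | (y , ys) , y∈ , refl = ↭-trans (Perm.prep x (picks-↭ xs y∈)) (Perm.swap x y ↭-refl)

∑-0-or : {A P : Set} (xs : List A) {f : A → ℤ} → (∀ {x} → x ∈ xs → f x ≡ 0ℤ ⊎ P) → ∑ xs f ≡ 0ℤ ⊎ P
∑-0-or [] h = inj₁ refl
∑-0-or (x ∷ xs) h with h (here refl) | ∑-0-or xs (h ∘ there)
... | inj₂ p | _ = inj₂ p
... | inj₁ e | inj₂ p = inj₂ p
... | inj₁ e | inj₁ e' = inj₁ (cong₂ _+ᶻ_ e e')

-- A contributing choice pairs each part of γ with an equal part of δ, leaving none over.
matchings-0-or-↭ : ∀ γ δ → matchings γ δ ≡ 0ℤ ⊎ δ ↭ γ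
matchings-0-or-↭ [] [] = inj₂ ↭-refl
matchings-0-or-↭ [] (d ∷ δ) = inj₁ refl
matchings-0-or-↭ ((k , b) ∷ γ) δ = ∑-0-or (picks δ) (λ {(a , δ')} m → term a δ' (picks-↭ δ m))
  where
  term : ∀ a δ' → δ ↭ a ∷ δ' → typeWeight (k , b) a *ᶻ matchings γ δ' ≡ 0ℤ ⊎ δ ↭ (k , b) ∷ γ
  term (d , b') δ' p with (d ≡ᵇ k) ∧ eqBool b' b in eq
  ... | false = inj₁ refl
  ... | true with ∧⁻ {d ≡ᵇ k} (≡⇒T eq) | matchings-0-or-↭ γ δ'
  ... | _ | inj₁ e = inj₁ (trans (cong (⁺ (2 * k) *ᶻ_) e) (ℤₚ.*-zeroʳ (⁺ (2 * k))))
  ... | x , y | inj₂ q with refl ← ℕₚ.≡ᵇ⇒≡ d k x | refl ← eqBool⇒≡ {b'} {b} y = inj₂ (↭-trans p (Perm.prep (k , b) q))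

parts : Bool → List Part → List ℕ
parts b δ = map proj₁ (filterᵇ (λ p → eqBool b (proj₂ p)) δ)

parts-arrangement : ∀ b α β → parts b (arrangement α β) ≡ (if b then β else α)
parts-arrangement b α β = trans (cong (map proj₁) (Listₚ.filter-++ (T? ∘ (λ p → eqBool b (proj₂ p))) (map (_, false) α) (map (_, true) β)))
  (trans (Listₚ.map-++ proj₁ (filterᵇ (λ p → eqBool b (proj₂ p)) (map (_, false) α)) _) (cases b))
  where
  keep : ∀ b ks → parts b (map (_, b) ks) ≡ ks
  keep b ks = trans (cong (map proj₁) (filterᵇ-all (map (_, b) ks) (λ m → T⇒≡ (≡⇒eqBool (sym (tag m))))))
    (trans (sym (Listₚ.map-∘ ks)) (Listₚ.map-id ks))
    where
    tag : ∀ {p} → p ∈ map (_, b) ks → proj₂ p ≡ b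
    tag m with ∈-map⁻ (_, b) m
    ... | _ , _ , refl = refl
  skip : ∀ b ks → parts b (map (_, not b) ks) ≡ []
  skip b [] = refl
  skip true (k ∷ ks) = skip true ks
  skip false (k ∷ ks) = skip false ks
  cases : ∀ b → parts b (map (_, false) α) ++ parts b (map (_, true) β) ≡ (if b then β else α)
  cases true = cong₂ _++_ (skip true α) (keep true β)
  cases false = trans (cong₂ _++_ (keep false α) (skip false β)) (Listₚ.++-identityʳ α)

-- The tags separate α from β up to order, and a descending list admits only one order.
arrangement-injective : ∀ {α β α' β'} → AllPairs _≥_ α → AllPairs _≥_ β → AllPairs _≥_ α' → AllPairs _≥_ β' →
  arrangement α β ↭ arrangement α' β' → α ≡ α' × β ≡ β'
arrangement-injective {α} {β} {α'} {β'} a b a' b' p =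
  AllPairs-↭⇒≡ (λ x y → ℕₚ.≤-antisym y x) a a' (at-tag false) , AllPairs-↭⇒≡ (λ x y → ℕₚ.≤-antisym y x) b b' (at-tag true)
  where
  at-tag : ∀ t → (if t then β else α) ↭ (if t then β' else α')
  at-tag t = ↭-trans (↭-reflexive (sym (parts-arrangement t α β)))
    (↭-trans (Permₚ.map⁺ proj₁ (Permₚ.filter-↭ (T? ∘ (λ p → eqBool t (proj₂ p))) p))
    (↭-reflexive (parts-arrangement t α' β')))

-- The character formula

coeff-schurXY-compatible : ∀ {la mu} → Linked _≥_ la → Linked _≥_ mu → ∀ n → size la + size mu ≡ n →
  (st e : Vec Bool n) → leading st ≡ 0 → Consistent true st e → ∀ prev →
  coeff (schurXY n la mu) (runsMono (st , e)) ≡ ∑ (SYT n la mu) (λ Q → ⟦ compatible prev st e Q ⟧)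
coeff-schurXY-compatible {la} {mu} hla hmu n refl st e lead cons prev = coeff-schurXY la mu hla hmu st e lead cons prev

∑-family-schurXY : ∀ {la mu} → Linked _≥_ la → Linked _≥_ mu → ∀ γ → All Positive γ → size la + size mu ≡ total γ →
  ∑ (family γ) (λ f → proj₁ f *ᶻ coeff (schurXY (total γ) la mu) (runsMono (proj₂ f))) ≡
  ∑ (SYT (total γ) la mu) (λ Q → wt (total γ) γ (sDes (total γ) Q))
∑-family-schurXY {la} {mu} hla hmu γ pos s = begin
  ∑ (family γ) (λ f → proj₁ f *ᶻ coeff (schurXY (total γ) la mu) (runsMono (proj₂ f)))
    ≡⟨ ∑-cong∈ (family γ) (λ {(a , (st , e))} f∈ → trans (cong (a *ᶻ_)
         (coeff-schurXY-compatible hla hmu (total γ) s st e (leading-family γ f∈) (family-Consistent γ f∈ true) start)) (sym (∑-*ˡ Qs a))) ⟩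
  ∑ (family γ) (λ f → ∑ Qs (λ Q → proj₁ f *ᶻ ⟦ compatible start (proj₁ (proj₂ f)) (proj₂ (proj₂ f)) Q ⟧))
    ≡⟨ ∑-swap (family γ) Qs ⟩
  ∑ Qs (λ Q → ∑ (family γ) (λ f → proj₁ f *ᶻ ⟦ compatible start (proj₁ (proj₂ f)) (proj₂ (proj₂ f)) Q ⟧))
    ≡⟨ ∑-cong∈ Qs (λ {Q} Q∈ → trans (∑-family-compatible γ start Q (len Q∈)) (sym (wt≡blockFactors γ Q pos (len Q∈)))) ⟩
  ∑ Qs (λ Q → wt (total γ) γ (sDes (total γ) Q)) ∎
  where
  open ≡-Reasoning
  Qs : List (List Cell)
  Qs = SYT (total γ) la mu
  -- A predecessor for the first cell; the start bit at the head of every member of the family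
  -- admits any step out of it.
  start : Cell
  start = (true , (0 , 0))
  len : ∀ {Q} → Q ∈ Qs → length Q ≡ total γ
  len Q∈ = proj₁ (∈-allLists⁻ (total γ) (proj₁ (∈-filterᵇ⁻ (allLists (total γ) (cellsBi la mu)) Q∈)))

cycleTypes-Positive : ∀ {n} (w : SignedPerm n) → w ∈ Bn n → All Positive (cycleTypes w)
cycleTypes-Positive w w∈ = Allₚ.map⁺ (All.tabulate (λ {i} _ → Orbits.Return.positive
  (Orbits.period-Return w (injectiveV⁻ (proj₁ w) (Bn⁻ w∈)) i)))

character-formula : ∀ {la mu α β} → Linked _≥_ la → Linked _≥_ mu → Linked _≥_ α → Linked _≥_ β →
  ∀ γ → All Positive γ → size la + size mu ≡ total γ → γ ↭ arrangement α β →
  ∀ χ → IsIrrChar (total γ) la mu χ → χ α β ≡ ∑ (SYT (total γ) la mu) (λ Q → wt (total γ) γ (sDes (total γ) Q))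
character-formula {la} {mu} {α} {β} hla hmu hα hβ γ pos s p χ irr = ℤₚ.*-cancelˡ-≡ D _ _ {{nonzero}} (begin
  D *ᶻ χ α β
    ≡⟨ trans (ℤₚ.*-comm D (χ α β)) (cong (χ α β *ᶻ_) (sym (∑-matchings γ pos))) ⟩
  χ α β *ᶻ ∑ (Bn n) (λ w → matchings γ (cycleTypes w))
    ≡⟨ sym (∑-*ˡ (Bn n) (χ α β)) ⟩
  ∑ (Bn n) (λ w → χ α β *ᶻ matchings γ (cycleTypes w))
    ≡⟨ ∑-cong∈ (Bn n) (λ {w} w∈ → class w (matchings-0-or-↭ γ (cycleTypes w))) ⟩
  ∑ (Bn n) (λ w → χw w *ᶻ matchings γ (cycleTypes w))
    ≡⟨ ∑-cong∈ (Bn n) (λ {w} w∈ → cong (χw w *ᶻ_) (sym (coeff-matchings family proj₁ (λ _ → runsMono ∘ proj₂) familyWeight-multiplicative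
         γ (alphaOf w) (betaOf w) (cycleTypes w) (arrangement-↭ w) pos (cycleTypes-Positive w w∈)))) ⟩
  ∑ (Bn n) (λ w → χw w *ᶻ ∑ (family γ) (λ f → proj₁ f *ᶻ pw w f))
    ≡⟨ ∑-cong (Bn n) (λ w → trans (sym (∑-*ˡ (family γ) (χw w))) (∑-cong (family γ) (λ f → *-exchange (χw w) (proj₁ f) (pw w f)))) ⟩
  ∑ (Bn n) (λ w → ∑ (family γ) (λ f → proj₁ f *ᶻ (χw w *ᶻ pw w f)))
    ≡⟨ ∑-swap (Bn n) (family γ) ⟩
  ∑ (family γ) (λ f → ∑ (Bn n) (λ w → proj₁ f *ᶻ (χw w *ᶻ pw w f)))
    -- The characteristic identity in n variables, at each monomial of the family.
    ≡⟨ ∑-cong (family γ) (λ f → trans (∑-*ˡ (Bn n) (proj₁ f)) (trans (cong (proj₁ f *ᶻ_) (irr n (runsMono (proj₂ f))))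
         (*-exchange (proj₁ f) D (coeff (schurXY n la mu) (runsMono (proj₂ f)))))) ⟩
  ∑ (family γ) (λ f → D *ᶻ (proj₁ f *ᶻ coeff (schurXY n la mu) (runsMono (proj₂ f))))
    ≡⟨ trans (∑-*ˡ (family γ) D) (cong (D *ᶻ_) (∑-family-schurXY hla hmu γ pos s)) ⟩
  D *ᶻ ∑ (SYT n la mu) (λ Q → wt n γ (sDes n Q)) ∎)
  where
  open ≡-Reasoning
  n : ℕ
  n = total γ
  D : ℤ
  D = ⁺ (2 ^ n * n !)
  nonzero : Data.Integer.NonZero D
  nonzero = ℕₚ.m*n≢0 (2 ^ n) (n !) {{ℕₚ.m^n≢0 2 n}} {{ℕₚ._!≢0 n}}
  χw : SignedPerm n → ℤ
  χw w = χ (alphaOf w) (betaOf w)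
  pw : SignedPerm n → ℤ × Signing n → ℤ
  pw w f = coeff (pPM n (alphaOf w) (betaOf w)) (runsMono (proj₂ f))
  descending : ∀ {ks} → Linked _≥_ ks → AllPairs _≥_ ks
  descending = Linkedₚ.Linked⇒AllPairs (λ x y → ℕₚ.≤-trans y x)
  -- `matchings` acts as an indicator of the class: where it does not vanish, w has the type (α ,
  -- β), and the lists agree literally because all of them are descending.
  class : ∀ w → matchings γ (cycleTypes w) ≡ 0ℤ ⊎ cycleTypes w ↭ γ → χ α β *ᶻ matchings γ (cycleTypes w) ≡ χw w *ᶻ matchings γ
    (cycleTypes w)
  class w (inj₁ e) = trans (cong (χ α β *ᶻ_) e) (trans (ℤₚ.*-zeroʳ (χ α β)) (sym (trans (cong (χw w *ᶻ_) e) (ℤₚ.*-zeroʳ (χw w)))))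
  class w (inj₂ q) with arrangement-injective {α} {β} {alphaOf w} {betaOf w} (descending hα) (descending hβ)
    (sortDesc-sorted (map (returnTime w) (filterᵇ (λ i → isRep w i ∧ not (negCycle w i)) (allFinL n))))
    (sortDesc-sorted (map (returnTime w) (filterᵇ (λ i → isRep w i ∧ negCycle w i) (allFinL n))))
    (↭-trans (↭-sym p) (↭-trans (↭-sym q) (↭-sym (arrangement-↭ w))))
  ... | α≡ , β≡ = cong (_*ᶻ matchings γ (cycleTypes w)) (cong₂ χ α≡ β≡)

arrangement-total : ∀ α β → total (arrangement α β) ≡ size α + size β
arrangement-total α β = trans (total-++ (map (_, false) α) (map (_, true) β)) (cong₂ _+_ (tagged false α) (tagged true β))
  where
  tagged : ∀ b ks → total (map (_, b) ks) ≡ size ks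
  tagged b []       = refl
  tagged b (k ∷ ks) = cong (k +_) (tagged b ks)

arrangement-Positive : ∀ {α β} → All (0 <_) α → All (0 <_) β → All Positive (arrangement α β)
arrangement-Positive p q = Allₚ.++⁺ (Allₚ.map⁺ p) (Allₚ.map⁺ q)

theorem4p1 : (n : ℕ) (la mu α β : List ℕ) →
    IsPartition la → IsPartition mu → size la + size mu ≡ n →
    IsPartition α → IsPartition β → size α + size β ≡ n →
    (γ : List (ℕ × Bool)) → γ ↭ arrangement α β →
    (χ : List ℕ → List ℕ → ℤ) → IsIrrChar n la mu χ →
    χ α β ≡ sumℤ (map (λ Q → wt n γ (sDes n Q)) (SYT n la mu))
theorem4p1 n la mu α β (_ , hla) (_ , hmu) s (α>0 , hα) (β>0 , hβ) s' γ p χ irr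
  -- Replaces n by `total γ`, by which the exponent vectors of the functional are indexed.
  with refl ← trans (trans (total-↭ p) (arrangement-total α β)) s' =
  character-formula hla hmu hα hβ γ (Permₚ.All-resp-↭ (↭-sym p) (arrangement-Positive α>0 β>0)) s p χ irr
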